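{- $b(6)=6^{ -6}$.
   Context: For a finite set $X$, $K_X$ is the complete graph on $X$, and a probability mass $\mu$ on $\binom{X}{2}$ is a function from the 2-element subsets of $X$ (edges of $K_X$) to $[0,1]$ with total sum $1$. For a graph $G$ and $m\geq 3$, $\mathcal C_m(G)$ is the set of (unlabeled) copies of the $m$-cycle $C_m$ in $G$. For a subgraph $G\subseteq K_X$, $\mu(G)=\prod_{e\in E(G)}\mu(e)$. Define $b(\mu;m)=\sum_{C\in\mathcal C_m(K_X)}\mu(C)$, and $b(m)=\sup\{b(\mu;m)\}$, the supremum over all finite sets $X$ and all probability masses $\mu$ on $\binom X2$.
   Formalization: The probability masses take rational values in [0,1] instead of real ones, so the supremum b(6) is taken over rational masses (and the approximation tolerance is rational). -}

module Defs where

open import Data.Bool using (Bool; true; false; _∧_; not; if_then_else_)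
open import Data.Nat as ℕ using (ℕ; _^_)
open import Data.Fin using (Fin; toℕ)
open import Data.List using (List; map; foldr; allFin)
open import Data.Integer using (+_)
open import Data.Rational using (ℚ; 0ℚ; 1ℚ; _+_; _*_; _/_; _≤_)
open import Data.Product using (_×_)
open import Relation.Binary.PropositionalEquality using (_≡_)

-- Vertex set X = Fin n (every finite set is in bijection with some Fin n).
-- A (candidate) probability mass on the edges of K_n is given as a symmetric
-- function μ : Fin n → Fin n → ℚ; the value μ i j (i ≠ j) is the mass of
-- the edge {i,j}.  Diagonal values are never used.

Σᶠ : {n : ℕ} → (Fin n → ℚ) → ℚ
Σᶠ {n} f = foldr _+_ 0ℚ (map f (allFin n))

_<ᶠ_ : {n : ℕ} → Fin n → Fin n → Bool
i <ᶠ j = toℕ i ℕ.<ᵇ toℕ j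

_≢ᶠ_ : {n : ℕ} → Fin n → Fin n → Bool
i ≢ᶠ j = not (toℕ i ℕ.≡ᵇ toℕ j)

record IsProbMass {n : ℕ} (μ : Fin n → Fin n → ℚ) : Set where
  field
    symmetric : ∀ i j → μ i j ≡ μ j i
    nonneg    : ∀ i j → 0ℚ ≤ μ i j
    atMostOne : ∀ i j → μ i j ≤ 1ℚ
    total     : Σᶠ (λ i → Σᶠ (λ j → if i <ᶠ j then μ i j else 0ℚ)) ≡ 1ℚ

-- Each unlabeled copy of C_6 in K_n is v0 v1 v2 v3 v4 v5 v0 for distinct
-- vertices; it is counted exactly once by taking the canonical labelling
-- with v0 the smallest vertex and v1 < v5 (fixing rotation and reflection).
canonical6 : {n : ℕ} → Fin n → Fin n → Fin n → Fin n → Fin n → Fin n → Bool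
canonical6 v0 v1 v2 v3 v4 v5 =
  (v0 <ᶠ v1) ∧ (v0 <ᶠ v2) ∧ (v0 <ᶠ v3) ∧ (v0 <ᶠ v4) ∧ (v0 <ᶠ v5) ∧
  (v1 ≢ᶠ v2) ∧ (v1 ≢ᶠ v3) ∧ (v1 ≢ᶠ v4) ∧ (v1 <ᶠ v5) ∧
  (v2 ≢ᶠ v3) ∧ (v2 ≢ᶠ v4) ∧ (v2 ≢ᶠ v5) ∧
  (v3 ≢ᶠ v4) ∧ (v3 ≢ᶠ v5) ∧
  (v4 ≢ᶠ v5)

b6 : {n : ℕ} → (Fin n → Fin n → ℚ) → ℚ
b6 μ =
  Σᶠ λ v0 → Σᶠ λ v1 → Σᶠ λ v2 → Σᶠ λ v3 → Σᶠ λ v4 → Σᶠ λ v5 →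
    if canonical6 v0 v1 v2 v3 v4 v5
    then μ v0 v1 * μ v1 v2 * μ v2 v3 * μ v3 v4 * μ v4 v5 * μ v5 v0
    else 0ℚ

sixPowMinusSix : ℚ
sixPowMinusSix = + 1 / (6 ^ 6)

{-# OPTIONS --safe #-}

-- Scale the mass by 6, so that the total is 6 and the total weight of the 6-cycles has to be
-- at most 1.  Let c(e) be the total weight of the 5-edge paths joining the ends of e, that is,
-- the derivative of the weight of all cycles in the weight of e.  If c(e) ≤ 1 for an edge e of
-- weight at least 1/6, then taking a little weight off e and rescaling increases any excess over
-- 1 by a fixed amount; as the weight of all cycles is bounded, this cannot go on forever.  Hence
-- it suffices to refute that c(e) > 1 for all edges e of weight at least 1/6.
--
-- The stars of the successive vertices of a path, each in the graph without the earlier vertices,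
-- are disjoint, so by AM-GM the k-edge paths from a given vertex have total weight at most
-- (E / k) ^ k, where E is the mass available.  Seen from an end v of e, c(e) > 1 therefore forces
-- a second heavy edge at v and leaves little mass for the other edges at v.  Starting from the
-- heaviest edge vp one thus follows a path of heavy edges; estimating the few paths that leave it
-- by AM-GM gives a polynomial bound for c(vp), which turns out to be at most 1.

module Submission where

open import Defs
open import Algebra.Bundles using (module CommutativeRing)
open import Data.Bool.Base using (Bool; true; false; T; not; _∧_; _∨_; if_then_else_)
open import Data.Bool.Properties using (T-∧; T-≡; ¬-not)
open import Data.Empty using (⊥)
open import Data.Fin.Base as Fin using (Fin; zero; suc)
open import Data.Fin.Patterns
open import Data.Fin.Properties as Fin using (_≟_; any?)
import Data.Integer.Base as ℤ
import Data.Integer.Properties as ℤ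
open import Data.List.Base as List using (List; []; _∷_)
open import Data.List.Relation.Unary.All as ListAll using ([]; _∷_)
open import Data.List.Relation.Unary.AllPairs as ListAllPairs using ([]; _∷_)
open import Data.Nat.Base as ℕ using (ℕ; zero; suc)
import Data.Nat.Properties as ℕ
open import Data.Product using (_×_; Σ; ∃; ∃₂; _,_; proj₁; proj₂)
open import Data.Rational hiding (_≟_)
open import Data.Rational.Properties as ℚₚ hiding (_≟_)
open import Data.Rational.Solver using (module +-*-Solver)
import Data.Rational.Unnormalised.Base as ℚᵘ
import Data.Rational.Unnormalised.Properties as ℚᵘ
open import Data.Sum using (_⊎_; inj₁; inj₂)
open import Data.Vec.Base using (Vec; []; _∷_; _∷ʳ_; _[_]≔_; allFin; foldr; head; lookup; map; reverse; tail)
open import Data.Vec.Properties using (lookup∘update; lookup∘update′; reverse-∷)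
open import Data.Vec.Relation.Unary.All as All using (All; []; _∷_; all?)
open import Data.Vec.Relation.Unary.AllPairs using ([]; _∷_; allPairs?)
open import Data.Vec.Relation.Unary.Unique.Propositional using (Unique)
open import Function.Base using (id; _∘_)
open import Function.Bundles using (module Equivalence)
open import Relation.Binary.Definitions using (tri<; tri≈; tri>)
open import Relation.Binary.PropositionalEquality
open import Relation.Nullary using (¬_; Dec; yes; no; does)
open import Relation.Nullary.Decidable using (isYes; toWitness; dec-true; dec-false; decidable-stable; ¬?; T?; _×-dec_)
open import Relation.Nullary.Negation using (contradiction)
open import Algebra.Properties.Group +-0-group using (x∙y⁻¹≈ε⇒x≈y)
open import Algebra.Properties.Semiring.Sum (CommutativeRing.semiring +-*-commutativeRing)

-- Polynomial inequalities in nonnegative variables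

-- At a mass maximising the cycle weight F, a Lagrange multiplier would give c(e) = F on every edge
-- of positive weight, so F > 1 would force c(e) > 1 there. Over the rationals no maximiser is at
-- hand; the shift of weight takes its place, and it needs an edge that can spare an amount
-- proportional to the excess. The threshold 1/6 serves both ends: it leaves room for the shift, and
-- if all weights lie below 1/6, then c(e) ≤ (1/6)(6/4)^4 < 1 for every e. The obstacle is the
-- hexagon with all scaled weights equal to 1, where the bound is attained. No mass leaves the path
-- of heavy edges there, so the whole chain of path estimates has to be exact at that point; this is
-- why `R` vanishes at M = 1. The estimates are also kept polynomial, since their comparison is left
-- to sign checks on coefficients.

⟨_⟩ : ℕ → ℚ
⟨ n ⟩ = ℤ.+ n / 1

0≤+ : ∀ {p q} → 0ℚ ≤ p → 0ℚ ≤ q → 0ℚ ≤ p + q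
0≤+ = +-mono-≤

0≤* : ∀ {p q} → 0ℚ ≤ p → 0ℚ ≤ q → 0ℚ ≤ p * q
0≤* {p} {q} 0≤p 0≤q = nonNegative⁻¹ (p * q)
  {{nonNeg*nonNeg⇒nonNeg p {{nonNegative 0≤p}} q {{nonNegative 0≤q}}}}

≤⇒0≤- : ∀ {p q} → p ≤ q → 0ℚ ≤ q - p
≤⇒0≤- {p} {q} p≤q = subst (_≤ q - p) (+-inverseʳ p) (+-monoˡ-≤ (- p) p≤q)

0≤-⇒≤ : ∀ {p q} → 0ℚ ≤ q - p → p ≤ q
0≤-⇒≤ {p} {q} h = subst₂ _≤_ (+-identityˡ p)
  (+-*-Solver.solve 2 (λ p q → (q :- p) :+ p := q) refl p q) (+-monoˡ-≤ p h)
  where open +-*-Solver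

module Polynomial where

  infixl 6 _⊞_ _⊟_
  infixl 7 _⊠_
  infix 4 _⊑_

  data Expr (n : ℕ) : Set where
    var : Fin n → Expr n
    con : ℚ → Expr n
    _⊞_ _⊟_ _⊠_ : Expr n → Expr n → Expr n

  ⟦_⟧ : ∀ {n} → Expr n → Vec ℚ n → ℚ
  ⟦ var i ⟧ ρ = lookup ρ i
  ⟦ con q ⟧ ρ = q
  ⟦ e ⊞ f ⟧ ρ = ⟦ e ⟧ ρ + ⟦ f ⟧ ρ
  ⟦ e ⊟ f ⟧ ρ = ⟦ e ⟧ ρ - ⟦ f ⟧ ρ
  ⟦ e ⊠ f ⟧ ρ = ⟦ e ⟧ ρ * ⟦ f ⟧ ρ

  -- Dense recursive form: the list of coefficients in the first variable, lowest degree first, each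
  -- a polynomial in the remaining variables. Trailing zeros are harmless, as only the signs or the
  -- vanishing of all coefficients are tested.
  Poly : ℕ → Set
  Poly zero    = ℚ
  Poly (suc n) = List (Poly n)

  eval : ∀ {n} → Poly n → Vec ℚ n → ℚ
  eval {zero}  q        ρ       = q
  eval {suc n} []       (x ∷ ρ) = 0ℚ
  eval {suc n} (p ∷ ps) (x ∷ ρ) = eval p ρ + x * eval ps (x ∷ ρ)

  constant : ∀ {n} → ℚ → Poly n
  constant {zero}  q = q
  constant {suc n} q = constant q ∷ []

  indeterminate : ∀ {n} → Fin n → Poly n
  indeterminate zero    = constant 0ℚ ∷ constant 1ℚ ∷ []
  indeterminate (suc i) = indeterminate i ∷ []

  add : ∀ {n} → Poly n → Poly n → Poly n
  add {zero}  p        q        = p + q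
  add {suc n} []       q        = q
  add {suc n} (p ∷ ps) []       = p ∷ ps
  add {suc n} (p ∷ ps) (q ∷ qs) = add p q ∷ add ps qs

  mul   : ∀ {n} → Poly n → Poly n → Poly n
  scale : ∀ {n} → Poly n → Poly (suc n) → Poly (suc n)
  mul {zero}  p        q = p * q
  mul {suc n} []       q = []
  mul {suc n} (p ∷ ps) q = add (scale p q) (constant 0ℚ ∷ mul ps q)
  scale p []       = []
  scale p (q ∷ qs) = mul p q ∷ scale p qs

  normalise : ∀ {n} → Expr n → Poly n
  normalise (var i) = indeterminate i
  normalise (con q) = constant q
  normalise (e ⊞ f) = add (normalise e) (normalise f)
  normalise (e ⊟ f) = add (normalise e) (mul (constant (- 1ℚ)) (normalise f))
  normalise (e ⊠ f) = mul (normalise e) (normalise f)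

  eval-constant : ∀ {n} q (ρ : Vec ℚ n) → eval (constant {n} q) ρ ≡ q
  eval-constant {zero}  q ρ       = refl
  eval-constant {suc n} q (x ∷ ρ) = begin
    eval (constant q) ρ + x * 0ℚ ≡⟨ cong₂ _+_ (eval-constant q ρ) (*-zeroʳ x) ⟩
    q + 0ℚ                       ≡⟨ +-identityʳ q ⟩
    q                            ∎
    where open ≡-Reasoning

  eval-indeterminate : ∀ {n} i (ρ : Vec ℚ n) → eval (indeterminate i) ρ ≡ lookup ρ i
  eval-indeterminate zero (x ∷ ρ)
    rewrite eval-constant 0ℚ ρ | eval-constant 1ℚ ρ =
    solve 1 (λ x → con 0ℚ :+ x :* (con 1ℚ :+ x :* con 0ℚ) := x) refl x
    where open +-*-Solver
  eval-indeterminate (suc i) (x ∷ ρ)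
    rewrite eval-indeterminate i ρ | *-zeroʳ x = +-identityʳ (lookup ρ i)

  eval-add : ∀ {n} p q (ρ : Vec ℚ n) → eval (add p q) ρ ≡ eval p ρ + eval q ρ
  eval-add {zero}  p        q        ρ       = refl
  eval-add {suc n} []       q        (x ∷ ρ) = sym (+-identityˡ _)
  eval-add {suc n} (p ∷ ps) []       (x ∷ ρ) = sym (+-identityʳ _)
  eval-add {suc n} (p ∷ ps) (q ∷ qs) (x ∷ ρ)
    rewrite eval-add p q ρ | eval-add ps qs (x ∷ ρ) =
    solve 5 (λ a b c d x → a :+ b :+ x :* (c :+ d) := a :+ x :* c :+ (b :+ x :* d))
      refl (eval p ρ) (eval q ρ) (eval ps (x ∷ ρ)) (eval qs (x ∷ ρ)) x
    where open +-*-Solver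

  eval-mul   : ∀ {n} p q (ρ : Vec ℚ n) → eval (mul p q) ρ ≡ eval p ρ * eval q ρ
  eval-scale : ∀ {n} p q x (ρ : Vec ℚ n) →
               eval (scale p q) (x ∷ ρ) ≡ eval p ρ * eval q (x ∷ ρ)
  eval-mul {zero}  p        q ρ       = refl
  eval-mul {suc n} []       q (x ∷ ρ) = sym (*-zeroˡ (eval q (x ∷ ρ)))
  eval-mul {suc n} (p ∷ ps) q (x ∷ ρ)
    rewrite eval-add (scale p q) (constant 0ℚ ∷ mul ps q) (x ∷ ρ)
          | eval-scale p q x ρ | eval-mul ps q (x ∷ ρ) | eval-constant 0ℚ ρ =
    solve 4 (λ a b c x → a :* b :+ (con 0ℚ :+ x :* (c :* b)) := (a :+ x :* c) :* b)
      refl (eval p ρ) (eval q (x ∷ ρ)) (eval ps (x ∷ ρ)) x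
    where open +-*-Solver
  eval-scale p []       x ρ = sym (*-zeroʳ (eval p ρ))
  eval-scale p (q ∷ qs) x ρ
    rewrite eval-mul p q ρ | eval-scale p qs x ρ =
    solve 4 (λ a b c x → a :* b :+ x :* (a :* c) := a :* (b :+ x :* c))
      refl (eval p ρ) (eval q ρ) (eval qs (x ∷ ρ)) x
    where open +-*-Solver

  eval-normalise : ∀ {n} (e : Expr n) ρ → eval (normalise e) ρ ≡ ⟦ e ⟧ ρ
  eval-normalise (var i) ρ = eval-indeterminate i ρ
  eval-normalise (con q) ρ = eval-constant q ρ
  eval-normalise (e ⊞ f) ρ
    rewrite eval-add (normalise e) (normalise f) ρ
          | eval-normalise e ρ | eval-normalise f ρ = refl
  eval-normalise (e ⊟ f) ρ
    rewrite eval-add (normalise e) (mul (constant (- 1ℚ)) (normalise f)) ρ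
          | eval-mul (constant (- 1ℚ)) (normalise f) ρ | eval-constant (- 1ℚ) ρ
          | eval-normalise e ρ | eval-normalise f ρ =
    cong (λ q → ⟦ e ⟧ ρ + q) (neg-1 (⟦ f ⟧ ρ))
    where
    neg-1 : ∀ q → - 1ℚ * q ≡ - q
    neg-1 q = trans (sym (neg-distribˡ-* 1ℚ q)) (cong -_ (*-identityˡ q))
  eval-normalise (e ⊠ f) ρ
    rewrite eval-mul (normalise e) (normalise f) ρ
          | eval-normalise e ρ | eval-normalise f ρ = refl

  nonNeg? : ∀ {n} → Poly n → Bool
  nonNeg? {zero}  q        = isYes (0ℚ ≤? q)
  nonNeg? {suc n} []       = true
  nonNeg? {suc n} (p ∷ ps) = nonNeg? p ∧ nonNeg? ps

  eval-nonNeg : ∀ {n} (p : Poly n) → T (nonNeg? p) →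
                ∀ {ρ} → All (0ℚ ≤_) ρ → 0ℚ ≤ eval p ρ
  eval-nonNeg {zero}  q        t []        = toWitness t
  eval-nonNeg {suc n} []       t (px ∷ pρ) = ≤-refl
  eval-nonNeg {suc n} (p ∷ ps) t (px ∷ pρ) =
    let t₁ , t₂ = Equivalence.to T-∧ t in
    0≤+ (eval-nonNeg p t₁ pρ) (0≤* px (eval-nonNeg ps t₂ (px ∷ pρ)))

  zero? : ∀ {n} → Poly n → Bool
  zero? {zero}  q        = isYes (q ℚₚ.≟ 0ℚ)
  zero? {suc n} []       = true
  zero? {suc n} (p ∷ ps) = zero? p ∧ zero? ps

  eval-zero : ∀ {n} (p : Poly n) → T (zero? p) → ∀ ρ → eval p ρ ≡ 0ℚ
  eval-zero {zero}  q        t []      = toWitness t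
  eval-zero {suc n} []       t (x ∷ ρ) = refl
  eval-zero {suc n} (p ∷ ps) t (x ∷ ρ) =
    let t₁ , t₂ = Equivalence.to T-∧ t in begin
      eval p ρ + x * eval ps (x ∷ ρ)
        ≡⟨ cong₂ (λ a b → a + x * b) (eval-zero p t₁ ρ) (eval-zero ps t₂ (x ∷ ρ)) ⟩
      0ℚ + x * 0ℚ ≡⟨ +-identityˡ (x * 0ℚ) ⟩
      x * 0ℚ      ≡⟨ *-zeroʳ x ⟩
      0ℚ          ∎
    where open ≡-Reasoning

  -- A polynomial is certified by the signs of its coefficients, if need be after case
  -- distinctions: in the case xᵢ ≤ xⱼ of split i j the variable xⱼ is replaced by xᵢ + xⱼ,
  -- whose second summand is again nonnegative.
  data Certificate (n : ℕ) : Set where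
    coefficients : Certificate n
    split        : Fin n → Fin n → Certificate n → Certificate n → Certificate n

  raise : ∀ {n} → Fin n → Fin n → Expr n → Expr n
  raise i j (var k) with k Fin.≟ j
  ... | yes _ = var i ⊞ var j
  ... | no  _ = var k
  raise i j (con q) = con q
  raise i j (e ⊞ f) = raise i j e ⊞ raise i j f
  raise i j (e ⊟ f) = raise i j e ⊟ raise i j f
  raise i j (e ⊠ f) = raise i j e ⊠ raise i j f

  ⟦raise⟧ : ∀ {n} i j (e : Expr n) ρ → i ≢ j →
            ⟦ raise i j e ⟧ (ρ [ j ]≔ (lookup ρ j - lookup ρ i)) ≡ ⟦ e ⟧ ρ
  ⟦raise⟧ i j (var k) ρ i≢j with k Fin.≟ j
  ... | yes refl rewrite lookup∘update′ i≢j ρ (lookup ρ j - lookup ρ i)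
                       | lookup∘update j ρ (lookup ρ j - lookup ρ i) =
    solve 2 (λ a b → a :+ (b :- a) := b) refl (lookup ρ i) (lookup ρ j)
    where open +-*-Solver
  ... | no k≢j = lookup∘update′ k≢j ρ (lookup ρ j - lookup ρ i)
  ⟦raise⟧ i j (con q) ρ i≢j = refl
  ⟦raise⟧ i j (e ⊞ f) ρ i≢j = cong₂ _+_ (⟦raise⟧ i j e ρ i≢j) (⟦raise⟧ i j f ρ i≢j)
  ⟦raise⟧ i j (e ⊟ f) ρ i≢j = cong₂ _-_ (⟦raise⟧ i j e ρ i≢j) (⟦raise⟧ i j f ρ i≢j)
  ⟦raise⟧ i j (e ⊠ f) ρ i≢j = cong₂ _*_ (⟦raise⟧ i j e ρ i≢j) (⟦raise⟧ i j f ρ i≢j)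

  check : ∀ {n} → Certificate n → Expr n → Bool
  check coefficients    e = nonNeg? (normalise e)
  check (split i j c d) e with i Fin.≟ j
  -- For i = j the substitution would double a variable instead of describing a case, so such a
  -- certificate is rejected.
  ... | yes _ = false
  ... | no  _ = check c (raise i j e) ∧ check d (raise j i e)

  All-update : ∀ {n} {ρ : Vec ℚ n} → All (0ℚ ≤_) ρ → ∀ j {q} → 0ℚ ≤ q → All (0ℚ ≤_) (ρ [ j ]≔ q)
  All-update (px ∷ pρ) zero    pq = pq ∷ pρ
  All-update (px ∷ pρ) (suc j) pq = px ∷ All-update pρ j pq

  sound : ∀ {n} (c : Certificate n) e → T (check c e) →
          ∀ {ρ} → All (0ℚ ≤_) ρ → 0ℚ ≤ ⟦ e ⟧ ρ
  sound coefficients e t {ρ} pρ =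
    subst (0ℚ ≤_) (eval-normalise e ρ) (eval-nonNeg (normalise e) t pρ)
  sound (split i j c d) e t {ρ} pρ with i Fin.≟ j
  ... | no i≢j with ≤-total (lookup ρ i) (lookup ρ j)
  ...   | inj₁ le = subst (0ℚ ≤_) (⟦raise⟧ i j e ρ i≢j)
    (sound c (raise i j e) (proj₁ (Equivalence.to T-∧ t)) (All-update pρ j (≤⇒0≤- le)))
  ...   | inj₂ ge = subst (0ℚ ≤_) (⟦raise⟧ j i e ρ (≢-sym i≢j))
    (sound d (raise j i e) (proj₂ (Equivalence.to T-∧ t)) (All-update pρ i (≤⇒0≤- ge)))

  -- If the variables sum to 1, the signs are read off after homogenising (Pólya).
  variableSum : ∀ {n} → Expr n
  variableSum = foldr _ _⊞_ (con 0ℚ) (map var (allFin _))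

  raiseDegree : ∀ {n} → ℕ → Expr n → Expr n
  raiseDegree zero    e = e
  raiseDegree (suc k) e = raiseDegree k e ⊠ variableSum

  degree : ∀ {n} → Expr n → ℕ
  degree (var i) = 1
  degree (con q) = 0
  degree (e ⊞ f) = degree e ℕ.⊔ degree f
  degree (e ⊟ f) = degree e ℕ.⊔ degree f
  degree (e ⊠ f) = degree e ℕ.+ degree f

  homogenise : ∀ {n} → Expr n → Expr n
  homogenise (var i) = var i
  homogenise (con q) = con q
  homogenise (e ⊞ f) = raiseDegree (degree f ℕ.∸ degree e) (homogenise e)
                     ⊞ raiseDegree (degree e ℕ.∸ degree f) (homogenise f)
  homogenise (e ⊟ f) = raiseDegree (degree f ℕ.∸ degree e) (homogenise e)
                     ⊟ raiseDegree (degree e ℕ.∸ degree f) (homogenise f)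
  homogenise (e ⊠ f) = homogenise e ⊠ homogenise f

  module _ {n} {ρ : Vec ℚ n} (∑ρ≡1 : ⟦ variableSum ⟧ ρ ≡ 1ℚ) where

    ⟦raiseDegree⟧ : ∀ k e → ⟦ raiseDegree k e ⟧ ρ ≡ ⟦ e ⟧ ρ
    ⟦raiseDegree⟧ zero    e = refl
    ⟦raiseDegree⟧ (suc k) e =
      trans (cong₂ _*_ (⟦raiseDegree⟧ k e) ∑ρ≡1) (*-identityʳ (⟦ e ⟧ ρ))

    ⟦homogenise⟧ : ∀ e → ⟦ homogenise e ⟧ ρ ≡ ⟦ e ⟧ ρ
    ⟦homogenise⟧ (var i) = refl
    ⟦homogenise⟧ (con q) = refl
    ⟦homogenise⟧ (e ⊞ f) = cong₂ _+_
      (trans (⟦raiseDegree⟧ (degree f ℕ.∸ degree e) (homogenise e)) (⟦homogenise⟧ e))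
      (trans (⟦raiseDegree⟧ (degree e ℕ.∸ degree f) (homogenise f)) (⟦homogenise⟧ f))
    ⟦homogenise⟧ (e ⊟ f) = cong₂ _-_
      (trans (⟦raiseDegree⟧ (degree f ℕ.∸ degree e) (homogenise e)) (⟦homogenise⟧ e))
      (trans (⟦raiseDegree⟧ (degree e ℕ.∸ degree f) (homogenise f)) (⟦homogenise⟧ f))
    ⟦homogenise⟧ (e ⊠ f) = cong₂ _*_ (⟦homogenise⟧ e) (⟦homogenise⟧ f)

  record Claim (n : ℕ) : Set where
    constructor _⊑_
    field
      lhs rhs : Expr n

  open Claim

  -- Passing the variables as a vector lets a claim be written as a pattern-matching function that
  -- names them.
  claim : ∀ {n} → (Vec (Expr n) n → Claim n) → Claim n
  claim f = f (map var (allFin _))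

  difference : ∀ {n} → (Vec (Expr n) n → Claim n) → Expr n
  difference f = rhs (claim f) ⊟ lhs (claim f)

  -- The implicit `T` argument is filled by computation: it becomes the unit type once the check
  -- evaluates to `true`.
  inequality : ∀ {n} (ρ : Vec ℚ n) → All (0ℚ ≤_) ρ →
               (f : Vec (Expr n) n → Claim n) (c : Certificate n) →
               {T (check c (difference f))} →
               ⟦ lhs (claim f) ⟧ ρ ≤ ⟦ rhs (claim f) ⟧ ρ
  inequality ρ pρ f c {t} = 0≤-⇒≤ (sound c (difference f) t pρ)

  simplexInequality : ∀ {n} (ρ : Vec ℚ n) → All (0ℚ ≤_) ρ → ⟦ variableSum ⟧ ρ ≡ 1ℚ →
                      (f : Vec (Expr n) n → Claim n) (c : Certificate n) →
                      {T (check c (homogenise (difference f)))} →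
                      ⟦ lhs (claim f) ⟧ ρ ≤ ⟦ rhs (claim f) ⟧ ρ
  simplexInequality ρ pρ ∑ρ≡1 f c {t} = 0≤-⇒≤
    (subst (0ℚ ≤_) (⟦homogenise⟧ ∑ρ≡1 (difference f))
      (sound c (homogenise (difference f)) t pρ))

  -- Here `⊑` is read as an equation: all coefficients of the difference must be zero, so it holds
  -- for variables of any sign.
  identity : ∀ {n} (ρ : Vec ℚ n) (f : Vec (Expr n) n → Claim n) →
             {T (zero? (normalise (difference f)))} →
             ⟦ lhs (claim f) ⟧ ρ ≡ ⟦ rhs (claim f) ⟧ ρ
  identity ρ f {t} = sym (x∙y⁻¹≈ε⇒x≈y _ _
    (trans (sym (eval-normalise (difference f) ρ)) (eval-zero (normalise (difference f)) t ρ)))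

open Polynomial

-- Numerical estimates

-- The bounds are needed both as rational numbers and as polynomial expressions.
module Bound {A : Set} (_⊕_ _⊝_ _⊗_ : A → A → A) (# : ℚ → A) where

  -- power k E = (E / k) ^ k
  power : ℕ → A → A
  power zero    E = # 1ℚ
  power (suc k) E = pow (suc k)
    where
    pow : ℕ → A
    pow zero          = # 1ℚ
    pow (suc zero)    = # (ℤ.+ 1 / suc k) ⊗ E
    pow (suc (suc j)) = (# (ℤ.+ 1 / suc k) ⊗ E) ⊗ pow (suc j)

  -- M is the largest weight and E the mass that is still available.  At a vertex with a heavy
  -- edge of weight h, thin M h bounds the weight of all edges except this one and the heaviest
  -- other one, which has weight h′; Vₖ bounds the k-edge paths that continue beyond the edge of
  -- weight h (for V₄ that edge has weight M, and h and h′ are the weights of the next two).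
  R : A → A
  R M = # ½ ⊗ (# 1ℚ ⊝ (M ⊗ M))

  thin : A → A → A
  thin M h = R M ⊕ (M ⊝ h)

  V₂ : A → A → A → A
  V₂ M h E = ((M ⊗ (M ⊕ R M)) ⊕ power 2 (M ⊝ h)) ⊕ (thin M h ⊗ ((E ⊝ M) ⊝ thin M h))

  V₃ : A → A → A → A → A
  V₃ M h h′ E = (h′ ⊗ V₂ M h′ E′) ⊕ (thin M h ⊗ power 2 E′)
    where E′ = (E ⊝ h′) ⊝ thin M h

  V₄ : A → A → A → A → A
  V₄ M h h′ E = (h ⊗ V₃ M h h′ E′) ⊕ (R M ⊗ power 3 E′)
    where E′ = (E ⊝ h) ⊝ R M

open Bound _+_ _-_ _*_ id
module ^ {n : ℕ} = Bound (_⊞_ {n}) _⊟_ _⊠_ con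

<⇒≱ : ∀ {p q} → p < q → ¬ q ≤ p
<⇒≱ p<q q≤p = <-irrefl refl (<-≤-trans p<q q≤p)

≤-from : ∀ p q {r} → r ≡ q - p → 0ℚ ≤ r → p ≤ q
≤-from p q eq 0≤r = 0≤-⇒≤ (subst (0ℚ ≤_) eq 0≤r)

a+[b-a] : ∀ a b → a + (b - a) ≡ b
a+[b-a] a b = identity (a ∷ b ∷ []) λ { (a ∷ b ∷ []) → a ⊞ (b ⊟ a) ⊑ b }

-- Writing b = a + d with d ≥ 0 makes all coefficients of the difference nonnegative. Gaps between
-- ordered quantities serve as variables in this way throughout.
power₄-mono : ∀ {a b} → 0ℚ ≤ a → a ≤ b → power 4 a ≤ power 4 b
power₄-mono {a} {b} pa a≤b = subst (λ b → power 4 a ≤ power 4 b) (a+[b-a] a b)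
  (inequality (a ∷ b - a ∷ []) (pa ∷ ≤⇒0≤- a≤b ∷ [])
    (λ { (a ∷ d ∷ []) → ^.power 4 a ⊑ ^.power 4 (a ⊞ d) }) coefficients)

power₅-mono : ∀ {a b} → 0ℚ ≤ a → a ≤ b → power 5 a ≤ power 5 b
power₅-mono {a} {b} pa a≤b = subst (λ b → power 5 a ≤ power 5 b) (a+[b-a] a b)
  (inequality (a ∷ b - a ∷ []) (pa ∷ ≤⇒0≤- a≤b ∷ [])
    (λ { (a ∷ d ∷ []) → ^.power 5 a ⊑ ^.power 5 (a ⊞ d) }) coefficients)

amgm₁ : ∀ {s t} → 0ℚ ≤ s → 0ℚ ≤ t → s * power 1 t ≤ power 2 (s + t)
amgm₁ {s} {t} ps pt = inequality (s ∷ t ∷ []) (ps ∷ pt ∷ [])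
  (λ { (s ∷ t ∷ []) → s ⊠ ^.power 1 t ⊑ ^.power 2 (s ⊞ t) }) (split 0F 1F coefficients coefficients)

-- Equality holds at s = t / 2, so t is written as twice u: on either side of s = u the difference
-- has nonnegative coefficients in the smaller variable and the gap. The next two cases follow the
-- same pattern with t / 3 and t / 4.
amgm₂ : ∀ {s t} → 0ℚ ≤ s → 0ℚ ≤ t → s * power 2 t ≤ power 3 (s + t)
amgm₂ {s} {t} ps pt = subst (λ t → s * power 2 t ≤ power 3 (s + t))
  (identity (t ∷ []) λ { (t ∷ []) → con ⟨ 2 ⟩ ⊠ (con ½ ⊠ t) ⊑ t })
  (inequality (s ∷ ½ * t ∷ []) (ps ∷ 0≤* (nonNegative⁻¹ ½) pt ∷ [])
    (λ { (s ∷ u ∷ []) → s ⊠ ^.power 2 (con ⟨ 2 ⟩ ⊠ u) ⊑ ^.power 3 (s ⊞ con ⟨ 2 ⟩ ⊠ u) })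
    (split 0F 1F coefficients coefficients))

amgm₃ : ∀ {s t} → 0ℚ ≤ s → 0ℚ ≤ t → s * power 3 t ≤ power 4 (s + t)
amgm₃ {s} {t} ps pt = subst (λ t → s * power 3 t ≤ power 4 (s + t))
  (identity (t ∷ []) λ { (t ∷ []) → con ⟨ 3 ⟩ ⊠ (con (ℤ.+ 1 / 3) ⊠ t) ⊑ t })
  (inequality (s ∷ ℤ.+ 1 / 3 * t ∷ []) (ps ∷ 0≤* (nonNegative⁻¹ (ℤ.+ 1 / 3)) pt ∷ [])
    (λ { (s ∷ u ∷ []) → s ⊠ ^.power 3 (con ⟨ 3 ⟩ ⊠ u) ⊑ ^.power 4 (s ⊞ con ⟨ 3 ⟩ ⊠ u) })
    (split 0F 1F coefficients coefficients))

amgm₄ : ∀ {s t} → 0ℚ ≤ s → 0ℚ ≤ t → s * power 4 t ≤ power 5 (s + t)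
amgm₄ {s} {t} ps pt = subst (λ t → s * power 4 t ≤ power 5 (s + t))
  (identity (t ∷ []) λ { (t ∷ []) → con ⟨ 4 ⟩ ⊠ (con (ℤ.+ 1 / 4) ⊠ t) ⊑ t })
  (inequality (s ∷ ℤ.+ 1 / 4 * t ∷ []) (ps ∷ 0≤* (nonNegative⁻¹ (ℤ.+ 1 / 4)) pt ∷ [])
    (λ { (s ∷ u ∷ []) → s ⊠ ^.power 4 (con ⟨ 4 ⟩ ⊠ u) ⊑ ^.power 5 (s ⊞ con ⟨ 4 ⟩ ⊠ u) })
    (split 0F 1F coefficients coefficients))

*-monoʳ : ∀ {p q r} → 0ℚ ≤ r → p ≤ q → r * p ≤ r * q
*-monoʳ {r = r} 0≤r = *-monoˡ-≤-nonNeg r {{nonNegative 0≤r}}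

*-monoˡ : ∀ {p q r} → 0ℚ ≤ r → p ≤ q → p * r ≤ q * r
*-monoˡ {r = r} 0≤r = *-monoʳ-≤-nonNeg r {{nonNegative 0≤r}}

-- Consequences of a heavy edge at one vertex

-- `d` is the total weight at an end of an edge e and `m` the largest weight there apart from e;
-- `heavy` is what c(e) > 1 becomes after the remaining four edges are bounded by AM-GM.
module Heavy {m d : ℚ} (0≤m : 0ℚ ≤ m) (0≤d : 0ℚ ≤ d) (d≤6 : d ≤ ⟨ 6 ⟩) (heavy : 1ℚ < m * power 4 (⟨ 6 ⟩ - d)) where

  -- If d - m ≥ 1, then m and 6 - d add up to at most 5, and AM-GM bounds m ((6 - d) / 4)^4 by (5 /
  -- 5)^5.
  heavy-rest<1 : d - m < 1ℚ
  heavy-rest<1 = ≰⇒> λ 1≤d-m → <⇒≱ heavy (begin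
    m * power 4 (⟨ 6 ⟩ - d)   ≤⟨ amgm₄ 0≤m (≤⇒0≤- d≤6) ⟩
    power 5 (m + (⟨ 6 ⟩ - d)) ≤⟨ power₅-mono (0≤+ 0≤m (≤⇒0≤- d≤6)) (≤-from (m + (⟨ 6 ⟩ - d)) ⟨ 5 ⟩
      (identity (m ∷ d ∷ []) λ { (m ∷ d ∷ []) → (d ⊟ m) ⊟ con 1ℚ ⊑ con ⟨ 5 ⟩ ⊟ (m ⊞ (con ⟨ 6 ⟩ ⊟ d)) })
      (≤⇒0≤- 1≤d-m)) ⟩
    power 5 ⟨ 5 ⟩ ∎)
    where open ≤-Reasoning

  -- Since 6 - d ≤ 6, m (6 / 4)^4 exceeds 1, and (4 / 6)^4 = 16 / 81.
  heavy-large : ℤ.+ 16 / 81 ≤ m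
  heavy-large = ≮⇒≥ λ m< → <⇒≱ heavy (begin
    m * power 4 (⟨ 6 ⟩ - d) ≤⟨ *-monoʳ 0≤m (power₄-mono (≤⇒0≤- d≤6)
      (≤-from (⟨ 6 ⟩ - d) ⟨ 6 ⟩ (identity (d ∷ []) λ { (d ∷ []) → d ⊑ con ⟨ 6 ⟩ ⊟ (con ⟨ 6 ⟩ ⊟ d) }) 0≤d)) ⟩
    m * power 4 ⟨ 6 ⟩       ≤⟨ *-monoˡ (nonNegative⁻¹ (power 4 ⟨ 6 ⟩)) (<⇒≤ m<) ⟩
    1ℚ ∎)
    where open ≤-Reasoning

  -- For m = M the critical value of d - m - M is 6 - 2M - 4M^(-1/4). The polynomial `R M` = (1 -
  -- M²) / 2 lies above it on (0, 1] and touches it with the same slope at M = 1, the value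
  -- belonging to the hexagon.
  heavy-degree : ∀ {M} → m ≤ M → M ≤ 1ℚ → d - m ≤ M + R M
  heavy-degree {M} m≤M M≤1 = ≮⇒≥ λ lt → <⇒≱ heavy (begin
    m * power 4 (⟨ 6 ⟩ - d) ≤⟨ *-monoʳ 0≤m (power₄-mono (≤⇒0≤- d≤6)
      (≤-from (⟨ 6 ⟩ - d) (⟨ 6 ⟩ - m - M - R M) (identity (m ∷ d ∷ M ∷ []) λ { (m ∷ d ∷ M ∷ []) →
        (d ⊟ m) ⊟ (M ⊞ ^.R M) ⊑ con ⟨ 6 ⟩ ⊟ m ⊟ M ⊟ ^.R M ⊟ (con ⟨ 6 ⟩ ⊟ d) }) (≤⇒0≤- (<⇒≤ lt)))) ⟩
    m * power 4 (⟨ 6 ⟩ - m - M - R M) ≤⟨ aux (1ℚ - M) (M - m) m (sym (trans (+-comm (M - m) m) (a+[b-a] m M))) (trans (+-comm (1ℚ - M) M) (a+[b-a] M 1ℚ)) (≤⇒0≤- M≤1) (≤⇒0≤- m≤M) 0≤m ⟩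
    1ℚ ∎)
    where
    open ≤-Reasoning
    -- The gaps 1 - M, M - m and m of the chain 0 ≤ m ≤ M ≤ 1 sum to 1, which makes them coordinates
    -- on a simplex.
    aux : ∀ x u m {M} → M ≡ u + m → x + M ≡ 1ℚ → 0ℚ ≤ x → 0ℚ ≤ u → 0ℚ ≤ m → m * power 4 (⟨ 6 ⟩ - m - M - R M) ≤ 1ℚ
    aux x u m refl ∑ px pu pm = simplexInequality (x ∷ u ∷ m ∷ []) (px ∷ pu ∷ pm ∷ [])
      (trans (identity (x ∷ u ∷ m ∷ []) λ { (x ∷ u ∷ m ∷ []) → variableSum ⊑ x ⊞ (u ⊞ m) }) ∑)
      (λ { (x ∷ u ∷ m ∷ []) → m ⊠ ^.power 4 (con ⟨ 6 ⟩ ⊟ m ⊟ (u ⊞ m) ⊟ ^.R (u ⊞ m)) ⊑ con 1ℚ }) coefficients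

0≤sq : ∀ p → 0ℚ ≤ p * p
0≤sq p with ≤-total 0ℚ p
... | inj₁ 0≤p = 0≤* 0≤p 0≤p
... | inj₂ p≤0 = subst (0ℚ ≤_) (identity (p ∷ []) λ { (p ∷ []) → (con 0ℚ ⊟ p) ⊠ (con 0ℚ ⊟ p) ⊑ p ⊠ p })
  (0≤* (≤⇒0≤- p≤0) (≤⇒0≤- p≤0))

-- Monotonicity of the path bounds

module Levels {M : ℚ} (0≤M : 0ℚ ≤ M) (M≤1 : M ≤ 1ℚ) where

  0≤R : 0ℚ ≤ R M
  0≤R = subst (0ℚ ≤_) (identity (M ∷ []) λ { (M ∷ []) → con ½ ⊠ ((con 1ℚ ⊟ M) ⊠ (con 1ℚ ⊞ M)) ⊑ ^.R M })
    (0≤* (nonNegative⁻¹ ½) (0≤* (≤⇒0≤- M≤1) (0≤+ (nonNegative⁻¹ 1ℚ) 0≤M)))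

  0≤thin : ∀ {h} → h ≤ M → 0ℚ ≤ thin M h
  0≤thin h≤M = 0≤+ 0≤R (≤⇒0≤- h≤M)

  -- The difference is exactly (1 - M)² / 2. It reduces h `thin M h` to h (1 - h), hence to at most
  -- 1/4.
  thin≤1- : ∀ h → 0ℚ ≤ 1ℚ - h - thin M h
  thin≤1- h = subst (0ℚ ≤_) (identity (h ∷ M ∷ []) λ { (h ∷ M ∷ []) →
    con ½ ⊠ ((con 1ℚ ⊟ M) ⊠ (con 1ℚ ⊟ M)) ⊑ con 1ℚ ⊟ h ⊟ ^.thin M h })
    (0≤* (nonNegative⁻¹ ½) (0≤sq (1ℚ - M)))

  thin-product : ∀ {h} → 0ℚ ≤ h → h * thin M h ≤ ℤ.+ 1 / 4
  thin-product {h} 0≤h = ≤-from (h * thin M h) (ℤ.+ 1 / 4)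
    (identity (h ∷ M ∷ []) λ { (h ∷ M ∷ []) →
      (con ½ ⊟ h) ⊠ (con ½ ⊟ h) ⊞ h ⊠ (con 1ℚ ⊟ h ⊟ ^.thin M h) ⊑ con (ℤ.+ 1 / 4) ⊟ h ⊠ ^.thin M h })
    (0≤+ (0≤sq (½ - h)) (0≤* 0≤h (thin≤1- h)))

  -- The hypothesis on E makes r (E - h′ - r) increase in r up to `thin M h`, so r may be raised to
  -- that value. What then depends on h′ is h′ (M + h - h′), largest at h′ = (M + h) / 2; `V₂`
  -- contains this maximum, and `d` in the identity is the distance of h′ from it.
  level₂ : ∀ {h h′ r E} → h ≤ M → 0ℚ ≤ h′ → h′ ≤ M → r ≤ thin M h →
           M + ⟨ 2 ⟩ * thin M h ≤ E →
           h′ * (M + thin M h′) + r * power 1 (E - h′ - r) ≤ V₂ M h E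
  level₂ {h} {h′} {r} {E} h≤M 0≤h′ h′≤M r≤ E≥ =
    ≤-from (h′ * (M + thin M h′) + r * power 1 (E - h′ - r)) (V₂ M h E)
    (identity (M ∷ h ∷ h′ ∷ r ∷ E ∷ []) λ { (M ∷ h ∷ h′ ∷ r ∷ E ∷ []) →
      let d = (M ⊟ h′) ⊟ con ½ ⊠ (M ⊟ h)
          σ = ^.thin M h ⊟ r in
      d ⊠ d ⊞ σ ⊠ ((E ⊟ (M ⊞ con ⟨ 2 ⟩ ⊠ ^.thin M h)) ⊞ σ ⊞ (M ⊟ h′)) ⊑
      ^.V₂ M h E ⊟ (h′ ⊠ (M ⊞ ^.thin M h′) ⊞ r ⊠ ^.power 1 (E ⊟ h′ ⊟ r)) })
    (0≤+ (0≤sq (M - h′ - ½ * (M - h)))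
      (0≤* (≤⇒0≤- r≤) (0≤+ (0≤+ (≤⇒0≤- E≥) (≤⇒0≤- r≤)) (≤⇒0≤- h′≤M))))

  module _ {h : ℚ} (0≤h : 0ℚ ≤ h) (h≤M : h ≤ M) where

    private
      x = 1ℚ - M
      y = M - h

      ∑ : ⟦ variableSum ⟧ (x ∷ h ∷ y ∷ []) ≡ 1ℚ
      ∑ = identity (M ∷ h ∷ []) λ { (M ∷ h ∷ []) →
        (con 1ℚ ⊟ M) ⊞ (h ⊞ ((M ⊟ h) ⊞ con 0ℚ)) ⊑ con 1ℚ }

      coords≥0 : All (0ℚ ≤_) (x ∷ h ∷ y ∷ [])
      coords≥0 = ≤⇒0≤- M≤1 ∷ 0≤h ∷ ≤⇒0≤- h≤M ∷ []

      M≡ : h + y ≡ M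
      M≡ = identity (M ∷ h ∷ []) λ { (M ∷ h ∷ []) → h ⊞ (M ⊟ h) ⊑ M }

    rest₂ : ⟨ 3 ⟩ ≤ ⟨ 6 ⟩ - ⟨ 2 ⟩ * M - ⟨ 2 ⟩ * R M - h
    rest₂ = subst (λ M → ⟨ 3 ⟩ ≤ ⟨ 6 ⟩ - ⟨ 2 ⟩ * M - ⟨ 2 ⟩ * R M - h) M≡
      (simplexInequality (x ∷ h ∷ y ∷ []) coords≥0 ∑ (λ { (x ∷ h ∷ y ∷ []) → let M = h ⊞ y in
        con ⟨ 3 ⟩ ⊑ con ⟨ 6 ⟩ ⊟ con ⟨ 2 ⟩ ⊠ M ⊟ con ⟨ 2 ⟩ ⊠ ^.R M ⊟ h }) coefficients)

    rest₂′ : ℤ.+ 5 / 2 ≤ ⟨ 6 ⟩ - ⟨ 2 ⟩ * M - ⟨ 2 ⟩ * R M - h - ⟨ 3 ⟩ * R M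
    rest₂′ = subst (λ M → ℤ.+ 5 / 2 ≤ ⟨ 6 ⟩ - ⟨ 2 ⟩ * M - ⟨ 2 ⟩ * R M - h - ⟨ 3 ⟩ * R M) M≡
      (simplexInequality (x ∷ h ∷ y ∷ []) coords≥0 ∑ (λ { (x ∷ h ∷ y ∷ []) → let M = h ⊞ y in
        con (ℤ.+ 5 / 2) ⊑ con ⟨ 6 ⟩ ⊟ con ⟨ 2 ⟩ ⊠ M ⊟ con ⟨ 2 ⟩ ⊠ ^.R M ⊟ h ⊟ con ⟨ 3 ⟩ ⊠ ^.R M })
        (split 0F 1F coefficients coefficients))

    -- Lower bounds for e and e - 2ρ in the three-edge step, where the present h appears as h′. In
    -- `massBound h - h′ - thin M h` the previous weight h cancels, which leaves `e₀`; 32 / 81 in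
    -- `l₀` is twice the lower bound 16 / 81 for that previous weight.
    e₀ l₀ : ℚ
    e₀ = ⟨ 6 ⟩ - ⟨ 3 ⟩ * M - ⟨ 3 ⟩ * R M - h
    l₀ = e₀ - ⟨ 2 ⟩ * (M + R M) + ℤ.+ 32 / 81

    rest₃ : M + ⟨ 2 ⟩ * thin M h ≤ e₀
    rest₃ = subst (λ M → M + ⟨ 2 ⟩ * thin M h ≤ ⟨ 6 ⟩ - ⟨ 3 ⟩ * M - ⟨ 3 ⟩ * R M - h) M≡
      (simplexInequality (x ∷ h ∷ y ∷ []) coords≥0 ∑ (λ { (x ∷ h ∷ y ∷ []) → let M = h ⊞ y in
        M ⊞ con ⟨ 2 ⟩ ⊠ ^.thin M h ⊑ con ⟨ 6 ⟩ ⊟ con ⟨ 3 ⟩ ⊠ M ⊟ con ⟨ 3 ⟩ ⊠ ^.R M ⊟ h })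
        coefficients)

    rest₃-2 : ⟨ 2 ⟩ ≤ e₀
    rest₃-2 = subst (λ M → ⟨ 2 ⟩ ≤ ⟨ 6 ⟩ - ⟨ 3 ⟩ * M - ⟨ 3 ⟩ * R M - h) M≡
      (simplexInequality (x ∷ h ∷ y ∷ []) coords≥0 ∑ (λ { (x ∷ h ∷ y ∷ []) → let M = h ⊞ y in
        con ⟨ 2 ⟩ ⊑ con ⟨ 6 ⟩ ⊟ con ⟨ 3 ⟩ ⊠ M ⊟ con ⟨ 3 ⟩ ⊠ ^.R M ⊟ h })
        coefficients)

    rest₃′ : 0ℚ ≤ l₀
    rest₃′ = subst (λ M → 0ℚ ≤ ⟨ 6 ⟩ - ⟨ 3 ⟩ * M - ⟨ 3 ⟩ * R M - h - ⟨ 2 ⟩ * (M + R M) + ℤ.+ 32 / 81) M≡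
      (simplexInequality (x ∷ h ∷ y ∷ []) coords≥0 ∑ (λ { (x ∷ h ∷ y ∷ []) → let M = h ⊞ y in
        con 0ℚ ⊑ con ⟨ 6 ⟩ ⊟ con ⟨ 3 ⟩ ⊠ M ⊟ con ⟨ 3 ⟩ ⊠ ^.R M ⊟ h ⊟ con ⟨ 2 ⟩ ⊠ (M ⊞ ^.R M) ⊞ con (ℤ.+ 32 / 81) })
        coefficients)

    rest₃″ : ⟨ 4 ⟩ * (h * thin M h) ≤ e₀ * l₀
    rest₃″ = subst (λ M → ⟨ 4 ⟩ * (h * thin M h) ≤ (⟨ 6 ⟩ - ⟨ 3 ⟩ * M - ⟨ 3 ⟩ * R M - h) * (⟨ 6 ⟩ - ⟨ 3 ⟩ * M - ⟨ 3 ⟩ * R M - h - ⟨ 2 ⟩ * (M + R M) + ℤ.+ 32 / 81)) M≡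
      (simplexInequality (x ∷ h ∷ y ∷ []) coords≥0 ∑ (λ { (x ∷ h ∷ y ∷ []) →
        let M = h ⊞ y
            e = con ⟨ 6 ⟩ ⊟ con ⟨ 3 ⟩ ⊠ M ⊟ con ⟨ 3 ⟩ ⊠ ^.R M ⊟ h in
        con ⟨ 4 ⟩ ⊠ (h ⊠ ^.thin M h) ⊑ e ⊠ (e ⊟ con ⟨ 2 ⟩ ⊠ (M ⊞ ^.R M) ⊞ con (ℤ.+ 32 / 81)) })
        coefficients)

  -- The mass that is certainly left after the first two vertices v and p: the star of v weighs at
  -- most 2M + R, and that of p without v at most h + R.
  massBound : ℚ → ℚ
  massBound h = ⟨ 6 ⟩ - ⟨ 2 ⟩ * M - ⟨ 2 ⟩ * R M - h

  module _ {h h′ E : ℚ} (16/81≤h : ℤ.+ 16 / 81 ≤ h) (h≤M : h ≤ M) (0≤h′ : 0ℚ ≤ h′) (h′≤M : h′ ≤ M)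
           (E≥ : massBound h ≤ E) where

    private
      e ρ ρ′ : ℚ
      e = E - h′ - thin M h
      ρ = thin M h
      ρ′ = thin M h′

      0≤h : 0ℚ ≤ h
      0≤h = ≤-trans (nonNegative⁻¹ (ℤ.+ 16 / 81)) 16/81≤h

    e₀≤e : e₀ 0≤h′ h′≤M ≤ e
    e₀≤e = ≤-from (e₀ 0≤h′ h′≤M) e
      (identity (M ∷ h ∷ h′ ∷ E ∷ []) λ { (M ∷ h ∷ h′ ∷ E ∷ []) →
        E ⊟ (con ⟨ 6 ⟩ ⊟ con ⟨ 2 ⟩ ⊠ M ⊟ con ⟨ 2 ⟩ ⊠ ^.R M ⊟ h) ⊑
        (E ⊟ h′ ⊟ ^.thin M h) ⊟ (con ⟨ 6 ⟩ ⊟ con ⟨ 3 ⟩ ⊠ M ⊟ con ⟨ 3 ⟩ ⊠ ^.R M ⊟ h′) })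
      (≤⇒0≤- E≥)

    2≤e : ⟨ 2 ⟩ ≤ e
    2≤e = ≤-trans (rest₃-2 0≤h′ h′≤M) e₀≤e

    l₀≤ : l₀ 0≤h′ h′≤M ≤ e - ⟨ 2 ⟩ * ρ
    l₀≤ = ≤-from (l₀ 0≤h′ h′≤M) (e - ⟨ 2 ⟩ * ρ)
      (identity (M ∷ h ∷ h′ ∷ E ∷ []) λ { (M ∷ h ∷ h′ ∷ E ∷ []) →
        (E ⊟ (con ⟨ 6 ⟩ ⊟ con ⟨ 2 ⟩ ⊠ M ⊟ con ⟨ 2 ⟩ ⊠ ^.R M ⊟ h)) ⊞ con ⟨ 2 ⟩ ⊠ (h ⊟ con (ℤ.+ 16 / 81)) ⊑
        (E ⊟ h′ ⊟ ^.thin M h ⊟ con ⟨ 2 ⟩ ⊠ ^.thin M h) ⊟ (con ⟨ 6 ⟩ ⊟ con ⟨ 3 ⟩ ⊠ M ⊟ con ⟨ 3 ⟩ ⊠ ^.R M ⊟ h′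
          ⊟ con ⟨ 2 ⟩ ⊠ (M ⊞ ^.R M) ⊞ con (ℤ.+ 32 / 81)) })
      (0≤+ (≤⇒0≤- E≥) (0≤* (nonNegative⁻¹ ⟨ 2 ⟩) (≤⇒0≤- 16/81≤h)))

    -- The difference of the two sides is four times the derivative, at r = `thin M h`, of the left
    -- side of `level₃` in r.
    slope₃ : ⟨ 4 ⟩ * (h′ * ρ′) ≤ e * (e - ⟨ 2 ⟩ * ρ)
    slope₃ = begin
      ⟨ 4 ⟩ * (h′ * ρ′)                    ≤⟨ rest₃″ 0≤h′ h′≤M ⟩
      e₀ 0≤h′ h′≤M * l₀ 0≤h′ h′≤M ≤⟨ *-monoˡ (rest₃′ 0≤h′ h′≤M) e₀≤e ⟩
      e * l₀ 0≤h′ h′≤M             ≤⟨ *-monoʳ (≤-trans (nonNegative⁻¹ ⟨ 2 ⟩) 2≤e) l₀≤ ⟩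
      e * (e - ⟨ 2 ⟩ * ρ)                  ∎
      where open ≤-Reasoning

    -- Raising r to ρ gains a cubic in σ = ρ - r without constant term. Its linear coefficient is
    -- the slope just estimated; the others are visibly nonnegative.
    level₃ : ∀ {r} → r ≤ ρ →
             h′ * V₂ M h′ (E - h′ - r) + r * power 2 (E - h′ - r) ≤ V₃ M h h′ E
    level₃ {r} r≤ = ≤-from (h′ * V₂ M h′ (E - h′ - r) + r * power 2 (E - h′ - r)) (V₃ M h h′ E)
      (identity (M ∷ h ∷ h′ ∷ r ∷ E ∷ []) λ { (M ∷ h ∷ h′ ∷ r ∷ E ∷ []) →
        let ρ = ^.thin M h
            e = E ⊟ h′ ⊟ ρ
            l = e ⊟ con ⟨ 2 ⟩ ⊠ ρ
            σ = ρ ⊟ r in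
        con (ℤ.+ 1 / 4) ⊠ (σ ⊠ ((e ⊠ l ⊟ con ⟨ 4 ⟩ ⊠ (h′ ⊠ ^.thin M h′))
          ⊞ σ ⊠ (con ⟨ 2 ⟩ ⊠ l ⊞ con ⟨ 3 ⟩ ⊠ ρ) ⊞ σ ⊠ σ)) ⊑
        ^.V₃ M h h′ E ⊟ (h′ ⊠ ^.V₂ M h′ (E ⊟ h′ ⊟ r) ⊞ r ⊠ ^.power 2 (E ⊟ h′ ⊟ r)) })
      (0≤* (nonNegative⁻¹ (ℤ.+ 1 / 4)) (0≤* 0≤σ (0≤+ (0≤+ (≤⇒0≤- slope₃)
        (0≤* 0≤σ (0≤+ (0≤* (nonNegative⁻¹ ⟨ 2 ⟩) (≤-trans (rest₃′ 0≤h′ h′≤M) l₀≤))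
                      (0≤* (nonNegative⁻¹ ⟨ 3 ⟩) (0≤thin h≤M))))) (0≤* 0≤σ 0≤σ))))
      where
      0≤σ : 0ℚ ≤ ρ - r
      0≤σ = ≤⇒0≤- r≤

  module _ {h h′ E : ℚ} (16/81≤h : ℤ.+ 16 / 81 ≤ h) (h≤M : h ≤ M) (0≤h′ : 0ℚ ≤ h′) (h′≤M : h′ ≤ M)
           (E≥ : ⟨ 6 ⟩ - ⟨ 2 ⟩ * M - R M ≤ E) where

    private
      f e a b : ℚ
      f = E - h - R M
      e = f - h′ - thin M h
      a = h * thin M h
      b = h * (h′ * thin M h′)

      0≤h : 0ℚ ≤ h
      0≤h = ≤-trans (nonNegative⁻¹ (ℤ.+ 16 / 81)) 16/81≤h

      f≥ : massBound h ≤ f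
      f≥ = ≤-from (massBound h) f
        (identity (M ∷ h ∷ E ∷ []) λ { (M ∷ h ∷ E ∷ []) →
          E ⊟ (con ⟨ 6 ⟩ ⊟ con ⟨ 2 ⟩ ⊠ M ⊟ ^.R M) ⊑
          (E ⊟ h ⊟ ^.R M) ⊟ (con ⟨ 6 ⟩ ⊟ con ⟨ 2 ⟩ ⊠ M ⊟ con ⟨ 2 ⟩ ⊠ ^.R M ⊟ h) })
        (≤⇒0≤- E≥)

      3≤f : ⟨ 3 ⟩ ≤ f
      3≤f = ≤-trans (rest₂ 0≤h h≤M) f≥

      0≤f : 0ℚ ≤ f
      0≤f = ≤-trans (nonNegative⁻¹ ⟨ 3 ⟩) 3≤f

      0≤f-3 : 0ℚ ≤ f - ⟨ 3 ⟩
      0≤f-3 = ≤⇒0≤- 3≤f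

      0≤f-3R : 0ℚ ≤ f - ⟨ 3 ⟩ * R M - ℤ.+ 5 / 2
      0≤f-3R = ≤⇒0≤- (≤-trans (rest₂′ 0≤h h≤M) (+-monoˡ-≤ (- (⟨ 3 ⟩ * R M)) f≥))

      0≤¼-a : 0ℚ ≤ ℤ.+ 1 / 4 - a
      0≤¼-a = ≤⇒0≤- (thin-product 0≤h)

      0≤¼-b : 0ℚ ≤ ℤ.+ 1 / 4 - b
      0≤¼-b = ≤⇒0≤- (≤-trans (*-monoˡ (0≤* 0≤h′ (0≤thin h′≤M)) (≤-trans h≤M M≤1))
        (subst (_≤ ℤ.+ 1 / 4) (sym (*-identityˡ (h′ * thin M h′))) (thin-product 0≤h′)))

      0≤a : 0ℚ ≤ a
      0≤a = 0≤* 0≤h (0≤thin h≤M)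

      0≤f-e : 0ℚ ≤ f - e
      0≤f-e = subst (0ℚ ≤_) (identity (f ∷ h′ ∷ thin M h ∷ []) λ { (f ∷ h′ ∷ t ∷ []) →
        h′ ⊞ t ⊑ f ⊟ (f ⊟ h′ ⊟ t) }) (0≤+ 0≤h′ (0≤thin h≤M))

      2≤e′ : ⟨ 2 ⟩ ≤ e
      2≤e′ = 2≤e 16/81≤h h≤M 0≤h′ h′≤M f≥

      -- `A` is 27 times the slope at r = `R M` of the left side of `level₄` in r, and `B` / 9 is
      -- the coefficient of σ² in the gain from raising r. The constants are distributed so that
      -- each summand is nonnegative because of f ≥ 3, f - 3R ≥ 5/2, e ≤ f and a, b ≤ 1/4.
      A B : ℚ
      A = f * f * (f - ⟨ 3 ⟩ * R M - ℤ.+ 5 / 2) + (f - ⟨ 3 ⟩) * (ℤ.+ 5 / 2 * (f - ⟨ 3 ⟩) + ℤ.+ 93 / 8) + ℤ.+ 45 / 8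
        + ⟨ 27 ⟩ * (ℤ.+ 1 / 4 - b) + ℤ.+ 27 / 2 * (f * (ℤ.+ 1 / 4 - a)) + ℤ.+ 27 / 2 * (a * (f - e))
      B = f * (f - ⟨ 3 ⟩ * R M - ℤ.+ 5 / 2) + ⟨ 2 ⟩ * (f * R M) + ℤ.+ 5 / 2 * (f - ⟨ 3 ⟩) + ℤ.+ 111 / 16
        + ℤ.+ 9 / 4 * (ℤ.+ 1 / 4 - a)

      0≤A : 0ℚ ≤ A
      0≤A = 0≤+ (0≤+ (0≤+ (0≤+ (0≤+ (0≤* (0≤* 0≤f 0≤f) 0≤f-3R)
        (0≤* 0≤f-3 (0≤+ (0≤* (nonNegative⁻¹ (ℤ.+ 5 / 2)) 0≤f-3) (nonNegative⁻¹ (ℤ.+ 93 / 8)))))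
        (nonNegative⁻¹ (ℤ.+ 45 / 8))) (0≤* (nonNegative⁻¹ ⟨ 27 ⟩) 0≤¼-b))
        (0≤* (nonNegative⁻¹ (ℤ.+ 27 / 2)) (0≤* 0≤f 0≤¼-a))) (0≤* (nonNegative⁻¹ (ℤ.+ 27 / 2)) (0≤* 0≤a 0≤f-e))

      0≤B : 0ℚ ≤ B
      0≤B = 0≤+ (0≤+ (0≤+ (0≤+ (0≤* 0≤f 0≤f-3R) (0≤* (nonNegative⁻¹ ⟨ 2 ⟩) (0≤* 0≤f 0≤R)))
        (0≤* (nonNegative⁻¹ (ℤ.+ 5 / 2)) 0≤f-3)) (nonNegative⁻¹ (ℤ.+ 111 / 16)))
        (0≤* (nonNegative⁻¹ (ℤ.+ 9 / 4)) 0≤¼-a)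

    level₄ : ∀ {r} → r ≤ R M →
             h * V₃ M h h′ (E - h - r) + r * power 3 (E - h - r) ≤ V₄ M h h′ E
    level₄ {r} r≤ = ≤-from (h * V₃ M h h′ (E - h - r) + r * power 3 (E - h - r)) (V₄ M h h′ E)
      (identity (M ∷ h ∷ h′ ∷ r ∷ E ∷ []) λ { (M ∷ h ∷ h′ ∷ r ∷ E ∷ []) →
        let f = E ⊟ h ⊟ ^.R M
            e = f ⊟ h′ ⊟ ^.thin M h
            a = h ⊠ ^.thin M h
            b = h ⊠ (h′ ⊠ ^.thin M h′)
            σ = ^.R M ⊟ r
            A = f ⊠ f ⊠ (f ⊟ con ⟨ 3 ⟩ ⊠ ^.R M ⊟ con (ℤ.+ 5 / 2)) ⊞ (f ⊟ con ⟨ 3 ⟩) ⊠ (con (ℤ.+ 5 / 2) ⊠ (f ⊟ con ⟨ 3 ⟩) ⊞ con (ℤ.+ 93 / 8)) ⊞ con (ℤ.+ 45 / 8)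
              ⊞ con ⟨ 27 ⟩ ⊠ (con (ℤ.+ 1 / 4) ⊟ b) ⊞ con (ℤ.+ 27 / 2) ⊠ (f ⊠ (con (ℤ.+ 1 / 4) ⊟ a)) ⊞ con (ℤ.+ 27 / 2) ⊠ (a ⊠ (f ⊟ e))
            B = f ⊠ (f ⊟ con ⟨ 3 ⟩ ⊠ ^.R M ⊟ con (ℤ.+ 5 / 2)) ⊞ con ⟨ 2 ⟩ ⊠ (f ⊠ ^.R M) ⊞ con (ℤ.+ 5 / 2) ⊠ (f ⊟ con ⟨ 3 ⟩) ⊞ con (ℤ.+ 111 / 16)
              ⊞ con (ℤ.+ 9 / 4) ⊠ (con (ℤ.+ 1 / 4) ⊟ a) in
        con (ℤ.+ 1 / 27) ⊠ (σ ⊠ (A ⊞ σ ⊠ (con ⟨ 3 ⟩ ⊠ B) ⊞ σ ⊠ σ ⊠ ((f ⊟ con ⟨ 3 ⟩ ⊠ ^.R M ⊟ con (ℤ.+ 5 / 2)) ⊞ con ⟨ 2 ⟩ ⊠ f ⊞ con ⟨ 2 ⟩ ⊠ ^.R M ⊞ con (ℤ.+ 5 / 2)) ⊞ σ ⊠ σ ⊠ σ)) ⊑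
        ^.V₄ M h h′ E ⊟ (h ⊠ ^.V₃ M h h′ (E ⊟ h ⊟ r) ⊞ r ⊠ ^.power 3 (E ⊟ h ⊟ r)) })
      (0≤* (nonNegative⁻¹ (ℤ.+ 1 / 27)) (0≤* 0≤σ (0≤+ (0≤+ (0≤+ 0≤A (0≤* 0≤σ (0≤* (nonNegative⁻¹ ⟨ 3 ⟩) 0≤B)))
        (0≤* (0≤* 0≤σ 0≤σ) (0≤+ (0≤+ (0≤+ 0≤f-3R (0≤* (nonNegative⁻¹ ⟨ 2 ⟩) 0≤f)) (0≤* (nonNegative⁻¹ ⟨ 2 ⟩) 0≤R)) (nonNegative⁻¹ (ℤ.+ 5 / 2)))))
        (0≤* (0≤* 0≤σ 0≤σ) 0≤σ))))
      where
      0≤σ : 0ℚ ≤ R M - r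
      0≤σ = ≤⇒0≤- r≤

    V₄-mono : ∀ {E′} → E ≤ E′ → V₄ M h h′ E ≤ V₄ M h h′ E′
    V₄-mono {E′} E≤E′ = ≤-from (V₄ M h h′ E) (V₄ M h h′ E′)
      (identity (M ∷ h ∷ h′ ∷ E ∷ E′ ∷ []) λ { (M ∷ h ∷ h′ ∷ E ∷ E′ ∷ []) →
        let f = E ⊟ h ⊟ ^.R M
            e = f ⊟ h′ ⊟ ^.thin M h
            g = E′ ⊟ E in
        g ⊠ (h ⊠ (h′ ⊠ ^.thin M h′) ⊞ h ⊠ ^.thin M h ⊠ (con ½ ⊠ e ⊞ con (ℤ.+ 1 / 4) ⊠ g)
          ⊞ con (ℤ.+ 1 / 27) ⊠ (^.R M ⊠ (con ⟨ 3 ⟩ ⊠ (f ⊠ f) ⊞ con ⟨ 3 ⟩ ⊠ (f ⊠ g) ⊞ g ⊠ g))) ⊑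
        ^.V₄ M h h′ E′ ⊟ ^.V₄ M h h′ E })
      (0≤* 0≤g (0≤+ (0≤+ (0≤* 0≤h (0≤* 0≤h′ (0≤thin h′≤M)))
        (0≤* 0≤a (0≤+ (0≤* (nonNegative⁻¹ ½) (≤-trans (nonNegative⁻¹ ⟨ 2 ⟩) 2≤e′)) (0≤* (nonNegative⁻¹ (ℤ.+ 1 / 4)) 0≤g))))
        (0≤* (nonNegative⁻¹ (ℤ.+ 1 / 27)) (0≤* 0≤R (0≤+ (0≤+ (0≤* (nonNegative⁻¹ ⟨ 3 ⟩) (0≤* 0≤f 0≤f)) (0≤* (nonNegative⁻¹ ⟨ 3 ⟩) (0≤* 0≤f 0≤g))) (0≤* 0≤g 0≤g))))))
      where
      0≤g : 0ℚ ≤ E′ - E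
      0≤g = ≤⇒0≤- E≤E′

  -- A larger second edge at v is a larger factor but leaves less mass. The factor prevails, so w =
  -- M is the worst case; the identity expands the difference in z = M - w.
  outermost : ∀ {h h′ w} → ℤ.+ 16 / 81 ≤ h → h ≤ M → 0ℚ ≤ h′ → h′ ≤ M → 0ℚ ≤ w → w ≤ M →
              w * V₄ M h h′ (⟨ 6 ⟩ - M - w) ≤ M * V₄ M h h′ (⟨ 6 ⟩ - ⟨ 2 ⟩ * M)
  outermost {h} {h′} {w} 16/81≤h h≤M 0≤h′ h′≤M 0≤w w≤M =
    ≤-from (w * V₄ M h h′ (⟨ 6 ⟩ - M - w)) (M * V₄ M h h′ (⟨ 6 ⟩ - ⟨ 2 ⟩ * M))
    (identity (M ∷ h ∷ h′ ∷ w ∷ []) λ { (M ∷ h ∷ h′ ∷ w ∷ []) →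
      let f = con ⟨ 6 ⟩ ⊟ con ⟨ 2 ⟩ ⊠ M ⊟ h ⊟ ^.R M
          e = f ⊟ h′ ⊟ ^.thin M h
          u = e ⊟ con ⟨ 2 ⟩
          v = f ⊟ con ⟨ 3 ⟩
          s = con 1ℚ ⊟ M
          z = M ⊟ w in
      z ⊠ (h ⊠ h′ ⊠ (M ⊠ (M ⊞ ^.R M) ⊞ con (ℤ.+ 1 / 4) ⊠ ((M ⊟ h′) ⊠ (M ⊟ h′)))
        ⊞ h ⊠ (h′ ⊠ ^.thin M h′) ⊠ (s ⊠ (con (ℤ.+ 3 / 2) ⊠ s ⊞ con ⟨ 3 ⟩) ⊞ z)
        ⊞ h ⊠ ^.thin M h ⊠ (con (ℤ.+ 1 / 4) ⊠
            (u ⊠ u ⊞ con ⟨ 2 ⟩ ⊠ (u ⊠ (con 1ℚ ⊞ s ⊞ z)) ⊞ con ⟨ 4 ⟩ ⊠ s ⊞ z ⊠ (con ⟨ 3 ⟩ ⊞ s ⊞ z)))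
        ⊞ ^.R M ⊠ (con (ℤ.+ 1 / 27) ⊠ (f ⊠ f ⊠ v ⊞ con ⟨ 3 ⟩ ⊠ (f ⊠ f ⊠ s)
            ⊞ z ⊠ (con ⟨ 3 ⟩ ⊠ (f ⊠ (v ⊞ s ⊞ z)) ⊞ con ⟨ 6 ⟩ ⊠ v ⊞ con ⟨ 17 ⟩ ⊞ s ⊞ w ⊞ s ⊠ z ⊞ z ⊠ z)))) ⊑
      M ⊠ ^.V₄ M h h′ (con ⟨ 6 ⟩ ⊟ con ⟨ 2 ⟩ ⊠ M) ⊟ w ⊠ ^.V₄ M h h′ (con ⟨ 6 ⟩ ⊟ M ⊟ w) })
    (0≤* 0≤z (0≤+ (0≤+ (0≤+
      (0≤* (0≤* 0≤h 0≤h′) (0≤+ (0≤* 0≤M (0≤+ 0≤M 0≤R)) (0≤* (nonNegative⁻¹ (ℤ.+ 1 / 4)) (0≤sq (M - h′)))))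
      (0≤* (0≤* 0≤h (0≤* 0≤h′ (0≤thin h′≤M))) (0≤+ (0≤* 0≤s (0≤+ (0≤* (nonNegative⁻¹ (ℤ.+ 3 / 2)) 0≤s) (nonNegative⁻¹ ⟨ 3 ⟩))) 0≤z)))
      (0≤* (0≤* 0≤h (0≤thin h≤M)) (0≤* (nonNegative⁻¹ (ℤ.+ 1 / 4)) (0≤+ (0≤+ (0≤+ (0≤* 0≤u 0≤u)
        (0≤* (nonNegative⁻¹ ⟨ 2 ⟩) (0≤* 0≤u (0≤+ (0≤+ (nonNegative⁻¹ 1ℚ) 0≤s) 0≤z)))) (0≤* (nonNegative⁻¹ ⟨ 4 ⟩) 0≤s))
        (0≤* 0≤z (0≤+ (0≤+ (nonNegative⁻¹ ⟨ 3 ⟩) 0≤s) 0≤z))))))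
      (0≤* 0≤R (0≤* (nonNegative⁻¹ (ℤ.+ 1 / 27)) (0≤+ (0≤+ (0≤* (0≤* 0≤f 0≤f) 0≤v) (0≤* (nonNegative⁻¹ ⟨ 3 ⟩) (0≤* (0≤* 0≤f 0≤f) 0≤s)))
        (0≤* 0≤z (0≤+ (0≤+ (0≤+ (0≤+ (0≤+ (0≤+ (0≤* (nonNegative⁻¹ ⟨ 3 ⟩) (0≤* 0≤f (0≤+ (0≤+ 0≤v 0≤s) 0≤z)))
          (0≤* (nonNegative⁻¹ ⟨ 6 ⟩) 0≤v)) (nonNegative⁻¹ ⟨ 17 ⟩)) 0≤s) 0≤w) (0≤* 0≤s 0≤z)) (0≤* 0≤z 0≤z))))))))
    where
    f = ⟨ 6 ⟩ - ⟨ 2 ⟩ * M - h - R M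

    f≥ : massBound h ≤ f
    f≥ = ≤-from (massBound h) f (identity (M ∷ h ∷ []) λ { (M ∷ h ∷ []) →
      ^.R M ⊑ (con ⟨ 6 ⟩ ⊟ con ⟨ 2 ⟩ ⊠ M ⊟ h ⊟ ^.R M) ⊟ (con ⟨ 6 ⟩ ⊟ con ⟨ 2 ⟩ ⊠ M ⊟ con ⟨ 2 ⟩ ⊠ ^.R M ⊟ h) })
      0≤R

    0≤h : 0ℚ ≤ h
    0≤h = ≤-trans (nonNegative⁻¹ (ℤ.+ 16 / 81)) 16/81≤h

    0≤s : 0ℚ ≤ 1ℚ - M
    0≤s = ≤⇒0≤- M≤1

    0≤z : 0ℚ ≤ M - w
    0≤z = ≤⇒0≤- w≤M

    0≤u : 0ℚ ≤ f - h′ - thin M h - ⟨ 2 ⟩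
    0≤u = ≤⇒0≤- (2≤e 16/81≤h h≤M 0≤h′ h′≤M f≥)

    3≤f : ⟨ 3 ⟩ ≤ f
    3≤f = ≤-trans (rest₂ 0≤h h≤M) f≥

    0≤v : 0ℚ ≤ f - ⟨ 3 ⟩
    0≤v = ≤⇒0≤- 3≤f

    0≤f : 0ℚ ≤ f
    0≤f = ≤-trans (nonNegative⁻¹ ⟨ 3 ⟩) 3≤f

  -- At M = h = h′ = 1, the hexagon, both sides are equal. The orders of h and h′ are treated
  -- separately so that the gaps of the chain up to 1 are coordinates on a simplex; the certificates
  -- then compare 1 - M with the smallest of the three weights.
  closing : ∀ {h h′} → 0ℚ ≤ h → h ≤ M → 0ℚ ≤ h′ → h′ ≤ M →
            M * V₄ M h h′ (⟨ 6 ⟩ - ⟨ 2 ⟩ * M) ≤ 1ℚ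
  closing {h} {h′} 0≤h h≤M 0≤h′ h′≤M with ≤-total h′ h
  ... | inj₁ h′≤h = subst₂ (λ M h → M * V₄ M h h′ (⟨ 6 ⟩ - ⟨ 2 ⟩ * M) ≤ 1ℚ)
    (identity (M ∷ h ∷ h′ ∷ []) λ { (M ∷ h ∷ h′ ∷ []) → (M ⊟ h) ⊞ (h ⊟ h′) ⊞ h′ ⊑ M })
    (identity (h ∷ h′ ∷ []) λ { (h ∷ h′ ∷ []) → (h ⊟ h′) ⊞ h′ ⊑ h })
    (simplexInequality (1ℚ - M ∷ M - h ∷ h - h′ ∷ h′ ∷ [])
      (≤⇒0≤- M≤1 ∷ ≤⇒0≤- h≤M ∷ ≤⇒0≤- h′≤h ∷ 0≤h′ ∷ [])
      (identity (M ∷ h ∷ h′ ∷ []) λ { (M ∷ h ∷ h′ ∷ []) →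
        (con 1ℚ ⊟ M) ⊞ ((M ⊟ h) ⊞ ((h ⊟ h′) ⊞ (h′ ⊞ con 0ℚ))) ⊑ con 1ℚ })
      (λ { (x ∷ y ∷ d ∷ h′ ∷ []) → let M = y ⊞ d ⊞ h′ in
        M ⊠ ^.V₄ M (d ⊞ h′) h′ (con ⟨ 6 ⟩ ⊟ con ⟨ 2 ⟩ ⊠ M) ⊑ con 1ℚ })
      (split 0F 3F coefficients coefficients))
  ... | inj₂ h≤h′ = subst₂ (λ M h′ → M * V₄ M h h′ (⟨ 6 ⟩ - ⟨ 2 ⟩ * M) ≤ 1ℚ)
    (identity (M ∷ h ∷ h′ ∷ []) λ { (M ∷ h ∷ h′ ∷ []) → (M ⊟ h′) ⊞ (h′ ⊟ h) ⊞ h ⊑ M })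
    (identity (h ∷ h′ ∷ []) λ { (h ∷ h′ ∷ []) → (h′ ⊟ h) ⊞ h ⊑ h′ })
    (simplexInequality (1ℚ - M ∷ M - h′ ∷ h′ - h ∷ h ∷ [])
      (≤⇒0≤- M≤1 ∷ ≤⇒0≤- h′≤M ∷ ≤⇒0≤- h≤h′ ∷ 0≤h ∷ [])
      (identity (M ∷ h ∷ h′ ∷ []) λ { (M ∷ h ∷ h′ ∷ []) →
        (con 1ℚ ⊟ M) ⊞ ((M ⊟ h′) ⊞ ((h′ ⊟ h) ⊞ (h ⊞ con 0ℚ))) ⊑ con 1ℚ })
      (λ { (x ∷ y ∷ d ∷ h ∷ []) → let M = y ⊞ d ⊞ h in
        M ⊠ ^.V₄ M h (d ⊞ h) (con ⟨ 6 ⟩ ⊟ con ⟨ 2 ⟩ ⊠ M) ⊑ con 1ℚ })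
      (split 0F 3F coefficients coefficients))

open Polynomial

-- Paths in weighted graphs

sum-mono : ∀ {n} {f g : Fin n → ℚ} → (∀ i → f i ≤ g i) → sum f ≤ sum g
sum-mono {zero}  f≤g = ≤-refl
sum-mono {suc n} f≤g = +-mono-≤ (f≤g zero) (sum-mono (f≤g ∘ suc))

sum-nonNeg : ∀ {n} {f : Fin n → ℚ} → (∀ i → 0ℚ ≤ f i) → 0ℚ ≤ sum f
sum-nonNeg {zero}  0≤f = ≤-refl
sum-nonNeg {suc n} 0≤f = 0≤+ (0≤f zero) (sum-nonNeg (0≤f ∘ suc))

p≤p+q : ∀ {p q} → 0ℚ ≤ q → p ≤ p + q
p≤p+q {p} {q} 0≤q = subst (_≤ p + q) (+-identityʳ p) (+-monoʳ-≤ p 0≤q)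

p≤q+p : ∀ {p q} → 0ℚ ≤ q → p ≤ q + p
p≤q+p {p} {q} 0≤q = subst (p ≤_) (+-comm p q) (p≤p+q 0≤q)

term≤sum : ∀ {n} {f : Fin n → ℚ} → (∀ i → 0ℚ ≤ f i) → ∀ i → f i ≤ sum f
term≤sum 0≤f zero    = p≤p+q (sum-nonNeg (0≤f ∘ suc))
term≤sum 0≤f (suc i) = ≤-trans (term≤sum (0≤f ∘ suc) i) (p≤q+p (0≤f zero))

two-terms≤sum : ∀ {n} {f : Fin n → ℚ} → (∀ i → 0ℚ ≤ f i) → ∀ {i j} → i ≢ j → f i + f j ≤ sum f
two-terms≤sum 0≤f {zero}  {zero}  i≢j = contradiction refl i≢j
two-terms≤sum {f = f} 0≤f {zero}  {suc j} i≢j = +-monoʳ-≤ (f zero) (term≤sum (0≤f ∘ suc) j)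
two-terms≤sum {f = f} 0≤f {suc i} {zero}  i≢j =
  subst (_≤ sum f) (+-comm (f zero) (f (suc i))) (+-monoʳ-≤ (f zero) (term≤sum (0≤f ∘ suc) i))
two-terms≤sum 0≤f {suc i} {suc j} i≢j =
  ≤-trans (two-terms≤sum (0≤f ∘ suc) (i≢j ∘ cong suc)) (p≤q+p (0≤f zero))

sum-select : ∀ {n} (f : Fin n → ℚ) x → sum (λ i → if does (i ≟ x) then f i else 0ℚ) ≡ f x
sum-select {suc n} f zero = trans (cong (f zero +_) (sum-replicate-zero n)) (+-identityʳ (f zero))
sum-select {suc n} f (suc x) = trans (+-identityˡ _) (sum-select (f ∘ suc) x)

sum-difference : ∀ {n} (f g : Fin n → ℚ) → sum (λ i → f i - g i) ≡ sum f - sum g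
sum-difference f g = begin
  sum (λ i → f i - g i)                   ≡⟨ identity (sum (λ i → f i - g i) ∷ sum g ∷ []) (λ { (a ∷ b ∷ []) → a ⊑ a ⊞ b ⊟ b }) ⟩
  sum (λ i → f i - g i) + sum g - sum g   ≡⟨ cong (_- sum g) (∑-distrib-+ (λ i → f i - g i) g) ⟨
  sum (λ i → f i - g i + g i) - sum g     ≡⟨ cong (_- sum g) (sum-cong-≗ λ i → identity (f i ∷ g i ∷ []) λ { (a ∷ b ∷ []) → a ⊟ b ⊞ b ⊑ a }) ⟩
  sum f - sum g                           ∎
  where open ≡-Reasoning

Weight : ℕ → Set
Weight n = Fin n → Fin n → ℚ

record IsWeight {n} (w : Weight n) : Set where
  field
    symmetric : ∀ i j → w i j ≡ w j i
    nonneg    : ∀ i j → 0ℚ ≤ w i j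
    loopless  : ∀ i → w i i ≡ 0ℚ

open IsWeight

star : ∀ {n} → Weight n → Fin n → ℚ
star w x = sum (w x)

mass : ∀ {n} → Weight n → ℚ
mass w = ½ * sum (star w)

delete : ∀ {n} → Fin n → Weight n → Weight n
delete x w i j = if does (i ≟ x) ∨ does (j ≟ x) then 0ℚ else w i j

module _ {n} (x : Fin n) (w : Weight n) where

  delete-to : ∀ i → delete x w i x ≡ 0ℚ
  delete-to i rewrite dec-true (x ≟ x) refl with does (i ≟ x)
  ... | true  = refl
  ... | false = refl

  delete-other : ∀ {i j} → i ≢ x → j ≢ x → delete x w i j ≡ w i j
  delete-other {i} {j} i≢x j≢x rewrite dec-false (i ≟ x) i≢x | dec-false (j ≟ x) j≢x = refl

  delete-cases : ∀ i j → delete x w i j ≡ 0ℚ ⊎ delete x w i j ≡ w i j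
  delete-cases i j with does (i ≟ x) ∨ does (j ≟ x)
  ... | true  = inj₁ refl
  ... | false = inj₂ refl

  delete-isWeight : IsWeight w → IsWeight (delete x w)
  delete-isWeight isW .symmetric i j with does (i ≟ x) | does (j ≟ x)
  ... | true  | true  = refl
  ... | true  | false = refl
  ... | false | true  = refl
  ... | false | false = isW .symmetric i j
  delete-isWeight isW .nonneg i j with does (i ≟ x) ∨ does (j ≟ x)
  ... | true  = ≤-refl
  ... | false = isW .nonneg i j
  delete-isWeight isW .loopless i with does (i ≟ x)
  ... | true  = refl
  ... | false = isW .loopless i

  -- The `if` term accounts for i = x, where the whole star disappears and w x i is 0 already.
  star-delete : IsWeight w → ∀ i →
    star (delete x w) i ≡ star w i - ((if does (i ≟ x) then star w i else 0ℚ) + w x i)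
  star-delete isW i with i ≟ x
  ... | yes refl rewrite isW .loopless i = trans (sum-replicate-zero n)
    (identity (star w i ∷ []) λ { (s ∷ []) → con 0ℚ ⊑ s ⊟ (s ⊞ con 0ℚ) })
  ... | no i≢x = begin
    sum (λ j → if does (j ≟ x) then 0ℚ else w i j)
      ≡⟨ sum-cong-≗ pointwise ⟩
    sum (λ j → w i j - (if does (j ≟ x) then w i j else 0ℚ))
      ≡⟨ sum-difference (w i) _ ⟩
    star w i - sum (λ j → if does (j ≟ x) then w i j else 0ℚ)
      ≡⟨ cong (λ t → star w i - t) (trans (sum-select (w i) x) (trans (isW .symmetric i x) (sym (+-identityˡ (w x i))))) ⟩
    star w i - (0ℚ + w x i) ∎
    where
    open ≡-Reasoning
    pointwise : ∀ j → (if does (j ≟ x) then 0ℚ else w i j) ≡ w i j - (if does (j ≟ x) then w i j else 0ℚ)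
    pointwise j with does (j ≟ x)
    ... | true  = sym (+-inverseʳ (w i j))
    ... | false = sym (+-identityʳ (w i j))

  mass-delete : IsWeight w → mass (delete x w) ≡ mass w - star w x
  mass-delete isW = begin
    ½ * sum (star (delete x w))
      ≡⟨ cong (½ *_) (sum-cong-≗ (star-delete isW)) ⟩
    ½ * sum (λ i → star w i - (select i + w x i))
      ≡⟨ cong (½ *_) (trans (sum-difference (star w) (λ i → select i + w x i))
           (cong (λ t → sum (star w) - t) (trans (∑-distrib-+ select (w x)) (cong (_+ star w x) (sum-select (star w) x))))) ⟩
    ½ * (sum (star w) - (star w x + star w x))
      ≡⟨ identity (sum (star w) ∷ star w x ∷ []) (λ { (a ∷ s ∷ []) → con ½ ⊠ (a ⊟ (s ⊞ s)) ⊑ con ½ ⊠ a ⊟ s }) ⟩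
    ½ * sum (star w) - star w x ∎
    where
    open ≡-Reasoning
    select : Fin n → ℚ
    select i = if does (i ≟ x) then star w i else 0ℚ

star-nonNeg : ∀ {n} {w : Weight n} → IsWeight w → ∀ x → 0ℚ ≤ star w x
star-nonNeg isW x = sum-nonNeg (isW .nonneg x)

mass-nonNeg : ∀ {n} {w : Weight n} → IsWeight w → 0ℚ ≤ mass w
mass-nonNeg isW = 0≤* (nonNegative⁻¹ ½) (sum-nonNeg (star-nonNeg isW))

star≤mass : ∀ {n} {w : Weight n} → IsWeight w → ∀ x → star w x ≤ mass w
star≤mass {w = w} isW x = 0≤-⇒≤ (subst (0ℚ ≤_) (mass-delete x w isW)
  (mass-nonNeg (delete-isWeight x w isW)))

-- Each vertex is deleted as it is left, so for loopless `w` only self-avoiding paths contribute: a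
-- return has a factor 0.
paths : ∀ {n} → ℕ → Weight n → Fin n → ℚ
paths zero    w x = 1ℚ
paths (suc k) w x = sum λ z → w x z * paths k (delete x w) z

module _ {n} {w : Weight n} (isW : IsWeight w) {x : Fin n} {k : ℕ} where

  -- The continuation through q is kept, every other edge at x is charged the uniform bound B. The
  -- gap lost at q is one term of the sum of all the nonnegative gaps.
  paths-peel : ∀ q {B} → (∀ z → paths k (delete x w) z ≤ B) →
    paths (suc k) w x ≤ w x q * paths k (delete x w) q + (star w x - w x q) * B
  paths-peel q {B} ≤B = ≤-from (paths (suc k) w x) (w x q * paths k (delete x w) q + (star w x - w x q) * B)
    (begin
      sum gap - gap q
        ≡⟨ cong (_- gap q) (trans (sum-cong-≗ λ z → identity (w x z ∷ B ∷ paths k (delete x w) z ∷ [])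
             λ { (a ∷ b ∷ p ∷ []) → a ⊠ (b ⊟ p) ⊑ a ⊠ b ⊟ a ⊠ p }) (sum-difference (λ z → w x z * B) _)) ⟩
      sum (λ z → w x z * B) - paths (suc k) w x - gap q
        ≡⟨ cong (λ t → t - paths (suc k) w x - gap q) (sym (*-distribʳ-sum B (w x))) ⟩
      star w x * B - paths (suc k) w x - gap q
        ≡⟨ identity (star w x ∷ B ∷ paths (suc k) w x ∷ w x q ∷ paths k (delete x w) q ∷ [])
            (λ { (s ∷ b ∷ p ∷ a ∷ p′ ∷ []) → s ⊠ b ⊟ p ⊟ a ⊠ (b ⊟ p′) ⊑ a ⊠ p′ ⊞ (s ⊟ a) ⊠ b ⊟ p }) ⟩
      w x q * paths k (delete x w) q + (star w x - w x q) * B - paths (suc k) w x ∎)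
    (≤⇒0≤- (term≤sum (λ z → 0≤* (isW .nonneg x z) (≤⇒0≤- (≤B z))) q))
    where
    open ≡-Reasoning
    gap : Fin n → ℚ
    gap z = w x z * (B - paths k (delete x w) z)

  paths≤star* : ∀ {B} → (∀ z → paths k (delete x w) z ≤ B) → paths (suc k) w x ≤ star w x * B
  paths≤star* {B} ≤B = begin
    sum (λ z → w x z * paths k (delete x w) z) ≤⟨ sum-mono (λ z → *-monoʳ (isW .nonneg x z) (≤B z)) ⟩
    sum (λ z → w x z * B)                      ≡⟨ *-distribʳ-sum B (w x) ⟨
    star w x * B                               ∎
    where open ≤-Reasoning

PathBound : ℕ → Set
PathBound k = ∀ {n} {w : Weight n} → IsWeight w → ∀ x → paths k w x ≤ power k (mass w)

paths-step : ∀ {k} → (∀ {s t} → 0ℚ ≤ s → 0ℚ ≤ t → s * power k t ≤ power (suc k) (s + t)) →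
             PathBound k → PathBound (suc k)
paths-step {k} amgm bound {w = w} isW x = begin
  paths (suc k) w x                         ≤⟨ paths≤star* isW {k = k} (bound (delete-isWeight x w isW)) ⟩
  star w x * power k (mass (delete x w))    ≤⟨ amgm (star-nonNeg isW x) (mass-nonNeg (delete-isWeight x w isW)) ⟩
  power (suc k) (star w x + mass (delete x w))
    ≡⟨ cong (power (suc k)) (trans (cong (star w x +_) (mass-delete x w isW)) (a+[b-a] (star w x) (mass w))) ⟩
  power (suc k) (mass w)                    ∎
  where open ≤-Reasoning

paths≤power₁ : PathBound 1
paths≤power₁ {w = w} isW x = begin
  sum (λ z → w x z * 1ℚ) ≡⟨ sum-cong-≗ (λ z → *-identityʳ (w x z)) ⟩
  star w x               ≤⟨ star≤mass isW x ⟩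
  mass w                 ≡⟨ *-identityˡ (mass w) ⟨
  1ℚ * mass w            ∎
  where open ≤-Reasoning

paths≤power₂ : PathBound 2
paths≤power₂ = paths-step {1} amgm₁ paths≤power₁

paths≤power₃ : PathBound 3
paths≤power₃ = paths-step {2} amgm₂ paths≤power₂

paths≤power₄ : PathBound 4
paths≤power₄ = paths-step {3} amgm₃ paths≤power₃

-- Following the heavy edges

-- Stronger than G ≤ w pointwise: an edge is either erased or keeps its full weight, so an edge that
-- survives in G inherits lower bounds from w.
_⊆_ : ∀ {n} → Weight n → Weight n → Set
G ⊆ w = ∀ i j → G i j ≡ 0ℚ ⊎ G i j ≡ w i j

delete-⊆ : ∀ {n} {G w : Weight n} x → G ⊆ w → delete x G ⊆ w
delete-⊆ {G = G} x G⊆w i j with delete-cases x G i j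
... | inj₁ ≡0 = inj₁ ≡0
... | inj₂ eq with G⊆w i j
...   | inj₁ ≡0 = inj₁ (trans eq ≡0)
...   | inj₂ ≡w = inj₂ (trans eq ≡w)

argmax : ∀ {n} (f : Fin (suc n) → ℚ) → ∃ λ i → ∀ j → f j ≤ f i
argmax {zero}  f = 0F , λ { 0F → ≤-refl }
argmax {suc n} f with argmax (f ∘ suc)
... | i , max with ≤-total (f 0F) (f (suc i))
...   | inj₁ f0≤ = suc i , λ { 0F → f0≤ ; (suc j) → max j }
...   | inj₂ ≤f0 = 0F , λ { 0F → ≤-refl ; (suc j) → ≤-trans (max j) ≤f0 }

inhabited-argmax : ∀ {n} (f : Fin n → ℚ) → Fin n → ∃ λ i → ∀ j → f j ≤ f i
inhabited-argmax {suc n} f _ = argmax f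

-- `many-paths` is c(ab) > 1 in the form in which it is exploited: the edge returning to a is
-- replaced by a bound m on all other weights at a, the rest by the four-edge paths from b that
-- avoid a.
module Descent {n} (w : Weight n) (isW : IsWeight w) (mass≡6 : mass w ≡ ⟨ 6 ⟩) (M : ℚ)
  (w≤M : ∀ i j → w i j ≤ M)
  (many-paths : ∀ a b → ℤ.+ 1 / 6 ≤ w a b → ∀ m → 0ℚ ≤ m → (∀ z → z ≢ b → w a z ≤ m) →
                1ℚ < m * paths 4 (delete a w) b) where

  record Successor (a b : Fin n) : Set where
    field
      next      : Fin n
      next≢     : next ≢ b
      0≤next    : 0ℚ ≤ w a next
      heavy     : 1ℚ < w a next * power 4 (⟨ 6 ⟩ - star w a)
      heavy′    : 1ℚ < w a next * paths 4 (delete a w) b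

    degree≤6 : star w a ≤ ⟨ 6 ⟩
    degree≤6 = subst (star w a ≤_) mass≡6 (star≤mass isW a)

    open Heavy {w a next} {star w a} 0≤next (star-nonNeg isW a) degree≤6 heavy public

  successor : ∀ a b → ℤ.+ 1 / 6 ≤ w a b → Successor a b
  successor a b 1/6≤ = record { next = q ; next≢ = q≢b ; 0≤next = isW .nonneg a q ; heavy = heavy ; heavy′ = heavy′ }
    where
    a≢b : a ≢ b
    a≢b refl = <⇒≱ (<-≤-trans (positive⁻¹ (ℤ.+ 1 / 6)) 1/6≤) (≤-reflexive (isW .loopless a))

    -- Erasing the edge to b turns the search for the heaviest other edge into an ordinary maximum.
    -- It is not attained at b, where the weight 0 would contradict `many`.
    best = inhabited-argmax (delete b w a) a
    q = proj₁ best

    bound : ∀ z → z ≢ b → w a z ≤ delete b w a q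
    bound z z≢b = subst (_≤ delete b w a q) (delete-other b w a≢b z≢b) (proj₂ best z)

    many : 1ℚ < delete b w a q * paths 4 (delete a w) b
    many = many-paths a b 1/6≤ (delete b w a q) (delete-isWeight b w isW .nonneg a q) bound

    q≢b : q ≢ b
    q≢b q≡b = <⇒≱ many (subst (_≤ 1ℚ)
      (sym (trans (cong (_* paths 4 (delete a w) b) (trans (cong (delete b w a) q≡b) (delete-to b w a)))
                  (*-zeroˡ (paths 4 (delete a w) b))))
      (nonNegative⁻¹ 1ℚ))

    heavy′ : 1ℚ < w a q * paths 4 (delete a w) b
    heavy′ = subst (λ m → 1ℚ < m * paths 4 (delete a w) b) (delete-other b w a≢b q≢b) many

    heavy : 1ℚ < w a q * power 4 (⟨ 6 ⟩ - star w a)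
    heavy = <-≤-trans heavy′ (*-monoʳ (isW .nonneg a q)
      (subst (λ E → paths 4 (delete a w) b ≤ power 4 E)
        (trans (mass-delete a w isW) (cong (_- star w a) mass≡6))
        (paths≤power₄ (delete-isWeight a w isW) b)))

  1/6≤16/81 : ℤ.+ 1 / 6 ≤ ℤ.+ 16 / 81
  1/6≤16/81 = toWitness {a? = ℤ.+ 1 / 6 ≤? ℤ.+ 16 / 81} _

  module _ (M≤1 : M ≤ 1ℚ) where

    -- A position on the path: p is the current vertex, b its predecessor, h the weight of the edge
    -- between them, and G what is left of `w`.
    record Stage (G : Weight n) (p b : Fin n) (h : ℚ) : Set where
      field
        isWeight : IsWeight G
        subgraph : G ⊆ w
        avoids   : G p b ≡ 0ℚ
        weight   : w p b ≡ h
        heavy    : ℤ.+ 16 / 81 ≤ h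

      1/6≤h : ℤ.+ 1 / 6 ≤ w p b
      1/6≤h = subst (ℤ.+ 1 / 6 ≤_) (sym weight) (≤-trans 1/6≤16/81 heavy)

      open Successor (successor p b 1/6≤h) public hiding (heavy)

      h≤M : h ≤ M
      h≤M = subst (_≤ M) weight (w≤M p b)

      0≤M : 0ℚ ≤ M
      0≤M = ≤-trans (≤-trans (nonNegative⁻¹ (ℤ.+ 16 / 81)) heavy) h≤M

      open Levels 0≤M M≤1 public

      h′ r : ℚ
      h′ = G p next
      r = star G p - h′

      G≤w : ∀ z → G p z ≤ w p z
      G≤w z with subgraph p z
      ... | inj₁ ≡0 = subst (_≤ w p z) (sym ≡0) (isW .nonneg p z)
      ... | inj₂ ≡w = ≤-reflexive ≡w

      0≤h′ : 0ℚ ≤ h′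
      0≤h′ = isWeight .nonneg p next

      h′≤M : h′ ≤ M
      h′≤M = ≤-trans (G≤w next) (w≤M p next)

      -- In passing from w to G the star of p has lost at least the edge to b, and also w p next -
      -- h′, which is nonzero only if the edge to `next` was erased. `heavy-degree` bounds what
      -- remains.
      r≤thin : r ≤ thin M h
      r≤thin = ≤-from r (thin M h)
        (identity (star w p ∷ star G p ∷ h ∷ w p next ∷ h′ ∷ M ∷ []) λ { (d ∷ s ∷ h ∷ m ∷ h′ ∷ M ∷ []) →
          (d ⊟ s ⊟ (h ⊟ con 0ℚ ⊞ (m ⊟ h′))) ⊞ (M ⊞ ^.R M ⊟ (d ⊟ m)) ⊑ ^.thin M h ⊟ (s ⊟ h′) })
        (0≤+ (≤⇒0≤- removed) (≤⇒0≤- (heavy-degree (w≤M p next) M≤1)))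
        where
        removed : h - 0ℚ + (w p next - h′) ≤ star w p - star G p
        removed = subst₂ (λ a b → a - b + (w p next - h′) ≤ star w p - star G p) weight avoids
          (≤-trans (two-terms≤sum {f = λ z → w p z - G p z} (λ z → ≤⇒0≤- (G≤w z)) (≢-sym next≢))
                   (≤-reflexive (sum-difference (w p) (G p))))

      rest : mass (delete p G) ≡ mass G - h′ - r
      rest = trans (mass-delete p G isWeight)
        (identity (mass G ∷ star G p ∷ h′ ∷ []) λ { (E ∷ s ∷ h′ ∷ []) → E ⊟ s ⊑ E ⊟ h′ ⊟ (s ⊟ h′) })

      peel : ∀ k → PathBound k →
             paths (suc k) G p ≤ h′ * paths k (delete p G) next + r * power k (mass G - h′ - r)
      peel k bound = subst (λ E → paths (suc k) G p ≤ h′ * paths k (delete p G) next + r * power k E) rest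
        (paths-peel isWeight {k = k} next (bound (delete-isWeight p G isWeight)))

      -- The heaviest edge at p may lead to a deleted vertex, and then h′ = 0.
      onwards : h′ ≡ 0ℚ ⊎ Stage (delete p G) next p h′
      onwards with subgraph p next
      ... | inj₁ ≡0 = inj₁ ≡0
      ... | inj₂ ≡w = inj₂ (record
        { isWeight = delete-isWeight p G isWeight
        ; subgraph = delete-⊆ p subgraph
        ; avoids   = delete-to p G next
        ; weight   = trans (isW .symmetric next p) (sym ≡w)
        ; heavy    = subst (ℤ.+ 16 / 81 ≤_) (sym ≡w) heavy-large })

      continue : ∀ {a b} → (Stage (delete p G) next p h′ → a ≤ b) → h′ * a ≤ h′ * b
      continue {a} {b} a≤b with onwards
      ... | inj₁ ≡0 = ≤-reflexive (trans (cong (_* a) ≡0) (trans (*-zeroˡ a) (sym (trans (cong (_* b) ≡0) (*-zeroˡ b)))))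
      ... | inj₂ st = *-monoʳ 0≤h′ (a≤b st)

    open Stage

    paths₁ : ∀ {G p b h} → Stage G p b h → paths 1 G p ≤ M + thin M h
    paths₁ {G} {p} {b} {h} st = begin
      sum (λ z → G p z * 1ℚ) ≡⟨ sum-cong-≗ (λ z → *-identityʳ (G p z)) ⟩
      star G p               ≡⟨ a+[b-a] (h′ st) (star G p) ⟨
      h′ st + r st           ≤⟨ +-mono-≤ (h′≤M st) (r≤thin st) ⟩
      M + thin M h           ∎
      where open ≤-Reasoning

    paths₂ : ∀ {G p b h} → Stage G p b h → M + ⟨ 2 ⟩ * thin M h ≤ mass G → paths 2 G p ≤ V₂ M h (mass G)
    paths₂ {G} {p} {b} {h} st E≥ = begin
      paths 2 G p
        ≤⟨ peel st 1 paths≤power₁ ⟩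
      h′ st * paths 1 (delete p G) (next st) + r st * power 1 (mass G - h′ st - r st)
        ≤⟨ +-monoˡ-≤ (r st * power 1 (mass G - h′ st - r st)) (continue st paths₁) ⟩
      h′ st * (M + thin M (h′ st)) + r st * power 1 (mass G - h′ st - r st)
        ≤⟨ level₂ st (h≤M st) (0≤h′ st) (h′≤M st) (r≤thin st) E≥ ⟩
      V₂ M h (mass G) ∎
      where open ≤-Reasoning

    paths₃ : ∀ {G p b h} (st : Stage G p b h) → massBound st h ≤ mass G →
             paths 3 G p ≤ V₃ M h (h′ st) (mass G)
    paths₃ {G} {p} {b} {h} st E≥ = begin
      paths 3 G p
        ≤⟨ peel st 2 paths≤power₂ ⟩
      h′ st * paths 2 (delete p G) (next st) + r st * power 2 (mass G - h′ st - r st)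
        ≤⟨ +-monoˡ-≤ (r st * power 2 (mass G - h′ st - r st)) (continue st λ st′ →
             subst (λ E → paths 2 (delete p G) (next st) ≤ V₂ M (h′ st) E) (rest st) (paths₂ st′ large)) ⟩
      h′ st * V₂ M (h′ st) (mass G - h′ st - r st) + r st * power 2 (mass G - h′ st - r st)
        ≤⟨ level₃ st (heavy st) (h≤M st) (0≤h′ st) (h′≤M st) E≥ (r≤thin st) ⟩
      V₃ M h (h′ st) (mass G) ∎
      where
      open ≤-Reasoning
      large : M + ⟨ 2 ⟩ * thin M (h′ st) ≤ mass (delete p G)
      large = begin
        M + ⟨ 2 ⟩ * thin M (h′ st)  ≤⟨ rest₃ st (0≤h′ st) (h′≤M st) ⟩
        e₀ st (0≤h′ st) (h′≤M st)   ≤⟨ e₀≤e st (heavy st) (h≤M st) (0≤h′ st) (h′≤M st) E≥ ⟩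
        mass G - h′ st - thin M h   ≤⟨ +-monoʳ-≤ (mass G - h′ st) (neg-antimono-≤ (r≤thin st)) ⟩
        mass G - h′ st - r st       ≡⟨ rest st ⟨
        mass (delete p G)           ∎

    module _ {v p : Fin n} (M≡ : w v p ≡ M) (heavyM : ℤ.+ 16 / 81 ≤ M) where

      private
        1/6≤M : ℤ.+ 1 / 6 ≤ w v p
        1/6≤M = subst (ℤ.+ 1 / 6 ≤_) (sym M≡) (≤-trans 1/6≤16/81 heavyM)

        open module v = Successor (successor v p 1/6≤M) using () renaming (next to u)

        G : Weight n
        G = delete v w

        st : Stage G p v M
        st = record
          { isWeight = delete-isWeight v w isW
          ; subgraph = delete-cases v w
          ; avoids   = delete-to v w p
          ; weight   = trans (isW .symmetric p v) M≡
          ; heavy    = heavyM }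

        p≢v : p ≢ v
        p≢v refl = <⇒≱ (<-≤-trans (positive⁻¹ (ℤ.+ 1 / 6)) 1/6≤M) (≤-reflexive (isW .loopless p))

        -- Only v has been deleted so far, and neither p nor `next` is v, so the edge survives in G.
        heavy-h : ℤ.+ 16 / 81 ≤ h′ st
        heavy-h = subst (ℤ.+ 16 / 81 ≤_) (sym (delete-other v w p≢v (next≢ st))) (heavy-large st)

        r≤R : r st ≤ R M
        r≤R = subst (r st ≤_) (identity (M ∷ []) λ { (M ∷ []) → ^.thin M M ⊑ ^.R M }) (r≤thin st)

        mass-G : mass G ≡ ⟨ 6 ⟩ - star w v
        mass-G = trans (mass-delete v w isW) (cong (_- star w v) mass≡6)

        -- The mass lost is the star of v. By `heavy-degree` it exceeds the weight of vu by at most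
        -- M + R; the opposite bound `E≤` holds because it contains both vp and vu.
        E≥ : ⟨ 6 ⟩ - ⟨ 2 ⟩ * M - R M ≤ mass G
        E≥ = ≤-from (⟨ 6 ⟩ - ⟨ 2 ⟩ * M - R M) (mass G)
          (trans (identity (M ∷ w v u ∷ star w v ∷ []) λ { (M ∷ m ∷ d ∷ []) →
             (M ⊟ m) ⊞ (M ⊞ ^.R M ⊟ (d ⊟ m)) ⊑ (con ⟨ 6 ⟩ ⊟ d) ⊟ (con ⟨ 6 ⟩ ⊟ con ⟨ 2 ⟩ ⊠ M ⊟ ^.R M) })
             (cong (_- (⟨ 6 ⟩ - ⟨ 2 ⟩ * M - R M)) (sym mass-G)))
          (0≤+ (≤⇒0≤- (w≤M v u)) (≤⇒0≤- (v.heavy-degree (w≤M v u) M≤1)))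

        E≤ : mass G ≤ ⟨ 6 ⟩ - M - w v u
        E≤ = ≤-from (mass G) (⟨ 6 ⟩ - M - w v u)
          (trans (identity (M ∷ w v u ∷ star w v ∷ []) λ { (M ∷ m ∷ d ∷ []) →
             d ⊟ (M ⊞ m) ⊑ (con ⟨ 6 ⟩ ⊟ M ⊟ m) ⊟ (con ⟨ 6 ⟩ ⊟ d) })
             (cong (λ E → ⟨ 6 ⟩ - M - w v u - E) (sym mass-G)))
          (≤⇒0≤- (subst (λ m → m + w v u ≤ star w v) M≡ (two-terms≤sum (isW .nonneg v) (≢-sym v.next≢))))

        h : ℚ
        h = h′ st

      paths₄ : ∃ λ h″ → (0ℚ ≤ h″ × h″ ≤ M) × paths 4 G p ≤ V₄ M h h″ (mass G)
      paths₄ with onwards st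
      ... | inj₁ h≡0 = contradiction (subst (ℤ.+ 16 / 81 ≤_) h≡0 heavy-h) (<⇒≱ (positive⁻¹ (ℤ.+ 16 / 81)))
      ... | inj₂ st′ = h′ st′ , (0≤h′ st′ , h′≤M st′) , (begin
        paths 4 G p
          ≤⟨ peel st 3 paths≤power₃ ⟩
        h * paths 3 (delete p G) (next st) + r st * power 3 (mass G - h - r st)
          ≤⟨ +-monoˡ-≤ (r st * power 3 (mass G - h - r st)) (*-monoʳ (0≤h′ st)
               (subst (λ E → paths 3 (delete p G) (next st) ≤ V₃ M h (h′ st′) E) (rest st) (paths₃ st′ large))) ⟩
        h * V₃ M h (h′ st′) (mass G - h - r st) + r st * power 3 (mass G - h - r st)
          ≤⟨ level₄ st heavy-h (h′≤M st) (0≤h′ st′) (h′≤M st′) E≥ r≤R ⟩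
        V₄ M h (h′ st′) (mass G) ∎)
        where
        open ≤-Reasoning
        large : massBound st′ h ≤ mass (delete p G)
        large = ≤-from (massBound st′ h) (mass (delete p G))
          (trans (identity (M ∷ h ∷ r st ∷ mass G ∷ []) λ { (M ∷ h ∷ r ∷ E ∷ []) →
             (E ⊟ (con ⟨ 6 ⟩ ⊟ con ⟨ 2 ⟩ ⊠ M ⊟ ^.R M)) ⊞ (^.R M ⊟ r) ⊑
             (E ⊟ h ⊟ r) ⊟ (con ⟨ 6 ⟩ ⊟ con ⟨ 2 ⟩ ⊠ M ⊟ con ⟨ 2 ⟩ ⊠ ^.R M ⊟ h) })
             (cong (_- massBound st′ h) (sym (rest st))))
          (0≤+ (≤⇒0≤- E≥) (≤⇒0≤- r≤R))

      absurd : ⊥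
      absurd with paths₄
      ... | h″ , (0≤h″ , h″≤M) , bound = contradiction (begin
        w v u * paths 4 G p                   ≤⟨ *-monoʳ (isW .nonneg v u) bound ⟩
        w v u * V₄ M h h″ (mass G)            ≤⟨ *-monoʳ (isW .nonneg v u)
                                                   (V₄-mono st heavy-h (h′≤M st) 0≤h″ h″≤M E≥ E≤) ⟩
        w v u * V₄ M h h″ (⟨ 6 ⟩ - M - w v u) ≤⟨ outermost st heavy-h (h′≤M st) 0≤h″ h″≤M (isW .nonneg v u) (w≤M v u) ⟩
        M * V₄ M h h″ (⟨ 6 ⟩ - ⟨ 2 ⟩ * M)     ≤⟨ closing st (0≤h′ st) (h′≤M st) 0≤h″ h″≤M ⟩
        1ℚ                                    ∎) (<⇒≱ v.heavy′)
        where open ≤-Reasoning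

  -- `absurd` asks for M ≤ 1 and 16 / 81 ≤ M. The first comes from the end p: its edges apart from
  -- the second heavy one weigh less than 1, and pv is among them. The second comes from the second
  -- heavy edge at v.
  heaviest-edge<1/6 : ∀ {v p} → w v p ≡ M → ¬ ℤ.+ 1 / 6 ≤ M
  heaviest-edge<1/6 {v} {p} M≡ 1/6≤M = absurd (<⇒≤ M<1) M≡ (≤-trans v.heavy-large (w≤M v v.next))
    where
    module v = Successor (successor v p (subst (ℤ.+ 1 / 6 ≤_) (sym M≡) 1/6≤M))
    module p = Successor (successor p v (subst (ℤ.+ 1 / 6 ≤_) (trans (sym M≡) (isW .symmetric v p)) 1/6≤M))

    M<1 : M < 1ℚ
    M<1 = ≤-<-trans (≤-from M (star w p - w p p.next)
      (identity (star w p ∷ M ∷ w p p.next ∷ []) λ { (d ∷ M ∷ m ∷ []) → d ⊟ (M ⊞ m) ⊑ d ⊟ m ⊟ M })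
      (≤⇒0≤- (subst (λ M → M + w p p.next ≤ star w p) (trans (isW .symmetric p v) M≡)
        (two-terms≤sum (isW .nonneg p) (≢-sym p.next≢)))))
      p.heavy-rest<1

-- Sums over cycles

∑ : ∀ {n} k → (Vec (Fin n) k → ℚ) → ℚ
∑ zero    f = f []
∑ (suc k) f = sum λ i → ∑ k λ v → f (i ∷ v)

module _ {n : ℕ} where

  ∑-cong : ∀ k {f g : Vec (Fin n) k → ℚ} → (∀ v → f v ≡ g v) → ∑ k f ≡ ∑ k g
  ∑-cong zero    f≗g = f≗g []
  ∑-cong (suc k) f≗g = sum-cong-≗ λ i → ∑-cong k λ v → f≗g (i ∷ v)

  ∑-mono : ∀ k {f g : Vec (Fin n) k → ℚ} → (∀ v → f v ≤ g v) → ∑ k f ≤ ∑ k g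
  ∑-mono zero    f≤g = f≤g []
  ∑-mono (suc k) f≤g = sum-mono λ i → ∑-mono k λ v → f≤g (i ∷ v)

  ∑-+ : ∀ k (f g : Vec (Fin n) k → ℚ) → ∑ k (λ v → f v + g v) ≡ ∑ k f + ∑ k g
  ∑-+ zero    f g = refl
  ∑-+ (suc k) f g = trans
    (sum-cong-≗ λ i → ∑-+ k (λ v → f (i ∷ v)) (λ v → g (i ∷ v)))
    (∑-distrib-+ (λ i → ∑ k λ v → f (i ∷ v)) (λ i → ∑ k λ v → g (i ∷ v)))

  ∑-* : ∀ k c (f : Vec (Fin n) k → ℚ) → ∑ k (λ v → c * f v) ≡ c * ∑ k f
  ∑-* zero    c f = refl
  ∑-* (suc k) c f = trans (sum-cong-≗ λ i → ∑-* k c (λ v → f (i ∷ v)))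
    (sym (*-distribˡ-sum c (λ i → ∑ k λ v → f (i ∷ v))))

  sum-∑ : ∀ {m} k (f : Fin m → Vec (Fin n) k → ℚ) →
          sum (λ i → ∑ k (f i)) ≡ ∑ k (λ v → sum λ i → f i v)
  sum-∑ zero    f = refl
  sum-∑ (suc k) f = trans (∑-comm λ i j → ∑ k λ v → f i (j ∷ v))
    (sum-cong-≗ λ j → sum-∑ k λ i v → f i (j ∷ v))

  ∑-∷ʳ : ∀ k (f : Vec (Fin n) (suc k) → ℚ) → ∑ (suc k) f ≡ ∑ k (λ v → sum λ i → f (v ∷ʳ i))
  ∑-∷ʳ zero    f = refl
  ∑-∷ʳ (suc k) f = sum-cong-≗ λ j → ∑-∷ʳ k λ v → f (j ∷ v)

  rotate : ∀ {k} → Vec (Fin n) (suc k) → Vec (Fin n) (suc k)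
  rotate v = tail v ∷ʳ head v

  ∑-rotate : ∀ k (f : Vec (Fin n) (suc k) → ℚ) → ∑ (suc k) (f ∘ rotate) ≡ ∑ (suc k) f
  ∑-rotate k f = trans (sum-∑ k λ i v → f (v ∷ʳ i)) (sym (∑-∷ʳ k f))

  ∑-reverse : ∀ k (f : Vec (Fin n) k → ℚ) → ∑ k (f ∘ reverse) ≡ ∑ k f
  ∑-reverse zero    f = refl
  ∑-reverse (suc k) f = begin
    sum (λ i → ∑ k λ v → f (reverse (i ∷ v)))  ≡⟨ sum-cong-≗ (λ i → ∑-cong k λ v → cong f (reverse-∷ i v)) ⟩
    sum (λ i → ∑ k λ v → f (reverse v ∷ʳ i))   ≡⟨ sum-cong-≗ (λ i → ∑-reverse k λ v → f (v ∷ʳ i)) ⟩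
    sum (λ i → ∑ k λ v → f (v ∷ʳ i))           ≡⟨ ∑-rotate k f ⟩
    ∑ (suc k) f                                ∎
    where open ≡-Reasoning

module _ {A : Set} where

  Unique-∷ʳ : ∀ {k} {v : Vec A k} {x} → All (_≢ x) v → Unique v → Unique (v ∷ʳ x)
  Unique-∷ʳ []          []        = [] ∷ []
  Unique-∷ʳ (y≢x ∷ v≢x) (y∉v ∷ u) = All-∷ʳ y∉v y≢x ∷ Unique-∷ʳ v≢x u
    where
    All-∷ʳ : ∀ {k} {P : A → Set} {v : Vec A k} {x} → All P v → P x → All P (v ∷ʳ x)
    All-∷ʳ []       px = px ∷ []
    All-∷ʳ (py ∷ p) px = py ∷ All-∷ʳ p px

  Unique-rotate : ∀ {k} {v : Vec A k} {x} → Unique (x ∷ v) → Unique (v ∷ʳ x)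
  Unique-rotate (x∉v ∷ u) = Unique-∷ʳ (All.map ≢-sym x∉v) u

when : {P : Set} → Dec P → ℚ → ℚ
when d q = if does d then q else 0ℚ

module _ {P Q : Set} where

  when-mono : (d : Dec P) (e : Dec Q) → (P → Q) → ∀ {p q} → p ≤ q → 0ℚ ≤ q → when d p ≤ when e q
  when-mono (yes p) (yes q) P→Q p≤q 0≤q = p≤q
  when-mono (yes p) (no ¬q) P→Q p≤q 0≤q = contradiction (P→Q p) ¬q
  when-mono (no _)  (yes _) P→Q p≤q 0≤q = 0≤q
  when-mono (no _)  (no _)  P→Q p≤q 0≤q = ≤-refl

  when-cong : (d : Dec P) (e : Dec Q) → (P → Q) → (Q → P) → ∀ {p q} → p ≡ q → when d p ≡ when e q
  when-cong (yes p) (yes q) P→Q Q→P p≡q = p≡q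
  when-cong (yes p) (no ¬q) P→Q Q→P p≡q = contradiction (P→Q p) ¬q
  when-cong (no ¬p) (yes q) P→Q Q→P p≡q = contradiction (Q→P q) ¬p
  when-cong (no _)  (no _)  P→Q Q→P p≡q = refl

when≤ : ∀ {P : Set} (d : Dec P) {p q} → 0ℚ ≤ q → (P → p ≤ q) → when d p ≤ q
when≤ (yes p) 0≤q p≤q = p≤q p
when≤ (no _)  0≤q p≤q = 0≤q

when-* : ∀ {P : Set} (d : Dec P) c q → when d (c * q) ≡ c * when d q
when-* (yes _) c q = refl
when-* (no _)  c q = sym (*-zeroʳ c)

module _ {n : ℕ} where

  unique? : ∀ {k} (v : Vec (Fin n) k) → Dec (Unique v)
  unique? = allPairs? λ i j → ¬? (i ≟ j)

  closedWalk : Weight n → Vec (Fin n) 6 → ℚ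
  closedWalk w (a ∷ b ∷ c ∷ d ∷ e ∷ f ∷ []) = w a b * w b c * w c d * w d e * w e f * w f a

  -- Every 6-cycle is counted twelve times.
  cycles : Weight n → ℚ
  cycles w = ∑ 6 λ v → when (unique? v) (closedWalk w v)

  -- completions w a b is the derivative of the sum over all 6-cycles in the weight of the edge ab.
  completion : Weight n → Fin n → Fin n → Vec (Fin n) 4 → ℚ
  completion w a b (c ∷ d ∷ e ∷ f ∷ []) = w b c * w c d * w d e * w e f * w f a

  completions : Weight n → Fin n → Fin n → ℚ
  completions w a b = ∑ 4 λ v → when (unique? (a ∷ b ∷ v)) (completion w a b v)

  pathWeight : ∀ {k} → Weight n → Fin n → Vec (Fin n) k → ℚ
  pathWeight w x []      = 1ℚ
  pathWeight w x (z ∷ v) = w x z * pathWeight (delete x w) z v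

  paths≡∑ : ∀ k w x → paths k w x ≡ ∑ k (pathWeight w x)
  paths≡∑ zero    w x = refl
  paths≡∑ (suc k) w x = sum-cong-≗ λ z → trans (cong (w x z *_) (paths≡∑ k (delete x w) z))
    (sym (∑-* k (w x z) (pathWeight (delete x w) z)))

  pathWeight-nonNeg : ∀ {w} → IsWeight w → ∀ {k} x (v : Vec (Fin n) k) → 0ℚ ≤ pathWeight w x v
  pathWeight-nonNeg isW x []      = nonNegative⁻¹ 1ℚ
  pathWeight-nonNeg isW x (z ∷ v) =
    0≤* (isW .nonneg x z) (pathWeight-nonNeg (delete-isWeight x _ isW) z v)

  pathWeight-delete : ∀ {w k} y x (v : Vec (Fin n) k) → Unique (y ∷ x ∷ v) →
                      pathWeight (delete y w) x v ≡ pathWeight w x v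
  pathWeight-delete y x [] u = refl
  pathWeight-delete {w} y x (z ∷ v) ((y≢x ∷ y≢z ∷ y∉v) ∷ (x≢z ∷ x∉v) ∷ (z∉v ∷ u)) = cong₂ _*_
    (delete-other y w (≢-sym y≢x) (≢-sym y≢z))
    -- The deletion of y lies beneath that of x, so both are stripped off and the one of x is put
    -- back.
    (trans (pathWeight-delete {delete y w} x z v ((x≢z ∷ x∉v) ∷ z∉v ∷ u))
    (trans (pathWeight-delete {w} y z v ((y≢z ∷ y∉v) ∷ z∉v ∷ u))
      (sym (pathWeight-delete {w} x z v ((x≢z ∷ x∉v) ∷ z∉v ∷ u)))))

  pathWeight-unique : ∀ w (a b c d e f : Fin n) → Unique (a ∷ b ∷ c ∷ d ∷ e ∷ f ∷ []) →
    pathWeight (delete a w) b (c ∷ d ∷ e ∷ f ∷ []) ≡ w b c * (w c d * (w d e * (w e f * 1ℚ)))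
  pathWeight-unique w a b c d e f u@(a∉ ∷ u₁@(_ ∷ u₂@(_ ∷ u₃@(_ ∷ _)))) = trans
    (pathWeight-delete {w} a b (c ∷ d ∷ e ∷ f ∷ []) u) (cong (w b c *_) (trans (pathWeight-delete {w} b c (d ∷ e ∷ f ∷ []) u₁)
    (cong (w c d *_) (trans (pathWeight-delete {w} c d (e ∷ f ∷ []) u₂)
    (cong (w d e *_) (cong (_* 1ℚ) (delete-last u₃)))))))
    where
    delete-last : Unique (d ∷ e ∷ f ∷ []) → delete d w e f ≡ w e f
    delete-last ((d≢e ∷ d≢f ∷ []) ∷ _) = delete-other d w (≢-sym d≢e) (≢-sym d≢f)

  -- The edge fa is charged m, which is allowed because f differs from b; the other four edges form
  -- a path from b that avoids a.
  completions≤paths : ∀ {w} → IsWeight w → ∀ a b m → 0ℚ ≤ m → (∀ z → z ≢ b → w a z ≤ m) →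
                      completions w a b ≤ m * paths 4 (delete a w) b
  completions≤paths {w} isW a b m 0≤m ≤m = begin
    completions w a b
      ≤⟨ ∑-mono 4 bound ⟩
    ∑ 4 (λ v → m * pathWeight (delete a w) b v)
      ≡⟨ ∑-* 4 m (pathWeight (delete a w) b) ⟩
    m * ∑ 4 (pathWeight (delete a w) b)
      ≡⟨ cong (m *_) (paths≡∑ 4 (delete a w) b) ⟨
    m * paths 4 (delete a w) b ∎
    where
    open ≤-Reasoning
    bound : ∀ v → when (unique? (a ∷ b ∷ v)) (completion w a b v) ≤ m * pathWeight (delete a w) b v
    bound v@(c ∷ d ∷ e ∷ f ∷ []) = when≤ (unique? (a ∷ b ∷ v))
      (0≤* 0≤m (pathWeight-nonNeg (delete-isWeight a w isW) b v))
      λ { u@(_ ∷ (_ ∷ _ ∷ _ ∷ b≢f ∷ []) ∷ _) → begin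
      w b c * w c d * w d e * w e f * w f a
        ≤⟨ *-monoʳ (0≤* (0≤* (0≤* (isW .nonneg b c) (isW .nonneg c d)) (isW .nonneg d e)) (isW .nonneg e f))
             (subst (_≤ m) (isW .symmetric a f) (≤m f (≢-sym b≢f))) ⟩
      w b c * w c d * w d e * w e f * m
        ≡⟨ identity (w b c ∷ w c d ∷ w d e ∷ w e f ∷ m ∷ []) (λ { (p ∷ q ∷ r ∷ s ∷ m ∷ []) →
             p ⊠ q ⊠ r ⊠ s ⊠ m ⊑ m ⊠ (p ⊠ (q ⊠ (r ⊠ (s ⊠ con 1ℚ)))) }) ⟩
      m * (w b c * (w c d * (w d e * (w e f * 1ℚ))))
        ≡⟨ cong (m *_) (pathWeight-unique w a b c d e f u) ⟨
      m * pathWeight (delete a w) b v ∎ }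

module _ {n : ℕ} where

  ∑-unique : (Vec (Fin n) 6 → ℚ) → ℚ
  ∑-unique g = ∑ 6 λ v → when (unique? v) (g v)

  -- Five further rotations bring six entries back to their places.
  Unique-rotate⁻¹ : ∀ (v : Vec (Fin n) 6) → Unique (rotate v) → Unique v
  Unique-rotate⁻¹ (_ ∷ _ ∷ _ ∷ _ ∷ _ ∷ _ ∷ []) =
    Unique-rotate ∘ Unique-rotate ∘ Unique-rotate ∘ Unique-rotate ∘ Unique-rotate

  ∑-unique-rotate : ∀ g → ∑-unique (g ∘ rotate) ≡ ∑-unique g
  ∑-unique-rotate g = trans
    (∑-cong 6 pointwise)
    (∑-rotate 5 λ v → when (unique? v) (g v))
    where
    pointwise : ∀ v → when (unique? v) (g (rotate v)) ≡ when (unique? (rotate v)) (g (rotate v))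
    pointwise v@(_ ∷ _) = when-cong (unique? v) (unique? (rotate v)) Unique-rotate (Unique-rotate⁻¹ v) refl

  -- ι replaces the weight of the first edge: ι = w gives back the closed walk, and the indicator of
  -- an edge singles out the walks that start along it.
  markedWalk : Weight n → Weight n → Vec (Fin n) 6 → ℚ
  markedWalk ι w (a ∷ b ∷ v) = ι a b * completion w a b v

  ∑-unique-marked : ∀ (ι w : Weight n) → ∑-unique (markedWalk ι w) ≡
    sum λ a → sum λ b → ι a b * completions w a b
  ∑-unique-marked ι w = sum-cong-≗ λ a → sum-cong-≗ λ b → trans
    (∑-cong 4 λ v → when-* (unique? (a ∷ b ∷ v)) (ι a b) (completion w a b v))
    (∑-* 4 (ι a b) λ v → when (unique? (a ∷ b ∷ v)) (completion w a b v))

  closedWalk≡ : ∀ w v → closedWalk w v ≡ markedWalk w w v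
  closedWalk≡ w (a ∷ b ∷ c ∷ d ∷ e ∷ f ∷ []) = identity (w a b ∷ w b c ∷ w c d ∷ w d e ∷ w e f ∷ w f a ∷ [])
    λ { (p ∷ q ∷ r ∷ s ∷ t ∷ u ∷ []) → p ⊠ q ⊠ r ⊠ s ⊠ t ⊠ u ⊑ p ⊠ (q ⊠ r ⊠ s ⊠ t ⊠ u) }

  cycles≡ : ∀ w → cycles w ≡ sum λ a → sum λ b → w a b * completions w a b
  cycles≡ w = trans
    (∑-cong 6 λ v → cong (when (unique? v)) (closedWalk≡ w v))
    (∑-unique-marked w w)

  cycles≤ : ∀ {w} → IsWeight w → ∀ {C} → (∀ a b → completions w a b ≤ C) →
            cycles w ≤ ⟨ 2 ⟩ * mass w * C
  cycles≤ {w} isW {C} ≤C = begin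
    cycles w                                          ≡⟨ cycles≡ w ⟩
    sum (λ a → sum λ b → w a b * completions w a b)   ≤⟨ sum-mono (λ a → sum-mono λ b → *-monoʳ (isW .nonneg a b) (≤C a b)) ⟩
    sum (λ a → sum λ b → w a b * C)                   ≡⟨ sum-cong-≗ (λ a → sym (*-distribʳ-sum C (w a))) ⟩
    sum (λ a → star w a * C)                          ≡⟨ *-distribʳ-sum C (star w) ⟨
    sum (star w) * C                                  ≡⟨ identity (sum (star w) ∷ C ∷ []) (λ { (s ∷ c ∷ []) → s ⊠ c ⊑ con ⟨ 2 ⟩ ⊠ (con ½ ⊠ s) ⊠ c }) ⟩
    ⟨ 2 ⟩ * mass w * C                                ∎
    where open ≤-Reasoning

  completions-symmetric : ∀ {w} → IsWeight w → ∀ a b → completions w a b ≡ completions w b a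
  completions-symmetric {w} isW a b = sym (trans
    (∑-cong 4 pointwise)
    (∑-reverse 4 λ v → when (unique? (a ∷ b ∷ v)) (completion w a b v)))
    where
    reversal : Vec (Fin n) 4 → ℚ
    reversal v = when (unique? (a ∷ b ∷ reverse v)) (completion w a b (reverse v))

    flip : ∀ {a b c d e f : Fin n} → Unique (a ∷ b ∷ c ∷ d ∷ e ∷ f ∷ []) → Unique (b ∷ a ∷ f ∷ e ∷ d ∷ c ∷ [])
    flip ((ab ∷ ac ∷ ad ∷ ae ∷ af ∷ []) ∷ (bc ∷ bd ∷ be ∷ bf ∷ []) ∷ (cd ∷ ce ∷ cf ∷ []) ∷ (de ∷ df ∷ []) ∷ (ef ∷ []) ∷ [] ∷ []) =
      (≢-sym ab ∷ bf ∷ be ∷ bd ∷ bc ∷ []) ∷ (af ∷ ae ∷ ad ∷ ac ∷ []) ∷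
      (≢-sym ef ∷ ≢-sym df ∷ ≢-sym cf ∷ []) ∷ (≢-sym de ∷ ≢-sym ce ∷ []) ∷ (≢-sym cd ∷ []) ∷ [] ∷ []

    reversed : ∀ p q r s t {p′ q′ r′ s′ t′} → t′ ≡ t → s′ ≡ s → r′ ≡ r → q′ ≡ q → p′ ≡ p →
               p * q * r * s * t ≡ t′ * s′ * r′ * q′ * p′
    reversed p q r s t refl refl refl refl refl = identity (p ∷ q ∷ r ∷ s ∷ t ∷ [])
      λ { (p ∷ q ∷ r ∷ s ∷ t ∷ []) → p ⊠ q ⊠ r ⊠ s ⊠ t ⊑ t ⊠ s ⊠ r ⊠ q ⊠ p }

    pointwise : ∀ v → when (unique? (b ∷ a ∷ v)) (completion w b a v) ≡ reversal v
    pointwise (c ∷ d ∷ e ∷ f ∷ []) =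
      when-cong (unique? (b ∷ a ∷ c ∷ d ∷ e ∷ f ∷ [])) (unique? (a ∷ b ∷ f ∷ e ∷ d ∷ c ∷ [])) flip flip
        (reversed (w a c) (w c d) (w d e) (w e f) (w f b)
          (isW .symmetric b f) (isW .symmetric f e) (isW .symmetric e d) (isW .symmetric d c) (isW .symmetric c a))

-- Taking weight off an edge

-- Weierstrass' product inequality in homogeneous form. A monomial containing k ≥ 1 of the b's
-- occurs once on the left and k times on the right: the linear loss is an upper bound for the true
-- one.
weierstrass : ∀ {b₁ b₂ b₃ b₄ b₅ b₆ c₁ c₂ c₃ c₄ c₅ c₆ a₁ a₂ a₃ a₄ a₅ a₆} →
  All (0ℚ ≤_) (b₁ ∷ b₂ ∷ b₃ ∷ b₄ ∷ b₅ ∷ b₆ ∷ c₁ ∷ c₂ ∷ c₃ ∷ c₄ ∷ c₅ ∷ c₆ ∷ []) →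
  b₁ + c₁ ≡ a₁ → b₂ + c₂ ≡ a₂ → b₃ + c₃ ≡ a₃ → b₄ + c₄ ≡ a₄ → b₅ + c₅ ≡ a₅ → b₆ + c₆ ≡ a₆ →
  a₁ * a₂ * a₃ * a₄ * a₅ * a₆ ≤ c₁ * c₂ * c₃ * c₄ * c₅ * c₆
    + (b₁ * (a₂ * a₃ * a₄ * a₅ * a₆) + b₂ * (a₃ * a₄ * a₅ * a₆ * a₁) + b₃ * (a₄ * a₅ * a₆ * a₁ * a₂)
    + b₄ * (a₅ * a₆ * a₁ * a₂ * a₃) + b₅ * (a₆ * a₁ * a₂ * a₃ * a₄) + b₆ * (a₁ * a₂ * a₃ * a₄ * a₅))
weierstrass {b₁} {b₂} {b₃} {b₄} {b₅} {b₆} {c₁} {c₂} {c₃} {c₄} {c₅} {c₆} nonneg refl refl refl refl refl refl =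
  inequality (b₁ ∷ b₂ ∷ b₃ ∷ b₄ ∷ b₅ ∷ b₆ ∷ c₁ ∷ c₂ ∷ c₃ ∷ c₄ ∷ c₅ ∷ c₆ ∷ []) nonneg
    (λ { (b₁ ∷ b₂ ∷ b₃ ∷ b₄ ∷ b₅ ∷ b₆ ∷ c₁ ∷ c₂ ∷ c₃ ∷ c₄ ∷ c₅ ∷ c₆ ∷ []) →
      let a₁ = b₁ ⊞ c₁
          a₂ = b₂ ⊞ c₂
          a₃ = b₃ ⊞ c₃
          a₄ = b₄ ⊞ c₄
          a₅ = b₅ ⊞ c₅
          a₆ = b₆ ⊞ c₆ in
      a₁ ⊠ a₂ ⊠ a₃ ⊠ a₄ ⊠ a₅ ⊠ a₆ ⊑ c₁ ⊠ c₂ ⊠ c₃ ⊠ c₄ ⊠ c₅ ⊠ c₆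
      ⊞ (b₁ ⊠ (a₂ ⊠ a₃ ⊠ a₄ ⊠ a₅ ⊠ a₆) ⊞ b₂ ⊠ (a₃ ⊠ a₄ ⊠ a₅ ⊠ a₆ ⊠ a₁) ⊞ b₃ ⊠ (a₄ ⊠ a₅ ⊠ a₆ ⊠ a₁ ⊠ a₂)
      ⊞ b₄ ⊠ (a₅ ⊠ a₆ ⊠ a₁ ⊠ a₂ ⊠ a₃) ⊞ b₅ ⊠ (a₆ ⊠ a₁ ⊠ a₂ ⊠ a₃ ⊠ a₄) ⊞ b₆ ⊠ (a₁ ⊠ a₂ ⊠ a₃ ⊠ a₄ ⊠ a₅)) })
    coefficients

when-+ : ∀ {P : Set} (d : Dec P) p q → when d (p + q) ≡ when d p + when d q
when-+ (yes _) p q = refl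
when-+ (no _)  p q = sym (+-identityˡ 0ℚ)

module _ {n : ℕ} where

  ∑-unique-+ : ∀ (f g : Vec (Fin n) 6 → ℚ) → ∑-unique (λ v → f v + g v) ≡ ∑-unique f + ∑-unique g
  ∑-unique-+ f g = trans (∑-cong 6 λ v → when-+ (unique? v) (f v) (g v))
    (∑-+ 6 (λ v → when (unique? v) (f v)) (λ v → when (unique? v) (g v)))

  ∑-unique-* : ∀ c (f : Vec (Fin n) 6 → ℚ) → ∑-unique (λ v → c * f v) ≡ c * ∑-unique f
  ∑-unique-* c f = trans (∑-cong 6 λ v → when-* (unique? v) c (f v))
    (∑-* 6 c (λ v → when (unique? v) (f v)))

  ∑-unique-mono : ∀ {f g : Vec (Fin n) 6 → ℚ} → (∀ v → f v ≤ g v) → ∑-unique f ≤ ∑-unique g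
  ∑-unique-mono {f} {g} f≤g = ∑-mono 6 λ v → pointwise (unique? v) (f≤g v)
    where
    pointwise : ∀ {P : Set} (d : Dec P) {p q} → p ≤ q → when d p ≤ when d q
    pointwise (yes _) p≤q = p≤q
    pointwise (no _)  p≤q = ≤-refl

  ∑-rotations : (Vec (Fin n) 6 → ℚ) → Vec (Fin n) 6 → ℚ
  ∑-rotations g v = g v + (g ∘ r) v + (g ∘ r ∘ r) v + (g ∘ r ∘ r ∘ r) v
    + (g ∘ r ∘ r ∘ r ∘ r) v + (g ∘ r ∘ r ∘ r ∘ r ∘ r) v
    where r = rotate

  -- S is abstract because the same computation serves the sum over distinct vertices and the sum
  -- over all tuples.
  rotation-invariant-sum : ∀ (S : (Vec (Fin n) 6 → ℚ) → ℚ) →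
    (∀ f g → S (λ v → f v + g v) ≡ S f + S g) → (∀ g → S (g ∘ rotate) ≡ S g) →
    ∀ g → S (∑-rotations g) ≡ ⟨ 6 ⟩ * S g
  rotation-invariant-sum S S-+ S-rotate g = begin
    S (∑-rotations g)
      ≡⟨ S-+ (λ v → g v + g (r v) + g (r (r v)) + g (r (r (r v))) + g (r (r (r (r v))))) g₅ ⟩
    S (λ v → g v + g (r v) + g (r (r v)) + g (r (r (r v))) + g (r (r (r (r v))))) + S g₅
      ≡⟨ cong (_+ S g₅) (S-+ (λ v → g v + g (r v) + g (r (r v)) + g (r (r (r v)))) g₄) ⟩
    S (λ v → g v + g (r v) + g (r (r v)) + g (r (r (r v)))) + S g₄ + S g₅
      ≡⟨ cong (λ s → s + S g₄ + S g₅) (S-+ (λ v → g v + g (r v) + g (r (r v))) g₃) ⟩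
    S (λ v → g v + g (r v) + g (r (r v))) + S g₃ + S g₄ + S g₅
      ≡⟨ cong (λ s → s + S g₃ + S g₄ + S g₅) (S-+ (λ v → g v + g (r v)) g₂) ⟩
    S (λ v → g v + g (r v)) + S g₂ + S g₃ + S g₄ + S g₅
      ≡⟨ cong (λ s → s + S g₂ + S g₃ + S g₄ + S g₅) (S-+ g g₁) ⟩
    S g + S g₁ + S g₂ + S g₃ + S g₄ + S g₅
      ≡⟨ six e₁ e₂ e₃ e₄ e₅ ⟩
    ⟨ 6 ⟩ * S g ∎
    where
    open ≡-Reasoning
    r : Vec (Fin n) 6 → Vec (Fin n) 6
    r = rotate
    g₁ g₂ g₃ g₄ g₅ : Vec (Fin n) 6 → ℚ
    g₁ = g ∘ r
    g₂ = g₁ ∘ r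
    g₃ = g₂ ∘ r
    g₄ = g₃ ∘ r
    g₅ = g₄ ∘ r
    e₁ = S-rotate g
    e₂ = trans (S-rotate g₁) e₁
    e₃ = trans (S-rotate g₂) e₂
    e₄ = trans (S-rotate g₃) e₃
    e₅ = trans (S-rotate g₄) e₄
    six : ∀ {a b c d e f} → b ≡ a → c ≡ a → d ≡ a → e ≡ a → f ≡ a → a + b + c + d + e + f ≡ ⟨ 6 ⟩ * a
    six {a} refl refl refl refl refl = identity (a ∷ []) λ { (a ∷ []) → a ⊞ a ⊞ a ⊞ a ⊞ a ⊞ a ⊑ con ⟨ 6 ⟩ ⊠ a }

  indicator : Fin n → Fin n → ℚ
  indicator x i = if does (i ≟ x) then 1ℚ else 0ℚ

  0≤indicator : ∀ x i → 0ℚ ≤ indicator x i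
  0≤indicator x i with does (i ≟ x)
  ... | true  = nonNegative⁻¹ 1ℚ
  ... | false = ≤-refl

  sum-indicator : ∀ x (f : Fin n → ℚ) → sum (λ i → indicator x i * f i) ≡ f x
  sum-indicator x f = trans (sum-cong-≗ pointwise) (sum-select f x)
    where
    pointwise : ∀ i → indicator x i * f i ≡ (if does (i ≟ x) then f i else 0ℚ)
    pointwise i with does (i ≟ x)
    ... | true  = *-identityˡ (f i)
    ... | false = *-zeroˡ (f i)

  module _ (a b : Fin n) where

    edge : Weight n
    edge i j = indicator a i * indicator b j + indicator b i * indicator a j

    edge-symmetric : ∀ i j → edge i j ≡ edge j i
    edge-symmetric i j = identity (indicator a i ∷ indicator b i ∷ indicator a j ∷ indicator b j ∷ [])
      λ { (p ∷ q ∷ r ∷ s ∷ []) → p ⊠ s ⊞ q ⊠ r ⊑ r ⊠ q ⊞ s ⊠ p }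

    edge-nonNeg : ∀ i j → 0ℚ ≤ edge i j
    edge-nonNeg i j = 0≤+ (0≤* (0≤indicator a i) (0≤indicator b j)) (0≤* (0≤indicator b i) (0≤indicator a j))

    edge-cases : a ≢ b → ∀ i j → edge i j ≡ 0ℚ ⊎ edge i j ≡ 1ℚ × (i ≡ a × j ≡ b ⊎ i ≡ b × j ≡ a)
    edge-cases a≢b i j with i ≟ a | j ≟ b | i ≟ b | j ≟ a
    ... | yes refl | _        | yes refl | _        = contradiction refl a≢b
    ... | _        | yes refl | _        | yes refl = contradiction refl a≢b
    ... | yes i≡a  | yes j≡b  | no _     | no _     = inj₂ (refl , inj₁ (i≡a , j≡b))
    ... | yes _    | no _     | no _     | yes _    = inj₁ refl
    ... | yes _    | no _     | no _     | no _     = inj₁ refl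
    ... | no _     | yes _    | yes _    | no _     = inj₁ refl
    ... | no _     | no _     | yes i≡b  | yes j≡a  = inj₂ (refl , inj₂ (i≡b , j≡a))
    ... | no _     | no _     | yes _    | no _     = inj₁ refl
    ... | no _     | yes _    | no _     | no _     = inj₁ refl
    ... | no _     | no _     | no _     | yes _    = inj₁ refl
    ... | no _     | no _     | no _     | no _     = inj₁ refl

    edge-loopless : a ≢ b → ∀ i → edge i i ≡ 0ℚ
    edge-loopless a≢b i with edge-cases a≢b i i
    ... | inj₁ ≡0                         = ≡0
    ... | inj₂ (_ , inj₁ (refl , i≡b)) = contradiction i≡b a≢b
    ... | inj₂ (_ , inj₂ (refl , i≡a)) = contradiction (sym i≡a) a≢b

    sum-edge : ∀ (g : Weight n) → sum (λ i → sum λ j → edge i j * g i j) ≡ g a b + g b a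
    sum-edge g = begin
      sum (λ i → sum λ j → edge i j * g i j)
        ≡⟨ sum-cong-≗ inner ⟩
      sum (λ i → indicator a i * g i b + indicator b i * g i a)
        ≡⟨ ∑-distrib-+ (λ i → indicator a i * g i b) (λ i → indicator b i * g i a) ⟩
      sum (λ i → indicator a i * g i b) + sum (λ i → indicator b i * g i a)
        ≡⟨ cong₂ _+_ (sum-indicator a (λ i → g i b)) (sum-indicator b (λ i → g i a)) ⟩
      g a b + g b a ∎
      where
      open ≡-Reasoning
      select : ∀ x y i → sum (λ j → indicator x i * (indicator y j * g i j)) ≡ indicator x i * g i y
      select x y i = trans (sym (*-distribˡ-sum (indicator x i) (λ j → indicator y j * g i j)))
        (cong (indicator x i *_) (sum-indicator y (g i)))

      inner : ∀ i → sum (λ j → edge i j * g i j) ≡ indicator a i * g i b + indicator b i * g i a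
      inner i = begin
        sum (λ j → edge i j * g i j)
          ≡⟨ sum-cong-≗ (λ j → identity (indicator a i ∷ indicator b i ∷ indicator a j ∷ indicator b j ∷ g i j ∷ [])
               λ { (p ∷ q ∷ r ∷ s ∷ g ∷ []) → (p ⊠ s ⊞ q ⊠ r) ⊠ g ⊑ p ⊠ (s ⊠ g) ⊞ q ⊠ (r ⊠ g) }) ⟩
        sum (λ j → indicator a i * (indicator b j * g i j) + indicator b i * (indicator a j * g i j))
          ≡⟨ ∑-distrib-+ (λ j → indicator a i * (indicator b j * g i j)) (λ j → indicator b i * (indicator a j * g i j)) ⟩
        sum (λ j → indicator a i * (indicator b j * g i j)) + sum (λ j → indicator b i * (indicator a j * g i j))
          ≡⟨ cong₂ _+_ (select a b i) (select b a i) ⟩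
        indicator a i * g i b + indicator b i * g i a ∎

  module Perturbation {w : Weight n} (isW : IsWeight w) (mass≡6 : mass w ≡ ⟨ 6 ⟩)
    {a b : Fin n} (a≢b : a ≢ b) {t : ℚ} (0≤t : 0ℚ ≤ t) (6t≤ : ⟨ 6 ⟩ * t ≤ w a b) where

    K : ℚ
    K = 1ℚ + t

    -- Scaling by 1 + t adds 6t to the mass 6, and exactly this amount is taken off the edge ab.
    perturbed : Weight n
    perturbed i j = K * w i j - ⟨ 6 ⟩ * t * edge a b i j

    private
      0≤K : 0ℚ ≤ K
      0≤K = 0≤+ (nonNegative⁻¹ 1ℚ) 0≤t

      w≤Kw : ∀ i j → w i j ≤ K * w i j
      w≤Kw i j = ≤-from (w i j) (K * w i j)
        (identity (t ∷ w i j ∷ []) λ { (t ∷ p ∷ []) → t ⊠ p ⊑ (con 1ℚ ⊞ t) ⊠ p ⊟ p })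
        (0≤* 0≤t (isW .nonneg i j))

      0≤6tι : ∀ i j → 0ℚ ≤ ⟨ 6 ⟩ * t * edge a b i j
      0≤6tι i j = 0≤* (0≤* (nonNegative⁻¹ ⟨ 6 ⟩) 0≤t) (edge-nonNeg a b i j)

      6tι≤ : ∀ i j → ⟨ 6 ⟩ * t * edge a b i j ≤ K * w i j
      6tι≤ i j with edge-cases a b a≢b i j
      ... | inj₁ ≡0 = subst (λ e → ⟨ 6 ⟩ * t * e ≤ K * w i j) (sym ≡0)
        (subst (_≤ K * w i j) (sym (*-zeroʳ (⟨ 6 ⟩ * t))) (0≤* 0≤K (isW .nonneg i j)))
      ... | inj₂ (≡1 , inj₁ (refl , refl)) = subst (λ e → ⟨ 6 ⟩ * t * e ≤ K * w i j) (sym ≡1)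
        (subst (_≤ K * w i j) (sym (*-identityʳ (⟨ 6 ⟩ * t))) (≤-trans 6t≤ (w≤Kw i j)))
      ... | inj₂ (≡1 , inj₂ (refl , refl)) = subst (λ e → ⟨ 6 ⟩ * t * e ≤ K * w i j) (sym ≡1)
        (subst (_≤ K * w i j) (sym (*-identityʳ (⟨ 6 ⟩ * t)))
          (≤-trans 6t≤ (subst (_≤ K * w i j) (isW .symmetric i j) (w≤Kw i j))))

    perturbed-isWeight : IsWeight perturbed
    perturbed-isWeight .symmetric i j = cong₂ (λ p e → K * p - ⟨ 6 ⟩ * t * e) (isW .symmetric i j) (edge-symmetric a b i j)
    perturbed-isWeight .nonneg i j = ≤⇒0≤- (6tι≤ i j)
    perturbed-isWeight .loopless i = trans
      (cong₂ (λ p e → K * p - ⟨ 6 ⟩ * t * e) (isW .loopless i) (edge-loopless a b a≢b i))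
      (identity (t ∷ []) λ { (t ∷ []) → (con 1ℚ ⊞ t) ⊠ con 0ℚ ⊟ con ⟨ 6 ⟩ ⊠ t ⊠ con 0ℚ ⊑ con 0ℚ })

    perturbed-mass : mass perturbed ≡ ⟨ 6 ⟩
    perturbed-mass = begin
      ½ * sum (star perturbed)
        ≡⟨ cong (½ *_) (sum-cong-≗ λ i → trans (sum-difference (λ j → K * w i j) (λ j → ⟨ 6 ⟩ * t * edge a b i j))
             (cong₂ _-_ (sym (*-distribˡ-sum K (w i))) (sym (*-distribˡ-sum (⟨ 6 ⟩ * t) (edge a b i))))) ⟩
      ½ * sum (λ i → K * star w i - ⟨ 6 ⟩ * t * sum (edge a b i))
        ≡⟨ cong (½ *_) (trans (sum-difference (λ i → K * star w i) (λ i → ⟨ 6 ⟩ * t * sum (edge a b i)))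
             (cong₂ _-_ (sym (*-distribˡ-sum K (star w))) (sym (*-distribˡ-sum (⟨ 6 ⟩ * t) (λ i → sum (edge a b i)))))) ⟩
      ½ * (K * sum (star w) - ⟨ 6 ⟩ * t * sum (λ i → sum (edge a b i)))
        ≡⟨ cong (λ e → ½ * (K * sum (star w) - ⟨ 6 ⟩ * t * e))
             (trans (sum-cong-≗ λ i → sum-cong-≗ λ j → sym (*-identityʳ (edge a b i j))) (sum-edge a b (λ _ _ → 1ℚ))) ⟩
      ½ * (K * sum (star w) - ⟨ 6 ⟩ * t * (1ℚ + 1ℚ))
        ≡⟨ identity (t ∷ sum (star w) ∷ []) (λ { (t ∷ s ∷ []) →
             con ½ ⊠ ((con 1ℚ ⊞ t) ⊠ s ⊟ con ⟨ 6 ⟩ ⊠ t ⊠ con (1ℚ + 1ℚ)) ⊑ (con 1ℚ ⊞ t) ⊠ (con ½ ⊠ s) ⊟ con ⟨ 6 ⟩ ⊠ t }) ⟩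
      K * mass w - ⟨ 6 ⟩ * t
        ≡⟨ cong (λ m → K * m - ⟨ 6 ⟩ * t) mass≡6 ⟩
      K * ⟨ 6 ⟩ - ⟨ 6 ⟩ * t
        ≡⟨ identity (t ∷ []) (λ { (t ∷ []) → (con 1ℚ ⊞ t) ⊠ con ⟨ 6 ⟩ ⊟ con ⟨ 6 ⟩ ⊠ t ⊑ con ⟨ 6 ⟩ }) ⟩
      ⟨ 6 ⟩ ∎
      where open ≡-Reasoning

    private
      K⁵ : ℚ
      K⁵ = K * K * K * K * K

      pointwise : ∀ v → K⁵ * K * closedWalk w v ≤
        closedWalk perturbed v + ⟨ 6 ⟩ * t * K⁵ * ∑-rotations (markedWalk (edge a b) w) v
      pointwise (x₁ ∷ x₂ ∷ x₃ ∷ x₄ ∷ x₅ ∷ x₆ ∷ []) = subst₂ _≤_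
        (identity (K ∷ w₁ ∷ w₂ ∷ w₃ ∷ w₄ ∷ w₅ ∷ w₆ ∷ []) λ { (K ∷ w₁ ∷ w₂ ∷ w₃ ∷ w₄ ∷ w₅ ∷ w₆ ∷ []) →
          (K ⊠ w₁) ⊠ (K ⊠ w₂) ⊠ (K ⊠ w₃) ⊠ (K ⊠ w₄) ⊠ (K ⊠ w₅) ⊠ (K ⊠ w₆) ⊑
          K ⊠ K ⊠ K ⊠ K ⊠ K ⊠ K ⊠ (w₁ ⊠ w₂ ⊠ w₃ ⊠ w₄ ⊠ w₅ ⊠ w₆) })
        (cong (closedWalk perturbed (x₁ ∷ x₂ ∷ x₃ ∷ x₄ ∷ x₅ ∷ x₆ ∷ []) +_)
          (identity (K ∷ t ∷ w₁ ∷ w₂ ∷ w₃ ∷ w₄ ∷ w₅ ∷ w₆ ∷ ι₁ ∷ ι₂ ∷ ι₃ ∷ ι₄ ∷ ι₅ ∷ ι₆ ∷ [])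
            λ { (K ∷ t ∷ w₁ ∷ w₂ ∷ w₃ ∷ w₄ ∷ w₅ ∷ w₆ ∷ ι₁ ∷ ι₂ ∷ ι₃ ∷ ι₄ ∷ ι₅ ∷ ι₆ ∷ []) →
              let s = con ⟨ 6 ⟩ ⊠ t
                  a₁ = K ⊠ w₁
                  a₂ = K ⊠ w₂
                  a₃ = K ⊠ w₃
                  a₄ = K ⊠ w₄
                  a₅ = K ⊠ w₅
                  a₆ = K ⊠ w₆ in
              s ⊠ ι₁ ⊠ (a₂ ⊠ a₃ ⊠ a₄ ⊠ a₅ ⊠ a₆) ⊞ s ⊠ ι₂ ⊠ (a₃ ⊠ a₄ ⊠ a₅ ⊠ a₆ ⊠ a₁)
              ⊞ s ⊠ ι₃ ⊠ (a₄ ⊠ a₅ ⊠ a₆ ⊠ a₁ ⊠ a₂) ⊞ s ⊠ ι₄ ⊠ (a₅ ⊠ a₆ ⊠ a₁ ⊠ a₂ ⊠ a₃)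
              ⊞ s ⊠ ι₅ ⊠ (a₆ ⊠ a₁ ⊠ a₂ ⊠ a₃ ⊠ a₄) ⊞ s ⊠ ι₆ ⊠ (a₁ ⊠ a₂ ⊠ a₃ ⊠ a₄ ⊠ a₅) ⊑
              s ⊠ (K ⊠ K ⊠ K ⊠ K ⊠ K) ⊠
                (ι₁ ⊠ (w₂ ⊠ w₃ ⊠ w₄ ⊠ w₅ ⊠ w₆) ⊞ ι₂ ⊠ (w₃ ⊠ w₄ ⊠ w₅ ⊠ w₆ ⊠ w₁) ⊞ ι₃ ⊠ (w₄ ⊠ w₅ ⊠ w₆ ⊠ w₁ ⊠ w₂)
                ⊞ ι₄ ⊠ (w₅ ⊠ w₆ ⊠ w₁ ⊠ w₂ ⊠ w₃) ⊞ ι₅ ⊠ (w₆ ⊠ w₁ ⊠ w₂ ⊠ w₃ ⊠ w₄) ⊞ ι₆ ⊠ (w₁ ⊠ w₂ ⊠ w₃ ⊠ w₄ ⊠ w₅)) }))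
        (weierstrass
          (0≤6tι x₁ x₂ ∷ 0≤6tι x₂ x₃ ∷ 0≤6tι x₃ x₄ ∷ 0≤6tι x₄ x₅ ∷ 0≤6tι x₅ x₆ ∷ 0≤6tι x₆ x₁ ∷
           c x₁ x₂ ∷ c x₂ x₃ ∷ c x₃ x₄ ∷ c x₄ x₅ ∷ c x₅ x₆ ∷ c x₆ x₁ ∷ [])
          (e x₁ x₂) (e x₂ x₃) (e x₃ x₄) (e x₄ x₅) (e x₅ x₆) (e x₆ x₁))
        where
        c = perturbed-isWeight .nonneg
        e : ∀ i j → ⟨ 6 ⟩ * t * edge a b i j + perturbed i j ≡ K * w i j
        e i j = a+[b-a] (⟨ 6 ⟩ * t * edge a b i j) (K * w i j)
        w₁ = w x₁ x₂
        w₂ = w x₂ x₃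
        w₃ = w x₃ x₄
        w₄ = w x₄ x₅
        w₅ = w x₅ x₆
        w₆ = w x₆ x₁
        ι₁ = edge a b x₁ x₂
        ι₂ = edge a b x₂ x₃
        ι₃ = edge a b x₃ x₄
        ι₄ = edge a b x₄ x₅
        ι₅ = edge a b x₅ x₆
        ι₆ = edge a b x₆ x₁

    -- The factor 12 stands for the six positions and two directions in which a labelled cycle can
    -- run along ab.
    perturbed-cycles : K⁵ * K * cycles w ≤ cycles perturbed + ⟨ 6 ⟩ * t * K⁵ * (⟨ 12 ⟩ * completions w a b)
    perturbed-cycles = begin
      K⁵ * K * cycles w
        ≡⟨ ∑-unique-* (K⁵ * K) (closedWalk w) ⟨
      ∑-unique (λ v → K⁵ * K * closedWalk w v)
        ≤⟨ ∑-unique-mono pointwise ⟩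
      ∑-unique (λ v → closedWalk perturbed v + ⟨ 6 ⟩ * t * K⁵ * ∑-rotations (markedWalk (edge a b) w) v)
        ≡⟨ trans (∑-unique-+ (closedWalk perturbed) (λ v → ⟨ 6 ⟩ * t * K⁵ * ∑-rotations (markedWalk (edge a b) w) v))
             (cong (cycles perturbed +_) (∑-unique-* (⟨ 6 ⟩ * t * K⁵) (∑-rotations (markedWalk (edge a b) w)))) ⟩
      cycles perturbed + ⟨ 6 ⟩ * t * K⁵ * ∑-unique (∑-rotations (markedWalk (edge a b) w))
        ≡⟨ cong (λ s → cycles perturbed + ⟨ 6 ⟩ * t * K⁵ * s) (begin-equality
             ∑-unique (∑-rotations (markedWalk (edge a b) w))
               ≡⟨ rotation-invariant-sum ∑-unique ∑-unique-+ ∑-unique-rotate (markedWalk (edge a b) w) ⟩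
             ⟨ 6 ⟩ * ∑-unique (markedWalk (edge a b) w)
               ≡⟨ cong (⟨ 6 ⟩ *_) (trans (∑-unique-marked (edge a b) w) (sum-edge a b (completions w))) ⟩
             ⟨ 6 ⟩ * (completions w a b + completions w b a)
               ≡⟨ cong (λ c → ⟨ 6 ⟩ * (completions w a b + c)) (sym (completions-symmetric isW a b)) ⟩
             ⟨ 6 ⟩ * (completions w a b + completions w a b)
               ≡⟨ identity (completions w a b ∷ []) (λ { (c ∷ []) → con ⟨ 6 ⟩ ⊠ (c ⊞ c) ⊑ con ⟨ 12 ⟩ ⊠ c }) ⟩
             ⟨ 12 ⟩ * completions w a b ∎) ⟩
      cycles perturbed + ⟨ 6 ⟩ * t * K⁵ * (⟨ 12 ⟩ * completions w a b) ∎
      where open ≤-Reasoning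

-- Iterated improvement against a uniform bound

⟨suc⟩ : ∀ k → ⟨ suc k ⟩ ≡ 1ℚ + ⟨ k ⟩
⟨suc⟩ k = toℚᵘ-injective (begin-equality
  toℚᵘ ⟨ suc k ⟩                         ≃⟨ toℚᵘ-fromℚᵘ (ℚᵘ.mkℚᵘ (ℤ.+ suc k) 0) ⟩
  ℚᵘ.mkℚᵘ (ℤ.+ suc k) 0                  ≃⟨ ℚᵘ.*≡* (trans (ℤ.*-identityʳ (ℤ.+ suc k)) (sym (trans (ℤ.*-identityʳ (ℤ.+ 1 ℤ.+ ℤ.+ k ℤ.* ℤ.+ 1)) (cong (ℤ._+_ (ℤ.+ 1)) (ℤ.*-identityʳ (ℤ.+ k)))))) ⟩
  ℚᵘ.1ℚᵘ ℚᵘ.+ ℚᵘ.mkℚᵘ (ℤ.+ k) 0          ≃⟨ ℚᵘ.+-congʳ ℚᵘ.1ℚᵘ (ℚᵘ.≃-sym (toℚᵘ-fromℚᵘ (ℚᵘ.mkℚᵘ (ℤ.+ k) 0))) ⟩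
  toℚᵘ 1ℚ ℚᵘ.+ toℚᵘ ⟨ k ⟩                ≃⟨ ℚᵘ.≃-sym (toℚᵘ-homo-+ 1ℚ ⟨ k ⟩) ⟩
  toℚᵘ (1ℚ + ⟨ k ⟩)                      ∎)
  where
  open ℚᵘ.≤-Reasoning

-- The denominator of δ is the multiplier: it turns δ into its numerator, a positive integer.
archimedean : ∀ {δ} → 0ℚ < δ → ∃ λ k → 1ℚ ≤ ⟨ k ⟩ * δ
archimedean {δ} 0<δ = go δ (positive 0<δ)
  where
  go : ∀ δ → Positive δ → ∃ λ k → 1ℚ ≤ ⟨ k ⟩ * δ
  go δ@(mkℚ (ℤ.+[1+ m ]) d _) _ = suc d , toℚᵘ-cancel-≤ (begin
    ℚᵘ.1ℚᵘ                              ≤⟨ ℚᵘ.*≤* (ℤ.≤-trans (ℤ.≤-reflexive (ℤ.*-identityˡ (ℤ.+ suc (d ℕ.+ 0)))) (ℤ.+≤+ d≤)) ⟩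
    ℚᵘ.mkℚᵘ (ℤ.+ suc d) 0 ℚᵘ.* toℚᵘ δ             ≃⟨ ℚᵘ.*-congʳ {toℚᵘ δ} (ℚᵘ.≃-sym (toℚᵘ-fromℚᵘ (ℚᵘ.mkℚᵘ (ℤ.+ suc d) 0))) ⟩
    toℚᵘ ⟨ suc d ⟩ ℚᵘ.* toℚᵘ δ                    ≃⟨ ℚᵘ.≃-sym (toℚᵘ-homo-* ⟨ suc d ⟩ δ) ⟩
    toℚᵘ (⟨ suc d ⟩ * δ)                          ∎)
    where
    open ℚᵘ.≤-Reasoning
    d≤ : suc (d ℕ.+ 0) ℕ.≤ suc ((m ℕ.+ d ℕ.* suc m) ℕ.* 1)
    d≤ = ℕ.s≤s (ℕ.≤-trans (ℕ.≤-reflexive (ℕ.+-identityʳ d))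
      (ℕ.≤-trans (ℕ.≤-trans (ℕ.m≤m*n d (suc m)) (ℕ.m≤n+m (d ℕ.* suc m) m))
        (ℕ.≤-reflexive (sym (ℕ.*-identityʳ (m ℕ.+ d ℕ.* suc m))))))

module _ {n : ℕ} where

  completions≤power : ∀ {w : Weight n} → IsWeight w → mass w ≡ ⟨ 6 ⟩ →
    ∀ m → 0ℚ ≤ m → (∀ i j → w i j ≤ m) → ∀ a b → completions w a b ≤ m * power 4 ⟨ 6 ⟩
  completions≤power {w} isW mass≡6 m 0≤m ≤m a b = begin
    completions w a b                  ≤⟨ completions≤paths isW a b m 0≤m (λ z _ → ≤m a z) ⟩
    m * paths 4 (delete a w) b         ≤⟨ *-monoʳ 0≤m (paths≤power₄ isW′ b) ⟩
    m * power 4 (mass (delete a w))    ≤⟨ *-monoʳ 0≤m (power₄-mono (mass-nonNeg isW′) (≤-from (mass (delete a w)) ⟨ 6 ⟩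
                                            (trans (identity (star w a ∷ []) λ { (s ∷ []) → s ⊑ con ⟨ 6 ⟩ ⊟ (con ⟨ 6 ⟩ ⊟ s) })
                                              (cong (λ E → ⟨ 6 ⟩ - E) (sym (trans (mass-delete a w isW) (cong (_- star w a) mass≡6)))))
                                            (star-nonNeg isW a))) ⟩
    m * power 4 ⟨ 6 ⟩                  ∎
    where
    open ≤-Reasoning
    isW′ = delete-isWeight a w isW

  edge≤mass : ∀ {w : Weight n} → IsWeight w → ∀ i j → w i j ≤ mass w
  edge≤mass isW i j = ≤-trans (term≤sum (isW .nonneg i) j) (star≤mass isW i)

  record Configuration : Set where
    constructor configuration
    field
      w        : Weight n
      isWeight : IsWeight w
      mass≡6   : mass w ≡ ⟨ 6 ⟩

  open Configuration

  -- 2 · 6 · 6 (6 / 4)^4 = 364.5. The bound is crude, but common to all configurations, as the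
  -- iteration requires.
  cycles≤365 : ∀ c → cycles (c .w) ≤ ⟨ 365 ⟩
  cycles≤365 (configuration w isW mass≡6) = begin
    cycles w                         ≤⟨ cycles≤ isW (completions≤power isW mass≡6 ⟨ 6 ⟩ (nonNegative⁻¹ ⟨ 6 ⟩)
                                          (λ i j → subst (w i j ≤_) mass≡6 (edge≤mass isW i j))) ⟩
    ⟨ 2 ⟩ * mass w * (⟨ 6 ⟩ * power 4 ⟨ 6 ⟩) ≡⟨ cong (λ m → ⟨ 2 ⟩ * m * (⟨ 6 ⟩ * power 4 ⟨ 6 ⟩)) mass≡6 ⟩
    ⟨ 2 ⟩ * ⟨ 6 ⟩ * (⟨ 6 ⟩ * power 4 ⟨ 6 ⟩)  ≤⟨ toWitness {a? = ⟨ 2 ⟩ * ⟨ 6 ⟩ * (⟨ 6 ⟩ * power 4 ⟨ 6 ⟩) ≤? ⟨ 365 ⟩} _ ⟩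
    ⟨ 365 ⟩                          ∎
    where open ≤-Reasoning

  -- The search for a and b is finite and decidable, so it is enough to refute the absence of such
  -- an edge.
  cheap-edge : ∀ c → ⟨ 12 ⟩ < cycles (c .w) →
               ∃₂ λ a b → ℤ.+ 1 / 6 ≤ c .w a b × completions (c .w) a b ≤ 1ℚ
  cheap-edge (configuration w isW mass≡6) 12< = decidable-stable
    (any? λ a → any? λ b → (ℤ.+ 1 / 6 ≤? w a b) ×-dec (completions w a b ≤? 1ℚ))
    λ ¬cheap → <⇒≱ 12< (cycles≤12 ¬cheap (heaviest w))
    where
    open ≤-Reasoning
    Cheap : Set
    Cheap = ∃₂ λ a b → ℤ.+ 1 / 6 ≤ w a b × completions w a b ≤ 1ℚ

    heaviest : ∀ {n} (w : Weight n) → (Fin n → ⊥) ⊎ (∃₂ λ v p → ∀ i j → w i j ≤ w v p)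
    heaviest {zero}  w = inj₁ λ { (()) }
    heaviest {suc n} w with argmax (λ i → w i (proj₁ (argmax (w i))))
    ... | v , max = inj₂ (v , proj₁ (argmax (w v)) , λ i j → ≤-trans (proj₂ (argmax (w i)) j) (max i))

    many-paths : ¬ Cheap → ∀ a b → ℤ.+ 1 / 6 ≤ w a b → ∀ m → 0ℚ ≤ m → (∀ z → z ≢ b → w a z ≤ m) →
                 1ℚ < m * paths 4 (delete a w) b
    many-paths ¬cheap a b 1/6≤ m 0≤m ≤m = <-≤-trans
      (≰⇒> λ ≤1 → ¬cheap (a , b , 1/6≤ , ≤1))
      (completions≤paths isW a b m 0≤m ≤m)

    cycles≤12 : ¬ Cheap → (Fin n → ⊥) ⊎ (∃₂ λ v p → ∀ i j → w i j ≤ w v p) → cycles w ≤ ⟨ 12 ⟩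
    cycles≤12 _ (inj₁ empty) = begin
      cycles w              ≤⟨ cycles≤ isW {0ℚ} (λ a b → contradiction a empty) ⟩
      ⟨ 2 ⟩ * mass w * 0ℚ   ≡⟨ *-zeroʳ (⟨ 2 ⟩ * mass w) ⟩
      0ℚ                    ≤⟨ nonNegative⁻¹ ⟨ 12 ⟩ ⟩
      ⟨ 12 ⟩                ∎
    cycles≤12 ¬cheap (inj₂ (v , p , max)) = begin
      cycles w              ≤⟨ cycles≤ isW {1ℚ} few ⟩
      ⟨ 2 ⟩ * mass w * 1ℚ   ≡⟨ cong (λ m → ⟨ 2 ⟩ * m * 1ℚ) mass≡6 ⟩
      ⟨ 12 ⟩                ∎
      where
      few : ∀ a b → completions w a b ≤ 1ℚ
      few a b = begin
        completions w a b                ≤⟨ completions≤power isW mass≡6 (ℤ.+ 1 / 6) (nonNegative⁻¹ (ℤ.+ 1 / 6))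
                                              (λ i j → ≤-trans (max i j) (<⇒≤ light)) a b ⟩
        -- The value is 27 / 32.
        ℤ.+ 1 / 6 * power 4 ⟨ 6 ⟩        ≤⟨ toWitness {a? = ℤ.+ 1 / 6 * power 4 ⟨ 6 ⟩ ≤? 1ℚ} _ ⟩
        1ℚ                               ∎
        where
        light : w v p < ℤ.+ 1 / 6
        light = ≰⇒> (Descent.heaviest-edge<1/6 w isW mass≡6 (w v p) max (many-paths ¬cheap) refl)

  module _ {γ : ℚ} (0<γ : 0ℚ < γ) (γ≤1 : γ ≤ 1ℚ) where

    private
      -- γ is a relative excess over 12. To second order in γ, a shift with t = γ / 50 gains 72tγ -
      -- 180t², about 1.37 γ², so 3/25 γ² leaves a wide margin for the higher terms.
      δ base : ℚ
      δ = ℤ.+ 3 / 25 * (γ * γ)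
      base = ⟨ 12 ⟩ * (1ℚ + γ)

      0≤γ : 0ℚ ≤ γ
      0≤γ = <⇒≤ 0<γ

      12<base : ⟨ 12 ⟩ < base
      12<base = subst₂ _<_ (+-identityʳ ⟨ 12 ⟩) (identity (γ ∷ []) λ { (γ ∷ []) → con ⟨ 12 ⟩ ⊞ con ⟨ 12 ⟩ ⊠ γ ⊑ con ⟨ 12 ⟩ ⊠ (con 1ℚ ⊞ γ) })
        (+-monoʳ-< ⟨ 12 ⟩ (subst (_< ⟨ 12 ⟩ * γ) (*-zeroʳ ⟨ 12 ⟩) (*-monoʳ-<-pos ⟨ 12 ⟩ 0<γ)))

    shift : ∀ c → base ≤ cycles (c .w) →
            (∃₂ λ a b → ℤ.+ 1 / 6 ≤ c .w a b × completions (c .w) a b ≤ 1ℚ) →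
            ∃ λ c′ → cycles (c .w) + δ ≤ cycles (c′ .w)
    shift (configuration w isW mass≡6) base≤ (a , b , 1/6≤ , ≤1) =
      configuration perturbed perturbed-isWeight perturbed-mass ,
      ≤-from (F + δ) (cycles perturbed)
        (identity (cycles perturbed ∷ loss ∷ F ∷ δ ∷ []) λ { (F′ ∷ l ∷ F ∷ δ ∷ []) → (F′ ⊞ l) ⊟ (F ⊞ δ ⊞ l) ⊑ F′ ⊟ (F ⊞ δ) })
        (≤⇒0≤- (begin
          F + δ + loss
            ≤⟨ gain ⟩
          K * K * K * K * K * K * F
            ≤⟨ perturbed-cycles ⟩
          cycles perturbed + ⟨ 6 ⟩ * t * (K * K * K * K * K) * (⟨ 12 ⟩ * completions w a b)
            ≤⟨ +-monoʳ-≤ (cycles perturbed) (*-monoʳ (0≤* (0≤* (nonNegative⁻¹ ⟨ 6 ⟩) 0≤t) (0≤* (0≤* (0≤* (0≤* 0≤K 0≤K) 0≤K) 0≤K) 0≤K))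
                 (*-monoʳ (nonNegative⁻¹ ⟨ 12 ⟩) ≤1)) ⟩
          cycles perturbed + loss ∎))
      where
      open ≤-Reasoning
      -- As γ ≤ 1, the amount 6t = 3γ / 25 taken off ab stays below 1/6.
      t = ℤ.+ 1 / 50 * γ
      F = cycles w

      0≤t : 0ℚ ≤ t
      0≤t = 0≤* (nonNegative⁻¹ (ℤ.+ 1 / 50)) 0≤γ

      a≢b : a ≢ b
      a≢b refl = <⇒≱ (<-≤-trans (positive⁻¹ (ℤ.+ 1 / 6)) 1/6≤) (≤-reflexive (isW .loopless a))

      6t≤ : ⟨ 6 ⟩ * t ≤ w a b
      6t≤ = begin
        ⟨ 6 ⟩ * t                      ≤⟨ *-monoʳ (nonNegative⁻¹ ⟨ 6 ⟩) (*-monoʳ (nonNegative⁻¹ (ℤ.+ 1 / 50)) γ≤1) ⟩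
        ⟨ 6 ⟩ * (ℤ.+ 1 / 50 * 1ℚ)      ≤⟨ toWitness {a? = ⟨ 6 ⟩ * (ℤ.+ 1 / 50 * 1ℚ) ≤? ℤ.+ 1 / 6} _ ⟩
        ℤ.+ 1 / 6                      ≤⟨ 1/6≤ ⟩
        w a b                          ∎

      open Perturbation isW mass≡6 a≢b 0≤t 6t≤

      0≤K : 0ℚ ≤ K
      0≤K = 0≤+ (nonNegative⁻¹ 1ℚ) 0≤t

      loss : ℚ
      loss = ⟨ 6 ⟩ * t * (K * K * K * K * K) * (⟨ 12 ⟩ * 1ℚ)

      gain : F + δ + loss ≤ K * K * K * K * K * K * F
      gain = subst (λ F → F + δ + loss ≤ K * K * K * K * K * K * F) (a+[b-a] base F)
        (inequality (γ ∷ F - base ∷ []) (0≤γ ∷ ≤⇒0≤- base≤ ∷ [])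
          (λ { (γ ∷ g ∷ []) →
            let t = con (ℤ.+ 1 / 50) ⊠ γ
                K = con 1ℚ ⊞ t
                F = con ⟨ 12 ⟩ ⊠ (con 1ℚ ⊞ γ) ⊞ g in
            F ⊞ con (ℤ.+ 3 / 25) ⊠ (γ ⊠ γ) ⊞ con ⟨ 6 ⟩ ⊠ t ⊠ (K ⊠ K ⊠ K ⊠ K ⊠ K) ⊠ con (⟨ 12 ⟩ * 1ℚ) ⊑
            K ⊠ K ⊠ K ⊠ K ⊠ K ⊠ K ⊠ F }) coefficients)

    improve : ∀ c → base ≤ cycles (c .w) → ∃ λ c′ → cycles (c .w) + δ ≤ cycles (c′ .w)
    improve c base≤ = shift c base≤ (cheap-edge c (<-≤-trans 12<base base≤))

    iterate : ∀ c → base ≤ cycles (c .w) → ∀ k → ∃ λ c′ → base + ⟨ k ⟩ * δ ≤ cycles (c′ .w)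
    iterate c base≤ zero    = c , subst (_≤ cycles (c .w)) (identity (base ∷ δ ∷ []) λ { (b ∷ δ ∷ []) → b ⊑ b ⊞ con ⟨ 0 ⟩ ⊠ δ }) base≤
    iterate c base≤ (suc k) = step (iterate c base≤ k)
      where
      open ≤-Reasoning
      0≤δ : 0ℚ ≤ δ
      0≤δ = 0≤* (nonNegative⁻¹ (ℤ.+ 3 / 25)) (0≤* 0≤γ 0≤γ)

      step : (∃ λ c₁ → base + ⟨ k ⟩ * δ ≤ cycles (c₁ .w)) → ∃ λ c₂ → base + ⟨ suc k ⟩ * δ ≤ cycles (c₂ .w)
      step (c₁ , ≤₁) = proj₁ better , (begin
        base + ⟨ suc k ⟩ * δ         ≡⟨ cong (λ s → base + s * δ) (⟨suc⟩ k) ⟩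
        base + (1ℚ + ⟨ k ⟩) * δ      ≡⟨ identity (base ∷ ⟨ k ⟩ ∷ δ ∷ []) (λ { (b ∷ k ∷ δ ∷ []) → b ⊞ (con 1ℚ ⊞ k) ⊠ δ ⊑ b ⊞ k ⊠ δ ⊞ δ }) ⟩
        base + ⟨ k ⟩ * δ + δ         ≤⟨ +-monoˡ-≤ δ ≤₁ ⟩
        cycles (c₁ .w) + δ           ≤⟨ proj₂ better ⟩
        cycles (proj₁ better .w)     ∎)
        where
        better : ∃ λ c₂ → cycles (c₁ .w) + δ ≤ cycles (c₂ .w)
        better = improve c₁ (≤-trans (p≤p+q (0≤* (nonNegative⁻¹ ⟨ k ⟩ {{normalize-nonNeg k 1}}) 0≤δ)) ≤₁)

    -- After k improvements with kδ ≥ 365 the cycle sum would be at least `base` + 365, above the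
    -- uniform bound because `base` is positive.
    no-excess : ∀ c → ¬ base ≤ cycles (c .w)
    no-excess c base≤ = <⇒≱ (<-≤-trans 365< (proj₂ last)) (cycles≤365 (proj₁ last))
      where
      0<δ/365 : 0ℚ < ℤ.+ 1 / 365 * δ
      0<δ/365 = subst (0ℚ <_) (identity (γ ∷ []) λ { (γ ∷ []) → con (ℤ.+ 3 / 9125) ⊠ γ ⊠ γ ⊑ con (ℤ.+ 1 / 365) ⊠ (con (ℤ.+ 3 / 25) ⊠ (γ ⊠ γ)) })
        (positive⁻¹ (ℤ.+ 3 / 9125 * γ * γ) {{pos*pos⇒pos (ℤ.+ 3 / 9125 * γ) {{pos*pos⇒pos (ℤ.+ 3 / 9125) γ {{positive 0<γ}}}} γ {{positive 0<γ}}}})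

      steps : ∃ λ k → 1ℚ ≤ ⟨ k ⟩ * (ℤ.+ 1 / 365 * δ)
      steps = archimedean 0<δ/365

      k : ℕ
      k = proj₁ steps

      last : ∃ λ c′ → base + ⟨ k ⟩ * δ ≤ cycles (c′ .w)
      last = iterate c base≤ k

      365≤ : ⟨ 365 ⟩ ≤ ⟨ k ⟩ * δ
      365≤ = subst₂ _≤_ (*-identityʳ ⟨ 365 ⟩) (identity (⟨ k ⟩ ∷ δ ∷ []) λ { (k ∷ δ ∷ []) →
        con ⟨ 365 ⟩ ⊠ (k ⊠ (con (ℤ.+ 1 / 365) ⊠ δ)) ⊑ k ⊠ δ }) (*-monoʳ (nonNegative⁻¹ ⟨ 365 ⟩) (proj₂ steps))

      365< : ⟨ 365 ⟩ < base + ⟨ k ⟩ * δ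
      365< = subst (_< base + ⟨ k ⟩ * δ) (+-identityˡ ⟨ 365 ⟩)
        (+-mono-<-≤ (<-trans (positive⁻¹ ⟨ 12 ⟩) 12<base) 365≤)

  cycles≤12 : ∀ c → cycles (c .w) ≤ ⟨ 12 ⟩
  cycles≤12 c = ≮⇒≥ λ 12< → excess 12< (≤-total (F - ⟨ 12 ⟩) ⟨ 12 ⟩)
    where
    F = cycles (c .w)
    excess : ⟨ 12 ⟩ < F → F - ⟨ 12 ⟩ ≤ ⟨ 12 ⟩ ⊎ ⟨ 12 ⟩ ≤ F - ⟨ 12 ⟩ → ⊥
    -- γ is the true relative excess (F - 12) / 12 as long as this is at most 1; beyond that, γ = 1
    -- is used.
    excess 12< (inj₁ small) = no-excess {ℤ.+ 1 / 12 * (F - ⟨ 12 ⟩)}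
      (subst (_< ℤ.+ 1 / 12 * (F - ⟨ 12 ⟩)) (*-zeroʳ (ℤ.+ 1 / 12)) (*-monoʳ-<-pos (ℤ.+ 1 / 12) (subst (_< F - ⟨ 12 ⟩) (+-inverseʳ ⟨ 12 ⟩) (+-monoˡ-< (- ⟨ 12 ⟩) 12<))))
      (*-monoʳ (nonNegative⁻¹ (ℤ.+ 1 / 12)) small)
      c (≤-reflexive (identity (F ∷ []) λ { (F ∷ []) → con ⟨ 12 ⟩ ⊠ (con 1ℚ ⊞ con (ℤ.+ 1 / 12) ⊠ (F ⊟ con ⟨ 12 ⟩)) ⊑ F }))
    excess 12< (inj₂ large) = no-excess {1ℚ} (positive⁻¹ 1ℚ) ≤-refl c
      (≤-from (⟨ 12 ⟩ * (1ℚ + 1ℚ)) F (identity (F ∷ []) λ { (F ∷ []) →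
        F ⊟ con ⟨ 12 ⟩ ⊟ con ⟨ 12 ⟩ ⊑ F ⊟ con ⟨ 12 ⟩ ⊠ (con 1ℚ ⊞ con 1ℚ) }) (≤⇒0≤- large))

-- Canonical labellings

Σᶠ≡sum : ∀ {n} (f : Fin n → ℚ) → Σᶠ f ≡ sum f
Σᶠ≡sum {n} f = along id
  where
  along : ∀ {m} (g : Fin m → Fin n) → List.foldr _+_ 0ℚ (List.map f (List.tabulate g)) ≡ sum (f ∘ g)
  along {zero}  g = refl
  along {suc m} g = cong (f (g zero) +_) (along (g ∘ suc))

Decision : Set₁
Decision = ∃ λ (P : Set) → Dec P

count : List Decision → ℚ → ℚ
count []             q = 0ℚ
count ((P , d) ∷ ds) q = when d q + count ds q

Exclusive : Decision → Decision → Set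
Exclusive (P , _) (P′ , _) = P → P′ → ⊥

-- At most one of the exclusive conditions holds, so q is counted at most once. This will limit how
-- many symmetric copies of a labelled cycle are counted.
exclusive-count : ∀ {Q : Set} (e : Dec Q) {q} → 0ℚ ≤ q → ∀ {ds} →
  ListAllPairs.AllPairs Exclusive ds → ListAll.All (λ d → proj₁ d → Q) ds → count ds q ≤ when e q
exclusive-count (yes _) 0≤q [] [] = 0≤q
exclusive-count (no _)  0≤q [] [] = ≤-refl
exclusive-count e {q} 0≤q {(P , no ¬p) ∷ ds} (_ ∷ ex) (_ ∷ imp) =
  subst (_≤ when e q) (sym (+-identityˡ (count ds q))) (exclusive-count e 0≤q ex imp)
exclusive-count (no ¬Q) 0≤q {(P , yes p) ∷ ds} (_ ∷ ex) (P→Q ∷ imp) = contradiction (P→Q p) ¬Q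
exclusive-count (yes _) {q} 0≤q {(P , yes p) ∷ ds} (¬ds ∷ ex) (_ ∷ imp) =
  ≤-reflexive (trans (cong (q +_) (vanishes ¬ds)) (+-identityʳ q))
  where
  vanishes : ∀ {ds} → ListAll.All (Exclusive (P , yes p)) ds → count ds q ≡ 0ℚ
  vanishes []                             = refl
  vanishes {(_ , yes p′) ∷ _} (¬p′ ∷ ¬ds) = contradiction p′ (¬p′ p)
  vanishes {(_ , no _) ∷ _}   (_ ∷ ¬ds)   = trans (+-identityˡ _) (vanishes ¬ds)

module _ {n : ℕ} where

  Canonical : Vec (Fin n) 6 → Set
  Canonical (a ∷ b ∷ c ∷ d ∷ e ∷ f ∷ []) = T (canonical6 a b c d e f)

  canonical? : ∀ v → Dec (Canonical v)
  canonical? (a ∷ b ∷ c ∷ d ∷ e ∷ f ∷ []) = T? (canonical6 a b c d e f)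

  -- Halfway between `Canonical` and `Unique`: the rotation is fixed but not the direction. It
  -- splits the twelve labellings of a cycle into factors 2 and 6.
  LeastFirst : Vec (Fin n) 6 → Set
  LeastFirst v = All (head v Fin.<_) (tail v) × Unique v

  leastFirst? : ∀ v → Dec (LeastFirst v)
  leastFirst? v = all? (head v Fin.<?_) (tail v) ×-dec unique? v

  canonical⇒ : ∀ a b c d e f → Canonical (a ∷ b ∷ c ∷ d ∷ e ∷ f ∷ []) →
               LeastFirst (a ∷ b ∷ c ∷ d ∷ e ∷ f ∷ []) × b Fin.< f
  canonical⇒ a b c d e f t₀ =
    let ab , t₁ = and t₀
        ac , t₂ = and t₁
        ad , t₃ = and t₂
        ae , t₄ = and t₃
        af , t₅ = and t₄
        bc , t₆ = and t₅
        bd , t₇ = and t₆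
        be , t₈ = and t₇
        bf , t₉ = and t₈
        cd , u₀ = and t₉
        ce , u₁ = and u₀
        cf , u₂ = and u₁
        de , u₃ = and u₂
        df , ef = and u₃
    in ((lt ab ∷ lt ac ∷ lt ad ∷ lt ae ∷ lt af ∷ []) ,
        ((<⇒≢ᶠ ab ∷ <⇒≢ᶠ ac ∷ <⇒≢ᶠ ad ∷ <⇒≢ᶠ ae ∷ <⇒≢ᶠ af ∷ []) ∷
         (ne bc ∷ ne bd ∷ ne be ∷ <⇒≢ᶠ bf ∷ []) ∷ (ne cd ∷ ne ce ∷ ne cf ∷ []) ∷
         (ne de ∷ ne df ∷ []) ∷ (ne ef ∷ []) ∷ [] ∷ [])) , lt bf
    where
    and : ∀ {x y} → T (x ∧ y) → T x × T y
    and = Equivalence.to T-∧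
    lt : ∀ {i j : Fin n} → T (i <ᶠ j) → i Fin.< j
    lt {i} {j} = ℕ.<ᵇ⇒< (Fin.toℕ i) (Fin.toℕ j)
    <⇒≢ᶠ : ∀ {i j : Fin n} → T (i <ᶠ j) → i ≢ j
    <⇒≢ᶠ {i} i<j refl = ℕ.<-irrefl refl (lt {i} {i} i<j)
    ne : ∀ {i j : Fin n} → T (i ≢ᶠ j) → i ≢ j
    ne {i} t refl = subst (T ∘ not) (Equivalence.to T-≡ (ℕ.≡⇒≡ᵇ (Fin.toℕ i) (Fin.toℕ i) refl)) t

  module Counting {w : Weight n} (isW : IsWeight w) where

    canonicalCycles leastFirstCycles : ℚ
    canonicalCycles = ∑ 6 λ v → when (canonical? v) (closedWalk w v)
    leastFirstCycles = ∑ 6 λ v → when (leastFirst? v) (closedWalk w v)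

    closedWalk-nonNeg : ∀ v → 0ℚ ≤ closedWalk w v
    closedWalk-nonNeg (a ∷ b ∷ c ∷ d ∷ e ∷ f ∷ []) =
      0≤* (0≤* (0≤* (0≤* (0≤* (isW .nonneg a b) (isW .nonneg b c)) (isW .nonneg c d)) (isW .nonneg d e)) (isW .nonneg e f)) (isW .nonneg f a)

    closedWalk-rotate : ∀ v → closedWalk w (rotate v) ≡ closedWalk w v
    closedWalk-rotate (a ∷ b ∷ c ∷ d ∷ e ∷ f ∷ []) = identity (w a b ∷ w b c ∷ w c d ∷ w d e ∷ w e f ∷ w f a ∷ [])
      λ { (p ∷ q ∷ r ∷ s ∷ t ∷ u ∷ []) → q ⊠ r ⊠ s ⊠ t ⊠ u ⊠ p ⊑ p ⊠ q ⊠ r ⊠ s ⊠ t ⊠ u }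

    reflect : Vec (Fin n) 6 → Vec (Fin n) 6
    reflect (x ∷ v) = x ∷ reverse v

    closedWalk-reflect : ∀ v → closedWalk w (reflect v) ≡ closedWalk w v
    closedWalk-reflect (a ∷ b ∷ c ∷ d ∷ e ∷ f ∷ [])
      rewrite isW .symmetric a f | isW .symmetric f e | isW .symmetric e d
            | isW .symmetric d c | isW .symmetric c b | isW .symmetric b a =
      identity (w a b ∷ w b c ∷ w c d ∷ w d e ∷ w e f ∷ w f a ∷ [])
      λ { (p ∷ q ∷ r ∷ s ∷ t ∷ u ∷ []) → u ⊠ t ⊠ s ⊠ r ⊠ q ⊠ p ⊑ p ⊠ q ⊠ r ⊠ s ⊠ t ⊠ u }

    -- A tuple and its reflection share the least first vertex, while b < f and f < b exclude each
    -- other.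
    canonicalCycles≤ : ⟨ 2 ⟩ * canonicalCycles ≤ leastFirstCycles
    canonicalCycles≤ = begin
      ⟨ 2 ⟩ * canonicalCycles
        ≡⟨ identity (canonicalCycles ∷ []) (λ { (c ∷ []) → con ⟨ 2 ⟩ ⊠ c ⊑ c ⊞ c }) ⟩
      canonicalCycles + canonicalCycles
        ≡⟨ cong (canonicalCycles +_) (sym (sum-cong-≗ λ x → ∑-reverse 5 λ v → when (canonical? (x ∷ v)) (closedWalk w (x ∷ v)))) ⟩
      canonicalCycles + ∑ 6 reflected
        ≡⟨ ∑-+ 6 (λ v → when (canonical? v) (closedWalk w v)) reflected ⟨
      ∑ 6 (λ v → when (canonical? v) (closedWalk w v) + reflected v)
        ≤⟨ ∑-mono 6 pointwise ⟩
      leastFirstCycles ∎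
      where
      open ≤-Reasoning
      reflected : Vec (Fin n) 6 → ℚ
      reflected (x ∷ v) = when (canonical? (x ∷ reverse v)) (closedWalk w (x ∷ reverse v))

      pointwise : ∀ v → when (canonical? v) (closedWalk w v) + reflected v ≤ when (leastFirst? v) (closedWalk w v)
      pointwise v@(a ∷ b ∷ c ∷ d ∷ e ∷ f ∷ []) = begin
        when (canonical? v) (closedWalk w v) + when (canonical? v′) (closedWalk w v′)
          ≡⟨ cong (when (canonical? v) (closedWalk w v) +_) (trans (cong (when (canonical? v′)) (closedWalk-reflect v)) (sym (+-identityʳ _))) ⟩
        count ((Canonical v , canonical? v) ∷ (Canonical v′ , canonical? v′) ∷ []) (closedWalk w v)
          ≤⟨ exclusive-count (leastFirst? v) (closedWalk-nonNeg v) {(Canonical v , canonical? v) ∷ (Canonical v′ , canonical? v′) ∷ []}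
               (((λ p p′ → Fin.<-asym {x = b} {y = f} (proj₂ (canonical⇒ a b c d e f p)) (proj₂ (canonical⇒ a f e d c b p′))) ∷ []) ∷ [] ∷ [])
               ((λ p → proj₁ (canonical⇒ a b c d e f p)) ∷ (λ p′ → unreflect (proj₁ (canonical⇒ a f e d c b p′))) ∷ []) ⟩
        when (leastFirst? v) (closedWalk w v) ∎
        where
        v′ = a ∷ f ∷ e ∷ d ∷ c ∷ b ∷ []
        unreflect : LeastFirst v′ → LeastFirst v
        unreflect ((af ∷ ae ∷ ad ∷ ac ∷ ab ∷ []) ,
          ((a≢f ∷ a≢e ∷ a≢d ∷ a≢c ∷ a≢b ∷ []) ∷ (f≢e ∷ f≢d ∷ f≢c ∷ f≢b ∷ []) ∷ (e≢d ∷ e≢c ∷ e≢b ∷ []) ∷ (d≢c ∷ d≢b ∷ []) ∷ (c≢b ∷ []) ∷ [] ∷ [])) =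
          (ab ∷ ac ∷ ad ∷ ae ∷ af ∷ []) ,
          ((a≢b ∷ a≢c ∷ a≢d ∷ a≢e ∷ a≢f ∷ []) ∷ (≢-sym c≢b ∷ ≢-sym d≢b ∷ ≢-sym e≢b ∷ ≢-sym f≢b ∷ []) ∷
           (≢-sym d≢c ∷ ≢-sym e≢c ∷ ≢-sym f≢c ∷ []) ∷ (≢-sym e≢d ∷ ≢-sym f≢d ∷ []) ∷ (≢-sym f≢e ∷ []) ∷ [] ∷ [])

    -- At most one of the six rotations of a tuple starts at its least vertex: of two different
    -- ones, each head lies in the tail of the other.
    leastFirstCycles≤ : ⟨ 6 ⟩ * leastFirstCycles ≤ cycles w
    leastFirstCycles≤ = begin
      ⟨ 6 ⟩ * leastFirstCycles
        ≡⟨ ∑-rotations≡ ⟨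
      ∑ 6 (∑-rotations g)
        ≤⟨ ∑-mono 6 pointwise ⟩
      cycles w ∎
      where
      open ≤-Reasoning
      g : Vec (Fin n) 6 → ℚ
      g v = when (leastFirst? v) (closedWalk w v)
      ∑-rotations≡ : ∑ 6 (∑-rotations g) ≡ ⟨ 6 ⟩ * leastFirstCycles
      ∑-rotations≡ = rotation-invariant-sum (∑ 6) (∑-+ 6) (∑-rotate 5) g

      clash : ∀ i j {u v : Vec (Fin n) 6} → lookup (tail u) i ≡ head v → lookup (tail v) j ≡ head u →
              LeastFirst u → LeastFirst v → ⊥
      clash i j {u} {v} uᵢ≡v₀ vⱼ≡u₀ (u₀< , _) (v₀< , _) =
        Fin.<-asym (subst (head u Fin.<_) uᵢ≡v₀ (at i u₀<)) (subst (head v Fin.<_) vⱼ≡u₀ (at j v₀<))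
        where
        at : ∀ {m} {P : Fin n → Set} {xs : Vec (Fin n) m} i → All P xs → P (lookup xs i)
        at zero    (px ∷ _) = px
        at (suc i) (_ ∷ p)  = at i p

      pointwise : ∀ v → ∑-rotations g v ≤ when (unique? v) (closedWalk w v)
      pointwise v₀@(_ ∷ _ ∷ _ ∷ _ ∷ _ ∷ _ ∷ []) = begin
        ∑-rotations g v₀
          ≡⟨ regroup (g v₀) (e v₁ p₁) (e v₂ p₂) (e v₃ p₃) (e v₄ p₄) (e v₅ p₅) ⟩
        count (D v₀ ∷ D v₁ ∷ D v₂ ∷ D v₃ ∷ D v₄ ∷ D v₅ ∷ []) (closedWalk w v₀)
          ≤⟨ exclusive-count (unique? v₀) (closedWalk-nonNeg v₀) {D v₀ ∷ D v₁ ∷ D v₂ ∷ D v₃ ∷ D v₄ ∷ D v₅ ∷ []}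
               ((c₁ v₀ ∷ c₂ v₀ ∷ c₃ v₀ ∷ c₄ v₀ ∷ c₅ v₀ ∷ []) ∷ (c₁ v₁ ∷ c₂ v₁ ∷ c₃ v₁ ∷ c₄ v₁ ∷ []) ∷
                (c₁ v₂ ∷ c₂ v₂ ∷ c₃ v₂ ∷ []) ∷ (c₁ v₃ ∷ c₂ v₃ ∷ []) ∷ (c₁ v₄ ∷ []) ∷ [] ∷ [])
               (proj₂ ∷ u₁ v₀ ∘ proj₂ ∷ u₁ v₀ ∘ u₁ v₁ ∘ proj₂ ∷ u₁ v₀ ∘ u₁ v₁ ∘ u₁ v₂ ∘ proj₂ ∷
                u₁ v₀ ∘ u₁ v₁ ∘ u₁ v₂ ∘ u₁ v₃ ∘ proj₂ ∷ u₁ v₀ ∘ u₁ v₁ ∘ u₁ v₂ ∘ u₁ v₃ ∘ u₁ v₄ ∘ proj₂ ∷ []) ⟩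
        when (unique? v₀) (closedWalk w v₀) ∎
        where
        v₁ v₂ v₃ v₄ v₅ : Vec (Fin n) 6
        v₁ = rotate v₀
        v₂ = rotate v₁
        v₃ = rotate v₂
        v₄ = rotate v₃
        v₅ = rotate v₄
        D : Vec (Fin n) 6 → Decision
        D v = LeastFirst v , leastFirst? v
        c₁ : ∀ v → LeastFirst v → LeastFirst (rotate v) → ⊥
        c₁ v@(_ ∷ _ ∷ _ ∷ _ ∷ _ ∷ _ ∷ []) = clash 0F 4F {v} {rotate v} refl refl
        c₂ : ∀ v → LeastFirst v → LeastFirst (rotate (rotate v)) → ⊥
        c₂ v@(_ ∷ _ ∷ _ ∷ _ ∷ _ ∷ _ ∷ []) = clash 1F 3F {v} {rotate (rotate v)} refl refl
        c₃ : ∀ v → LeastFirst v → LeastFirst (rotate (rotate (rotate v))) → ⊥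
        c₃ v@(_ ∷ _ ∷ _ ∷ _ ∷ _ ∷ _ ∷ []) = clash 2F 2F {v} {rotate (rotate (rotate v))} refl refl
        c₄ : ∀ v → LeastFirst v → LeastFirst (rotate (rotate (rotate (rotate v)))) → ⊥
        c₄ v@(_ ∷ _ ∷ _ ∷ _ ∷ _ ∷ _ ∷ []) = clash 3F 1F {v} {rotate (rotate (rotate (rotate v)))} refl refl
        c₅ : ∀ v → LeastFirst v → LeastFirst (rotate (rotate (rotate (rotate (rotate v))))) → ⊥
        c₅ v@(_ ∷ _ ∷ _ ∷ _ ∷ _ ∷ _ ∷ []) = clash 4F 0F {v} {rotate (rotate (rotate (rotate (rotate v))))} refl refl
        u₁ = Unique-rotate⁻¹
        p₁ = closedWalk-rotate v₀
        p₂ = trans (closedWalk-rotate v₁) p₁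
        p₃ = trans (closedWalk-rotate v₂) p₂
        p₄ = trans (closedWalk-rotate v₃) p₃
        p₅ = trans (closedWalk-rotate v₄) p₄
        e : ∀ v → closedWalk w v ≡ closedWalk w v₀ → g v ≡ when (leastFirst? v) (closedWalk w v₀)
        e v = cong (when (leastFirst? v))
        regroup : ∀ x₀ {x₁ x₂ x₃ x₄ x₅ y₁ y₂ y₃ y₄ y₅} → x₁ ≡ y₁ → x₂ ≡ y₂ → x₃ ≡ y₃ → x₄ ≡ y₄ → x₅ ≡ y₅ →
          x₀ + x₁ + x₂ + x₃ + x₄ + x₅ ≡ x₀ + (y₁ + (y₂ + (y₃ + (y₄ + (y₅ + 0ℚ)))))
        regroup x₀ {x₁} {x₂} {x₃} {x₄} {x₅} refl refl refl refl refl = identity (x₀ ∷ x₁ ∷ x₂ ∷ x₃ ∷ x₄ ∷ x₅ ∷ [])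
          λ { (a ∷ b ∷ c ∷ d ∷ e ∷ f ∷ []) → a ⊞ b ⊞ c ⊞ d ⊞ e ⊞ f ⊑ a ⊞ (b ⊞ (c ⊞ (d ⊞ (e ⊞ (f ⊞ con 0ℚ))))) }

-- From probability masses to weights of mass 6

module _ {n : ℕ} {μ : Weight n} (isMass : IsProbMass μ) where

  open IsProbMass isMass renaming (symmetric to μ-symmetric; nonneg to μ-nonneg)

  -- The diagonal of μ is arbitrary and must be cleared to obtain a loopless weight; the terms
  -- counted in `b6` use distinct vertices only.
  scaled : Weight n
  scaled i j = if does (i ≟ j) then 0ℚ else ⟨ 6 ⟩ * μ i j

  scaled-loopless : ∀ i → scaled i i ≡ 0ℚ
  scaled-loopless i rewrite dec-true (i ≟ i) refl = refl

  scaled-≢ : ∀ {i j} → i ≢ j → scaled i j ≡ ⟨ 6 ⟩ * μ i j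
  scaled-≢ {i} {j} i≢j rewrite dec-false (i ≟ j) i≢j = refl

  scaled-isWeight : IsWeight scaled
  scaled-isWeight .loopless = scaled-loopless
  scaled-isWeight .symmetric i j with i ≟ j
  ... | yes refl = sym (scaled-loopless i)
  ... | no i≢j   = trans (cong (⟨ 6 ⟩ *_) (μ-symmetric i j)) (sym (scaled-≢ (≢-sym i≢j)))
  scaled-isWeight .nonneg i j with does (i ≟ j)
  ... | true  = ≤-refl
  ... | false = 0≤* (nonNegative⁻¹ ⟨ 6 ⟩) (μ-nonneg i j)

  upper lower : Weight n
  upper i j = if i <ᶠ j then μ i j else 0ℚ
  lower i j = upper j i

  scaled≡ : ∀ i j → scaled i j ≡ ⟨ 6 ⟩ * (upper i j + lower i j)
  scaled≡ i j with Fin.<-cmp i j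
  ... | tri< i<j i≢j i≯j
    rewrite dec-false (i ≟ j) i≢j
          | Equivalence.to T-≡ (ℕ.<⇒<ᵇ i<j)
          | ¬-not {Fin.toℕ j ℕ.<ᵇ Fin.toℕ i} {true} (λ eq → i≯j (ℕ.<ᵇ⇒< (Fin.toℕ j) (Fin.toℕ i) (Equivalence.from T-≡ eq))) =
    cong (⟨ 6 ⟩ *_) (sym (+-identityʳ (μ i j)))
  ... | tri≈ i≮i refl _
    rewrite dec-true (i ≟ i) refl
          | ¬-not {Fin.toℕ i ℕ.<ᵇ Fin.toℕ i} {true} (λ eq → i≮i (ℕ.<ᵇ⇒< (Fin.toℕ i) (Fin.toℕ i) (Equivalence.from T-≡ eq))) = refl
  ... | tri> i≮j i≢j i>j
    rewrite dec-false (i ≟ j) i≢j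
          | Equivalence.to T-≡ (ℕ.<⇒<ᵇ i>j)
          | ¬-not {Fin.toℕ i ℕ.<ᵇ Fin.toℕ j} {true} (λ eq → i≮j (ℕ.<ᵇ⇒< (Fin.toℕ i) (Fin.toℕ j) (Equivalence.from T-≡ eq))) =
    cong (⟨ 6 ⟩ *_) (trans (μ-symmetric i j) (sym (+-identityˡ (μ j i))))

  scaled-mass : mass scaled ≡ ⟨ 6 ⟩
  scaled-mass = begin
    ½ * sum (star scaled)
      ≡⟨ cong (½ *_) (sum-cong-≗ λ i → trans (sum-cong-≗ (scaled≡ i))
           (trans (sym (*-distribˡ-sum ⟨ 6 ⟩ (λ j → upper i j + lower i j))) (cong (⟨ 6 ⟩ *_) (∑-distrib-+ (upper i) (lower i))))) ⟩
    ½ * sum (λ i → ⟨ 6 ⟩ * (sum (upper i) + sum (lower i)))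
      ≡⟨ cong (½ *_) (trans (sym (*-distribˡ-sum ⟨ 6 ⟩ (λ i → sum (upper i) + sum (lower i))))
           (cong (⟨ 6 ⟩ *_) (∑-distrib-+ (sum ∘ upper) (sum ∘ lower)))) ⟩
    ½ * (⟨ 6 ⟩ * (sum (sum ∘ upper) + sum (sum ∘ lower)))
      ≡⟨ cong₂ (λ p q → ½ * (⟨ 6 ⟩ * (p + q))) total-upper (trans (∑-comm lower) total-upper) ⟩
    ½ * (⟨ 6 ⟩ * (1ℚ + 1ℚ)) ≡⟨⟩
    ⟨ 6 ⟩ ∎
    where
    open ≡-Reasoning
    total-upper : sum (sum ∘ upper) ≡ 1ℚ
    total-upper = trans (sum-cong-≗ λ i → sym (Σᶠ≡sum (upper i)))
      (trans (sym (Σᶠ≡sum (λ i → Σᶠ (upper i)))) total)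

  open Counting scaled-isWeight

  canonicalTerm : Vec (Fin n) 6 → ℚ
  canonicalTerm v@(a ∷ b ∷ c ∷ d ∷ e ∷ f ∷ []) = when (canonical? v) (μ a b * μ b c * μ c d * μ d e * μ e f * μ f a)

  b6≡ : b6 μ ≡ ∑ 6 canonicalTerm
  b6≡ = sums (λ a → sums (λ b → sums (λ c → sums (λ d → sums (λ e → sums (λ f → refl))))))
    where
    sums : ∀ {f g : Fin n → ℚ} → (∀ i → f i ≡ g i) → Σᶠ f ≡ sum g
    sums {f} f≗g = trans (Σᶠ≡sum f) (sum-cong-≗ f≗g)

  canonicalCycles≡ : canonicalCycles ≡ ⟨ 46656 ⟩ * b6 μ
  canonicalCycles≡ = trans (∑-cong 6 pointwise) (trans (∑-* 6 ⟨ 46656 ⟩ canonicalTerm) (cong (⟨ 46656 ⟩ *_) (sym b6≡)))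
    where
    pointwise : ∀ v → when (canonical? v) (closedWalk scaled v) ≡ ⟨ 46656 ⟩ * canonicalTerm v
    pointwise v@(a ∷ b ∷ c ∷ d ∷ e ∷ f ∷ []) = trans
      (when-cong′ (canonical? v) λ t → product (proj₂ (proj₁ (canonical⇒ a b c d e f t))))
      (when-* (canonical? v) ⟨ 46656 ⟩ (μ a b * μ b c * μ c d * μ d e * μ e f * μ f a))
      where
      when-cong′ : ∀ {P : Set} (d : Dec P) {p q} → (P → p ≡ q) → when d p ≡ when d q
      when-cong′ (yes p) p≡q = p≡q p
      when-cong′ (no _)  p≡q = refl

      product : Unique v → closedWalk scaled v ≡ ⟨ 46656 ⟩ * (μ a b * μ b c * μ c d * μ d e * μ e f * μ f a)
      product ((ab ∷ _ ∷ _ ∷ _ ∷ af ∷ []) ∷ (bc ∷ _ ∷ _ ∷ _ ∷ []) ∷ (cd ∷ _ ∷ _ ∷ []) ∷ (de ∷ _ ∷ []) ∷ (ef ∷ []) ∷ [] ∷ []) =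
        six (μ a b) (μ b c) (μ c d) (μ d e) (μ e f) (μ f a) (scaled-≢ ab) (scaled-≢ bc) (scaled-≢ cd) (scaled-≢ de) (scaled-≢ ef) (scaled-≢ (≢-sym af))
        where
        six : ∀ p′ q′ r′ s′ t′ u′ {p q r s t u} → p ≡ ⟨ 6 ⟩ * p′ → q ≡ ⟨ 6 ⟩ * q′ → r ≡ ⟨ 6 ⟩ * r′ →
              s ≡ ⟨ 6 ⟩ * s′ → t ≡ ⟨ 6 ⟩ * t′ → u ≡ ⟨ 6 ⟩ * u′ →
              p * q * r * s * t * u ≡ ⟨ 46656 ⟩ * (p′ * q′ * r′ * s′ * t′ * u′)
        six p q r s t u refl refl refl refl refl refl = identity (p ∷ q ∷ r ∷ s ∷ t ∷ u ∷ [])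
          λ { (p ∷ q ∷ r ∷ s ∷ t ∷ u ∷ []) → let k = con ⟨ 6 ⟩ in
            (k ⊠ p) ⊠ (k ⊠ q) ⊠ (k ⊠ r) ⊠ (k ⊠ s) ⊠ (k ⊠ t) ⊠ (k ⊠ u) ⊑ con ⟨ 46656 ⟩ ⊠ (p ⊠ q ⊠ r ⊠ s ⊠ t ⊠ u) }

  b6≤6⁻⁶ : b6 μ ≤ sixPowMinusSix
  -- 559872 = 12 · 6^6: twelve labellings of each cycle, and a scaling by 6 of each of its six
  -- edges.
  b6≤6⁻⁶ = *-cancelˡ-≤-pos ⟨ 559872 ⟩ (begin
    ⟨ 559872 ⟩ * b6 μ
      ≡⟨ identity (b6 μ ∷ []) (λ { (b ∷ []) → con ⟨ 559872 ⟩ ⊠ b ⊑ con ⟨ 6 ⟩ ⊠ (con ⟨ 2 ⟩ ⊠ (con ⟨ 46656 ⟩ ⊠ b)) }) ⟩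
    ⟨ 6 ⟩ * (⟨ 2 ⟩ * (⟨ 46656 ⟩ * b6 μ))
      ≡⟨ cong (λ c → ⟨ 6 ⟩ * (⟨ 2 ⟩ * c)) canonicalCycles≡ ⟨
    ⟨ 6 ⟩ * (⟨ 2 ⟩ * canonicalCycles)
      ≤⟨ *-monoʳ (nonNegative⁻¹ ⟨ 6 ⟩) canonicalCycles≤ ⟩
    ⟨ 6 ⟩ * leastFirstCycles
      ≤⟨ leastFirstCycles≤ ⟩
    cycles scaled
      ≤⟨ cycles≤12 (configuration scaled scaled-isWeight scaled-mass) ⟩
    ⟨ 12 ⟩ ≡⟨⟩
    ⟨ 559872 ⟩ * sixPowMinusSix ∎)
    where open ≤-Reasoning

-- The extremal hexagon

module Hexagon where

  adjacent : ℕ → ℕ → Bool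
  adjacent 0 1 = true
  adjacent 1 2 = true
  adjacent 2 3 = true
  adjacent 3 4 = true
  adjacent 4 5 = true
  adjacent 0 5 = true
  adjacent _ _ = false

  μ : Weight 6
  μ i j = if adjacent (Fin.toℕ i) (Fin.toℕ j) ∨ adjacent (Fin.toℕ j) (Fin.toℕ i) then ℤ.+ 1 / 6 else 0ℚ

  isProbMass : IsProbMass μ
  isProbMass = record
    { symmetric = toWitness {a? = Fin.all? λ i → Fin.all? λ j → μ i j ℚₚ.≟ μ j i} _
    ; nonneg    = toWitness {a? = Fin.all? λ i → Fin.all? λ j → 0ℚ ≤? μ i j} _
    ; atMostOne = toWitness {a? = Fin.all? λ i → Fin.all? λ j → μ i j ≤? 1ℚ} _
    ; total     = refl }

  b6≡6⁻⁶ : b6 μ ≡ sixPowMinusSix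
  b6≡6⁻⁶ = refl

theorem3p5 : ((n : ℕ) (μ : Fin n → Fin n → ℚ) → IsProbMass μ → b6 μ ≤ sixPowMinusSix)
    × ((ε : ℚ) → 0ℚ < ε →
    Σ ℕ (λ n → Σ (Fin n → Fin n → ℚ) (λ μ → IsProbMass μ × (sixPowMinusSix - ε < b6 μ))))
-- The supremum is attained, so one and the same hexagon serves every ε.
theorem3p5 = (λ n μ → b6≤6⁻⁶) , λ ε 0<ε →
  6 , Hexagon.μ , Hexagon.isProbMass , subst (sixPowMinusSix - ε <_) (sym Hexagon.b6≡6⁻⁶)
    (subst (sixPowMinusSix - ε <_) (+-identityʳ sixPowMinusSix)
      (+-monoʳ-< sixPowMinusSix (neg-antimono-< 0<ε)))
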